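{- Let $k \ge 1$ be any constant integer. Then there is an explicitly given family of Boolean functions $F_n$ on $n \cdot \log^{4k-4}(n)$ variables, each computed by a monotone DNF of width $O(\log^{2k-1}(n))$ and size $2^{O(\log^{2k}(n))}$, such that $$\widetilde{\deg}(F_n) = \Omega\!\left(n^{1-2^{k-1}/3^k} \cdot \log^{3 - 2^{k+2}/3^{k}}(n)\right).$$
   Context: Boolean functions map $\{ -1,1\}^m \to \{ -1,1\}$, with $-1$ interpreted as TRUE and $+1$ as FALSE. The approximate degree $\widetilde{\deg}(f)$ of $f$ is the least degree of a real polynomial $p$ with $|p(x)-f(x)| \le 1/3$ for all $x$ in the domain of $f$. A monotone DNF is an $\mathsf{OR}$ of $\mathsf{AND}$s of unnegated variables; its width is the maximum number of variables in a clause and its size is the number of clauses. Logarithms are base 2.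
   Formalization: The approximate degree is taken over polynomials with rational rather than real coefficients (the same value, since a system of linear inequalities with rational data that has a real solution has a rational one); log is rounded down to an integer. -}

module Defs where

open import Data.Bool using (Bool; true; false; if_then_else_)
open import Data.Nat as ℕ using (ℕ; _^_; _≤_)
open import Data.Nat.Logarithm using (⌊log₂_⌋)
open import Data.Fin using (Fin)
open import Data.List using (List; length; foldr; map)
open import Data.Bool.ListAction using (any; all)
open import Data.List.Relation.Unary.All using (All)
open import Data.Product using (_×_; _,_; Σ)
open import Data.Integer using (+_; -[1+_])
open import Data.Rational using (ℚ; _+_; _*_; _-_; ∣_∣; _/_; 0ℚ; 1ℚ)
open import Data.Rational using () renaming (_≤_ to _≤ℚ_)

-- Boolean inputs / outputs.  We encode the two-element set {-1,1} by Bool,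
-- with  true  = TRUE = -1  and  false = FALSE = +1  (the paper's convention).
-- A Boolean function on m variables  {-1,1}^m → {-1,1}:
BoolFun : ℕ → Set
BoolFun m = (Fin m → Bool) → Bool

val : Bool → ℚ
val true  = -[1+ 0 ] / 1
val false = 1ℚ

lg : ℕ → ℕ
lg n = ⌊log₂ n ⌋

Clause : ℕ → Set
Clause m = List (Fin m)

MDNF : ℕ → Set
MDNF m = List (Clause m)

evalDNF : ∀ {m} → MDNF m → BoolFun m
evalDNF D x = any (λ c → all x c) D

widthAtMost : ∀ {m} → ℕ → MDNF m → Set
widthAtMost w D = All (λ c → length c ≤ w) D

sizeAtMost : ∀ {m} → ℕ → MDNF m → Set
sizeAtMost s D = length D ≤ s

-- Real polynomials in m variables, represented as finite sums of terms
-- coefficient * x_{i1} * ... * x_{ir}  (monomial given as a list of variables,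
-- repetitions allowed).  Coefficients are rationals.
Poly : ℕ → Set
Poly m = List (ℚ × List (Fin m))

evalMono : ∀ {m} → List (Fin m) → (Fin m → Bool) → ℚ
evalMono is x = foldr (λ i r → val (x i) * r) 1ℚ is

evalPoly : ∀ {m} → Poly m → (Fin m → Bool) → ℚ
evalPoly p x = foldr (λ t r → Data.Product.proj₁ t * evalMono (Data.Product.proj₂ t) x + r) 0ℚ p

degAtMost : ∀ {m} → ℕ → Poly m → Set
degAtMost d p = All (λ t → length (Data.Product.proj₂ t) ≤ d) p

ApproxDegAtMost : ∀ {m} → BoolFun m → ℕ → Set
ApproxDegAtMost {m} f d =
  Σ (Poly m) λ p → degAtMost d p ×
    ((x : Fin m → Bool) → ∣ evalPoly p x - val (f x) ∣ ≤ℚ (+ 1 / 3))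

{-# OPTIONS --safe #-}
module Submission where

-- Polynomial slack makes the logarithms irrelevant: for every a > 0 there are monotone DNFs of
-- constant width and polynomial size on n variables with approximate degree n^(1 - a).
--
-- One step improves a to about a / (1 + a / 3), starting from a single variable (a = 1).  Given a
-- hard DNF f on R variables, take N items, each empty or one of the R m pairs (r , j), j < m, with m
-- constant, and let F be f with its variable r replaced by "each of (r , 0), …, (r , m - 1)
-- occurs among the items".
-- Suppose p approximates F.  There are distributions μ-true, μ-false on ℕ with equal moments up
-- to order h, such that μ-true avoids 0, μ-false is almost concentrated at 0 and both have small
-- support and mean.  For u ∈ {true, false}^R draw counts z(r , j) from μ-(u r) and then
-- independent items, with value v with probability z v / X.  The expectation of p is a polynomial
-- in u, and since the moments agree a monomial depends on u r only if it has degree more than h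
-- in block r; so the degree drops by the factor h.  The random input satisfies F exactly when
-- u satisfies f, up to a small probability, so this polynomial approximates f.
-- If the counts add up to more than X, the "probabilities" are signed; there the expectation is
-- still a polynomial of degree deg p in z, hence at most exponential in deg p · |z| / X, and the
-- tails of μ compensate for that.

open import Defs

-- A step multiplies the degree by `e = t ^ B` and the number of variables by the same factor up to
-- `t ^ 4`, so their quotient `t ^ A` is nearly kept while both grow. `B` is limited by the support
-- of the distributions: h moments are matched on 2h + 1 nodes spread quadratically up to c h², and
-- c of order h t keeps the mass off 0 at most 1 / t. With h = 2e the support has length of order e³
-- t, which must stay below `H = t ^ (A + 1)`; this is where the third in the gain comes from.
--
-- The AND over m pairs makes a mass of 1 / t acceptable: a row that should be false is decoded as
-- true with probability at most 1 / t ^ m, and m is taken large enough for a union bound over all R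
-- rows.
--
-- The allowed error is 1 - 1 / g instead of 1 / 3. Averaging makes an approximation slightly worse,
-- and the passage from g to 2g pays for this; since hardness is carried along for every g, it
-- survives any constant number of steps.
--
-- All parameters are powers of one t, so the requirements of a step compare exponents of t, and
-- spare factors t absorb the constants.

module Amplification where

  open import Data.Bool using (Bool; true; false; not; _∧_; _∨_; _xor_; if_then_else_)
  open import Data.Bool.ListAction using (any; all)
  open import Data.Bool.Properties using (∧-assoc; ∧-comm; ∧-distribʳ-∨; ∨-assoc)
  open import Data.Fin as Fin using (Fin; zero; suc; toℕ; fromℕ<; combine; quotient; remainder; finToFun; funToFin; inject≤)
  open import Data.Fin.Properties using (toℕ-fromℕ<; toℕ<n; toℕ-inject≤; toℕ-injective; remQuot-combine; combine-remQuot; funToFin-finToFin; inject≤-injective)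
  import Data.Integer as ℤ
  open import Data.List using (List; []; _∷_; _++_; foldr; map; length; concatMap; tabulate; allFin; mapMaybe)
  open import Data.List.Properties using (length-map; length-++; length-tabulate; length-mapMaybe)
  open import Data.List.Relation.Unary.All as All using (All; []; _∷_)
  import Data.List.Relation.Unary.All.Properties as All
  open import Data.Maybe using (Maybe; just; nothing; maybe′)
  open import Data.Nat as ℕ using (ℕ; zero; suc; z≤n; s≤s)
  open import Data.Nat.Combinatorics using (_C_; nCk+nC[k+1]≡[n+1]C[k+1]; k>n⇒nCk≡0)
  open import Data.Nat.DivMod using (m≡m%n+[m/n]*n; m%n<n)
  import Data.Nat.Properties as ℕ
  import Data.Nat.Tactic.RingSolver as ℕ-Solver
  open import Data.Product using (Σ; ∃; _×_; _,_; proj₁; proj₂)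
  open import Data.Rational
  open import Data.Rational.Properties
  open import Data.Sum using (_⊎_; inj₁; inj₂)
  open import Data.Unit using (⊤; tt)
  open import Data.Vec using (Vec; []; _∷_; lookup; sum)
  open import Function using (_∘_)
  open import Level using (0ℓ)
  open import Relation.Binary.PropositionalEquality
  open import Relation.Nullary using (does; yes; no; contradiction)
  open import Relation.Nullary.Decidable using (dec⇒maybe)
  open import Tactic.RingSolver using (solve-∀)
  open import Tactic.RingSolver.Core.AlmostCommutativeRing using (AlmostCommutativeRing; fromCommutativeRing)

  -- Rational arithmetic

  ring : AlmostCommutativeRing 0ℓ 0ℓ
  ring = fromCommutativeRing +-*-commutativeRing λ x → dec⇒maybe (0ℚ ≟ x)

  2ℚ : ℚ
  2ℚ = 1ℚ + 1ℚ

  ≤-by : ∀ {p q} r → 0ℚ ≤ r → p + r ≡ q → p ≤ q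
  ≤-by {p} r 0≤r refl = subst (_≤ p + r) (+-identityʳ p) (+-monoʳ-≤ p 0≤r)

  0≤q-p : ∀ {p q} → p ≤ q → 0ℚ ≤ q - p
  0≤q-p {p} {q} p≤q = subst (_≤ q - p) (+-inverseʳ p) (+-monoˡ-≤ (- p) p≤q)

  0≤1 : 0ℚ ≤ 1ℚ
  0≤1 = nonNegative⁻¹ 1ℚ

  0≤2 : 0ℚ ≤ 2ℚ
  0≤2 = nonNegative⁻¹ 2ℚ

  0≤+ : ∀ {p q} → 0ℚ ≤ p → 0ℚ ≤ q → 0ℚ ≤ p + q
  0≤+ = +-mono-≤

  *-monoˡ : ∀ {p q r} → 0ℚ ≤ r → p ≤ q → r * p ≤ r * q
  *-monoˡ {r = r} 0≤r = *-monoˡ-≤-nonNeg r {{nonNegative 0≤r}}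

  *-monoʳ : ∀ {p q r} → 0ℚ ≤ r → p ≤ q → p * r ≤ q * r
  *-monoʳ {r = r} 0≤r = *-monoʳ-≤-nonNeg r {{nonNegative 0≤r}}

  0≤* : ∀ {p q} → 0ℚ ≤ p → 0ℚ ≤ q → 0ℚ ≤ p * q
  0≤* {p} {q} 0≤p 0≤q = subst (_≤ p * q) (*-zeroʳ p) (*-monoˡ 0≤p 0≤q)

  *-mono : ∀ {p p′ q q′} → 0ℚ ≤ p → 0ℚ ≤ q′ → p ≤ p′ → q ≤ q′ → p * q ≤ p′ * q′
  *-mono 0≤p 0≤q′ p≤p′ q≤q′ = ≤-trans (*-monoˡ 0≤p q≤q′) (*-monoʳ 0≤q′ p≤p′)

  p≤∣p∣ : ∀ p → p ≤ ∣ p ∣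
  p≤∣p∣ p with ≤-total 0ℚ p
  ... | inj₁ 0≤p = ≤-reflexive (sym (0≤p⇒∣p∣≡p 0≤p))
  ... | inj₂ p≤0 = ≤-trans p≤0 (0≤∣p∣ p)

  ∣p∣≤ : ∀ {p q} → p ≤ q → - p ≤ q → ∣ p ∣ ≤ q
  ∣p∣≤ {p} p≤q -p≤q with ∣p∣≡p∨∣p∣≡-p p
  ... | inj₁ e = subst (_≤ _) (sym e) p≤q
  ... | inj₂ e = subst (_≤ _) (sym e) -p≤q

  -p≤∣p∣ : ∀ p → - p ≤ ∣ p ∣
  -p≤∣p∣ p = subst (- p ≤_) (∣-p∣≡∣p∣ p) (p≤∣p∣ (- p))

  -- By recursion, unlike + n / 1, so that it computes on successors.
  ι : ℕ → ℚ
  ι zero    = 0ℚ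
  ι (suc n) = 1ℚ + ι n

  ι-+ : ∀ m n → ι (m ℕ.+ n) ≡ ι m + ι n
  ι-+ zero    n = sym (+-identityˡ (ι n))
  ι-+ (suc m) n = trans (cong (1ℚ +_) (ι-+ m n)) (sym (+-assoc 1ℚ (ι m) (ι n)))

  ι-* : ∀ m n → ι (m ℕ.* n) ≡ ι m * ι n
  ι-* zero    n = sym (*-zeroˡ (ι n))
  ι-* (suc m) n = trans (ι-+ n (m ℕ.* n)) (trans (cong (ι n +_) (ι-* m n)) (lemma (ι m) (ι n)))
    where
    lemma : ∀ a b → b + a * b ≡ (1ℚ + a) * b
    lemma = solve-∀ ring

  0≤ι : ∀ n → 0ℚ ≤ ι n
  0≤ι zero    = ≤-refl
  0≤ι (suc n) = 0≤+ 0≤1 (0≤ι n)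

  ι-mono : ∀ {m n} → m ℕ.≤ n → ι m ≤ ι n
  ι-mono {n = n} z≤n = 0≤ι n
  ι-mono (s≤s m≤n)   = +-monoʳ-≤ 1ℚ (ι-mono m≤n)

  infixr 8 _^_
  _^_ : ℚ → ℕ → ℚ
  p ^ zero  = 1ℚ
  p ^ suc n = p * p ^ n

  0≤^ : ∀ {p} → 0ℚ ≤ p → ∀ n → 0ℚ ≤ p ^ n
  0≤^ 0≤p zero    = 0≤1
  0≤^ 0≤p (suc n) = 0≤* 0≤p (0≤^ 0≤p n)

  ^-+ : ∀ p m n → p ^ (m ℕ.+ n) ≡ p ^ m * p ^ n
  ^-+ p zero    n = sym (*-identityˡ (p ^ n))
  ^-+ p (suc m) n = trans (cong (p *_) (^-+ p m n)) (sym (*-assoc p (p ^ m) (p ^ n)))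

  ^-*-distrib : ∀ p q n → (p * q) ^ n ≡ p ^ n * q ^ n
  ^-*-distrib p q zero    = refl
  ^-*-distrib p q (suc n) = trans (cong (p * q *_) (^-*-distrib p q n)) (lemma p q (p ^ n) (q ^ n))
    where
    lemma : ∀ a b c d → a * b * (c * d) ≡ a * c * (b * d)
    lemma = solve-∀ ring

  1^ : ∀ n → 1ℚ ^ n ≡ 1ℚ
  1^ zero    = refl
  1^ (suc n) = trans (*-identityˡ (1ℚ ^ n)) (1^ n)

  ^-^ : ∀ p m n → p ^ (m ℕ.* n) ≡ (p ^ n) ^ m
  ^-^ p zero    n = refl
  ^-^ p (suc m) n = trans (^-+ p n (m ℕ.* n)) (cong (p ^ n *_) (^-^ p m n))

  ^-mono : ∀ {p q} → 0ℚ ≤ p → p ≤ q → ∀ n → p ^ n ≤ q ^ n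
  ^-mono 0≤p p≤q zero    = ≤-refl
  ^-mono 0≤p p≤q (suc n) = *-mono 0≤p (0≤^ (≤-trans 0≤p p≤q) n) p≤q (^-mono 0≤p p≤q n)

  1≤^ : ∀ {p} → 1ℚ ≤ p → ∀ n → 1ℚ ≤ p ^ n
  1≤^ {p} 1≤p n = subst (_≤ p ^ n) (1^ n) (^-mono 0≤1 1≤p n)

  ^-monoʳ : ∀ {p} → 1ℚ ≤ p → ∀ {m n} → m ℕ.≤ n → p ^ m ≤ p ^ n
  ^-monoʳ 1≤p {n = n} z≤n = 1≤^ 1≤p n
  ^-monoʳ 1≤p (s≤s m≤n)   = *-monoˡ (≤-trans 0≤1 1≤p) (^-monoʳ 1≤p m≤n)

  ι-^ : ∀ m n → ι (m ℕ.^ n) ≡ ι m ^ n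
  ι-^ m zero    = +-identityʳ 1ℚ
  ι-^ m (suc n) = trans (ι-* m (m ℕ.^ n)) (cong (ι m *_) (ι-^ m n))

  bernoulli : ∀ {y} → 0ℚ ≤ y → ∀ n → 1ℚ + ι n * y ≤ (1ℚ + y) ^ n
  bernoulli {y} 0≤y zero    = ≤-reflexive (trans (cong (1ℚ +_) (*-zeroˡ y)) (+-identityʳ 1ℚ))
  bernoulli {y} 0≤y (suc n) = ≤-trans
    (≤-by (ι n * (y * y)) (0≤* (0≤ι n) (0≤* 0≤y 0≤y)) (lemma (ι n) y))
    (*-monoˡ (0≤+ 0≤1 0≤y) (bernoulli 0≤y n))
    where
    lemma : ∀ n y → 1ℚ + (1ℚ + n) * y + n * (y * y) ≡ (1ℚ + y) * (1ℚ + n * y)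
    lemma = solve-∀ ring

  -- One more factor 1 + y adds y (1 + 2 n y), which is at most 2 y as long as 2 n y ≤ 1. This
  -- stands in for the exponential upper bound.
  bernoulli-upper : ∀ {y} → 0ℚ ≤ y → ∀ n → 2ℚ * (ι n * y) ≤ 1ℚ → (1ℚ + y) ^ n ≤ 1ℚ + 2ℚ * (ι n * y)
  bernoulli-upper {y} 0≤y zero    _     = ≤-reflexive (sym (lemma y))
    where
    lemma : ∀ y → 1ℚ + (1ℚ + 1ℚ) * (0ℚ * y) ≡ 1ℚ
    lemma = solve-∀ ring
  bernoulli-upper {y} 0≤y (suc n) small = ≤-trans
    (*-monoˡ (0≤+ 0≤1 0≤y) (bernoulli-upper 0≤y n small′))
    (≤-by (y * (1ℚ - 2ℚ * (ι n * y))) (0≤* 0≤y (0≤q-p small′)) (lemma (ι n) y))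
    where
    small′ : 2ℚ * (ι n * y) ≤ 1ℚ
    small′ = ≤-trans (*-monoˡ 0≤2 (*-monoʳ 0≤y (≤-by {ι n} 1ℚ 0≤1 (+-comm (ι n) 1ℚ)))) small
    lemma : ∀ n y → (1ℚ + y) * (1ℚ + (1ℚ + 1ℚ) * (n * y)) + y * (1ℚ - (1ℚ + 1ℚ) * (n * y)) ≡ 1ℚ + (1ℚ + 1ℚ) * ((1ℚ + n) * y)
    lemma = solve-∀ ring

  -- Finite sums and products

  ∑ : ∀ {n} → (Fin n → ℚ) → ℚ
  ∑ {zero}  f = 0ℚ
  ∑ {suc n} f = f zero + ∑ (f ∘ suc)

  ∏ : ∀ {n} → (Fin n → ℚ) → ℚ
  ∏ {zero}  f = 1ℚ
  ∏ {suc n} f = f zero * ∏ (f ∘ suc)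

  ∑-cong : ∀ {n} {f g : Fin n → ℚ} → (∀ i → f i ≡ g i) → ∑ f ≡ ∑ g
  ∑-cong {zero}  e = refl
  ∑-cong {suc n} e = cong₂ _+_ (e zero) (∑-cong (e ∘ suc))

  ∑-+ : ∀ {n} (f g : Fin n → ℚ) → ∑ (λ i → f i + g i) ≡ ∑ f + ∑ g
  ∑-+ {zero}  f g = refl
  ∑-+ {suc n} f g = trans (cong (f zero + g zero +_) (∑-+ (f ∘ suc) (g ∘ suc))) (lemma (f zero) (g zero) _ _)
    where
    lemma : ∀ a b c d → a + b + (c + d) ≡ a + c + (b + d)
    lemma = solve-∀ ring

  ∑-*ˡ : ∀ {n} a (f : Fin n → ℚ) → ∑ (λ i → a * f i) ≡ a * ∑ f
  ∑-*ˡ {zero}  a f = sym (*-zeroʳ a)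
  ∑-*ˡ {suc n} a f = trans (cong (a * f zero +_) (∑-*ˡ a (f ∘ suc))) (sym (*-distribˡ-+ a (f zero) _))

  ∑-*ʳ : ∀ {n} a (f : Fin n → ℚ) → ∑ (λ i → f i * a) ≡ ∑ f * a
  ∑-*ʳ a f = trans (∑-cong (λ i → *-comm (f i) a)) (trans (∑-*ˡ a f) (*-comm a (∑ f)))

  ∑-const : ∀ n a → ∑ {n} (λ _ → a) ≡ ι n * a
  ∑-const zero    a = sym (*-zeroˡ a)
  ∑-const (suc n) a = trans (cong (a +_) (∑-const n a)) (lemma (ι n) a)
    where
    lemma : ∀ n a → a + n * a ≡ (1ℚ + n) * a
    lemma = solve-∀ ring

  ∑-mono : ∀ {n} {f g : Fin n → ℚ} → (∀ i → f i ≤ g i) → ∑ f ≤ ∑ g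
  ∑-mono {zero}  le = ≤-refl
  ∑-mono {suc n} le = +-mono-≤ (le zero) (∑-mono (le ∘ suc))

  ∑-≤const : ∀ {n} {f : Fin n → ℚ} {a} → (∀ i → f i ≤ a) → ∑ f ≤ ι n * a
  ∑-≤const {n} {a = a} le = subst (_ ≤_) (∑-const n a) (∑-mono le)

  0≤∑ : ∀ {n} {f : Fin n → ℚ} → (∀ i → 0ℚ ≤ f i) → 0ℚ ≤ ∑ f
  0≤∑ {zero}  p = ≤-refl
  0≤∑ {suc n} p = 0≤+ (p zero) (0≤∑ (p ∘ suc))

  term≤∑ : ∀ {n} {f : Fin n → ℚ} → (∀ i → 0ℚ ≤ f i) → ∀ i → f i ≤ ∑ f
  term≤∑ {f = f} p zero    = ≤-by _ (0≤∑ (p ∘ suc)) refl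
  term≤∑ {f = f} p (suc i) = ≤-trans (term≤∑ (p ∘ suc) i) (≤-by (f zero) (p zero) (+-comm _ (f zero)))

  ∑-last : ∀ n (f : ℕ → ℚ) → ∑ {suc n} (f ∘ toℕ) ≡ ∑ {n} (f ∘ toℕ) + f n
  ∑-last zero    f = +-comm (f 0) 0ℚ
  ∑-last (suc n) f = trans (cong (f 0 +_) (∑-last n (f ∘ suc))) (sym (+-assoc (f 0) _ _))

  ∏-cong : ∀ {n} {f g : Fin n → ℚ} → (∀ i → f i ≡ g i) → ∏ f ≡ ∏ g
  ∏-cong {zero}  e = refl
  ∏-cong {suc n} e = cong₂ _*_ (e zero) (∏-cong (e ∘ suc))

  0≤∏ : ∀ {n} {f : Fin n → ℚ} → (∀ i → 0ℚ ≤ f i) → 0ℚ ≤ ∏ f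
  0≤∏ {zero}  p = 0≤1
  0≤∏ {suc n} p = 0≤* (p zero) (0≤∏ (p ∘ suc))

  ∏-mono : ∀ {n} {f g : Fin n → ℚ} → (∀ i → 0ℚ ≤ f i) → (∀ i → f i ≤ g i) → ∏ f ≤ ∏ g
  ∏-mono {zero}  p le = ≤-refl
  ∏-mono {suc n} p le = *-mono (p zero) (0≤∏ (λ i → ≤-trans (p (suc i)) (le (suc i)))) (le zero) (∏-mono (p ∘ suc) (le ∘ suc))

  ∏-const : ∀ n a → ∏ {n} (λ _ → a) ≡ a ^ n
  ∏-const zero    a = refl
  ∏-const (suc n) a = cong (a *_) (∏-const n a)

  -- Finite differences and binomial coefficients

  -- Below n G says that G : ℕ → ℚ is a polynomial of degree less than n.
  δ : (ℕ → ℚ) → ℕ → ℚ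
  δ G i = G i - G (suc i)

  Below : ℕ → (ℕ → ℚ) → Set
  Below zero    G = ∀ i → G i ≡ 0ℚ
  Below (suc n) G = Below n (δ G)

  below-cong : ∀ n {G G′} → (∀ i → G i ≡ G′ i) → Below n G → Below n G′
  below-cong zero    e G₀ i = trans (sym (e i)) (G₀ i)
  below-cong (suc n) e = below-cong n (λ i → cong₂ _-_ (e i) (e (suc i)))

  below-0 : ∀ n {G} → (∀ i → G i ≡ 0ℚ) → Below n G
  below-0 zero    G₀ = G₀
  below-0 (suc n) G₀ = below-0 n (λ i → cong₂ _-_ (G₀ i) (G₀ (suc i)))

  below-+ : ∀ n {G G′} → Below n G → Below n G′ → Below n (λ i → G i + G′ i)
  below-+ zero    p q i = cong₂ _+_ (p i) (q i)
  below-+ (suc n) {G} {G′} p q = below-cong n (λ i → lemma (G i) (G (suc i)) (G′ i) (G′ (suc i))) (below-+ n p q)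
    where
    lemma : ∀ a b c d → a - b + (c - d) ≡ a + c - (b + d)
    lemma = solve-∀ ring

  below-* : ∀ n a {G} → Below n G → Below n (λ i → a * G i)
  below-* zero    a p i = trans (cong (a *_) (p i)) (*-zeroʳ a)
  below-* (suc n) a {G} p = below-cong n (λ i → lemma a (G i) (G (suc i))) (below-* n a p)
    where
    lemma : ∀ a b c → a * (b - c) ≡ a * b - a * c
    lemma = solve-∀ ring

  below-shift : ∀ n {G} → Below n G → Below n (G ∘ suc)
  below-shift zero    p = p ∘ suc
  below-shift (suc n) p = below-shift n p

  below-suc : ∀ n {G} → Below n G → Below (suc n) G
  below-suc zero    p = below-0 1 p
  below-suc (suc n) p = below-suc n p

  below-≤ : ∀ {m n G} → m ℕ.≤ n → Below m G → Below n G
  below-≤ {n = n} z≤n p = below-0 n p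
  below-≤ (s≤s m≤n)   p = below-≤ m≤n p

  below-const : ∀ a → Below 1 (λ _ → a)
  below-const a _ = +-inverseʳ a

  -- The discrete product rule: the difference of i G(i) is i times the difference of G, minus G(i +
  -- 1).
  below-ι* : ∀ n {G} → Below n G → Below (suc n) (λ i → ι i * G i)
  below-ι* zero    {G} p = below-0 1 (λ i → trans (cong (ι i *_) (p i)) (*-zeroʳ (ι i)))
  below-ι* (suc n) {G} p = below-cong (suc n) (λ i → lemma (ι i) (G i) (G (suc i)))
    (below-+ (suc n) {λ i → ι i * δ G i} {λ i → - 1ℚ * G (suc i)} (below-ι* n p) (below-* (suc n) (- 1ℚ) {G ∘ suc} (below-shift n p)))
    where
    lemma : ∀ i a b → i * (a - b) + - 1ℚ * b ≡ i * a - (1ℚ + i) * b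
    lemma = solve-∀ ring

  below-affine* : ∀ n a {G} → Below n G → Below (suc n) (λ i → (ι i - a) * G i)
  below-affine* n a {G} p = below-cong (suc n) (λ i → lemma (ι i) a (G i))
    (below-+ (suc n) {λ i → ι i * G i} {λ i → (- a) * G i} (below-ι* n p) (below-* (suc n) (- a) {G} (below-suc n p)))
    where
    lemma : ∀ i a b → i * b + (- a) * b ≡ (i - a) * b
    lemma = solve-∀ ring

  iterδ : ℕ → (ℕ → ℚ) → ℚ
  iterδ zero    G = G 0
  iterδ (suc n) G = iterδ n (δ G)

  iterδ-below : ∀ n {G} → Below n G → iterδ n G ≡ 0ℚ
  iterδ-below zero    p = p 0
  iterδ-below (suc n) p = iterδ-below n p

  signedC : ℕ → ℕ → ℚ
  signedC n j = (- 1ℚ) ^ j * ι (n C j)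

  signedC-pascal : ∀ n j → signedC (suc n) (suc j) ≡ signedC n (suc j) - signedC n j
  signedC-pascal n j = trans
    (cong (λ x → (- 1ℚ) ^ suc j * x) (trans (cong ι (sym (nCk+nC[k+1]≡[n+1]C[k+1] n j))) (ι-+ (n C j) (n C suc j))))
    (lemma ((- 1ℚ) ^ j) (ι (n C j)) (ι (n C suc j)))
    where
    lemma : ∀ s a b → - 1ℚ * s * (a + b) ≡ - 1ℚ * s * b - s * a
    lemma = solve-∀ ring

  signedC-beyond : ∀ n → signedC n (suc n) ≡ 0ℚ
  signedC-beyond n = trans (cong (λ x → (- 1ℚ) ^ suc n * ι x) (k>n⇒nCk≡0 (ℕ.n<1+n n))) (*-zeroʳ ((- 1ℚ) ^ suc n))

  -- The binomial expansion of the n-th difference at 0, by Pascal's rule. Together with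
  -- `iterδ-below` it makes the signed binomials orthogonal to all polynomials of degree less than
  -- n.
  iterδ-∑ : ∀ n G → iterδ n G ≡ ∑ {suc n} (λ j → signedC n (toℕ j) * G (toℕ j))
  iterδ-∑ zero    G = lemma (G 0)
    where
    lemma : ∀ a → a ≡ 1ℚ * (1ℚ + 0ℚ) * a + 0ℚ
    lemma = solve-∀ ring
  iterδ-∑ (suc n) G = begin
    iterδ n (δ G)
      ≡⟨ iterδ-∑ n (δ G) ⟩
    ∑ {suc n} (λ j → a (toℕ j) * (G (toℕ j) - G (suc (toℕ j))))
      ≡⟨ ∑-cong {suc n} (λ j → split₁ (a (toℕ j)) (G (toℕ j)) (G (suc (toℕ j)))) ⟩
    ∑ {suc n} (λ j → a (toℕ j) * G (toℕ j) + (- a (toℕ j)) * G (suc (toℕ j)))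
      ≡⟨ ∑-+ {suc n} (λ j → a (toℕ j) * G (toℕ j)) (λ j → (- a (toℕ j)) * G (suc (toℕ j))) ⟩
    ∑ {suc n} (λ j → a (toℕ j) * G (toℕ j)) + R
      ≡⟨ cong (_+ R) extend ⟩
    a 0 * G 0 + ∑ {suc n} (λ j → a (suc (toℕ j)) * G (suc (toℕ j))) + R
      ≡⟨ +-assoc (a 0 * G 0) _ R ⟩
    a 0 * G 0 + (∑ {suc n} (λ j → a (suc (toℕ j)) * G (suc (toℕ j))) + R)
      ≡⟨ cong (a 0 * G 0 +_) (sym (∑-+ {suc n} (λ j → a (suc (toℕ j)) * G (suc (toℕ j))) (λ j → (- a (toℕ j)) * G (suc (toℕ j))))) ⟩
    a 0 * G 0 + ∑ {suc n} (λ j → a (suc (toℕ j)) * G (suc (toℕ j)) + (- a (toℕ j)) * G (suc (toℕ j)))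
      ≡⟨ cong (a 0 * G 0 +_) (∑-cong {suc n} (λ j → trans (split₂ (a (suc (toℕ j))) (a (toℕ j)) (G (suc (toℕ j))))
                                        (cong (_* G (suc (toℕ j))) (sym (signedC-pascal n (toℕ j)))))) ⟩
    a 0 * G 0 + ∑ {suc n} (λ j → signedC (suc n) (suc (toℕ j)) * G (suc (toℕ j))) ∎
    where
    open ≡-Reasoning
    a = signedC n
    R = ∑ {suc n} (λ j → (- a (toℕ j)) * G (suc (toℕ j)))
    split₁ : ∀ a b c → a * (b - c) ≡ a * b + (- a) * c
    split₁ = solve-∀ ring
    split₂ : ∀ a b c → a * c + (- b) * c ≡ (a - b) * c
    split₂ = solve-∀ ring
    extend : ∑ {suc n} (λ j → a (toℕ j) * G (toℕ j)) ≡ a 0 * G 0 + ∑ {suc n} (λ j → a (suc (toℕ j)) * G (suc (toℕ j)))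
    extend = sym (trans (∑-last (suc n) (λ j → a j * G j))
      (trans (cong (∑ {suc n} (λ j → a (toℕ j) * G (toℕ j)) +_)
               (trans (cong (_* G (suc n)) (signedC-beyond n)) (*-zeroˡ (G (suc n)))))
             (+-identityʳ _)))

  -- The rule (j + 1) C(n, j + 1) = (n - j) C(n, j), with the subtraction moved to the other side.
  -- It compares neighbouring binomials.
  C-absorption : ∀ n j → suc j ℕ.* (n C suc j) ℕ.+ j ℕ.* (n C j) ≡ n ℕ.* (n C j)
  C-absorption zero    zero    = refl
  C-absorption zero    (suc j) = cong₂ ℕ._+_ (ℕ.*-zeroʳ j) (ℕ.*-zeroʳ j)
  C-absorption (suc n) zero    = begin
    1 ℕ.* (suc n C 1) ℕ.+ 0      ≡⟨ cong (λ x → 1 ℕ.* x ℕ.+ 0) (sym (nCk+nC[k+1]≡[n+1]C[k+1] n 0)) ⟩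
    1 ℕ.* (1 ℕ.+ n C 1) ℕ.+ 0    ≡⟨ arith (n C 1) ⟩
    1 ℕ.+ (1 ℕ.* (n C 1) ℕ.+ 0)  ≡⟨ cong suc (C-absorption n 0) ⟩
    suc n ℕ.* 1                  ∎
    where
    open ≡-Reasoning
    arith : ∀ x → 1 ℕ.* (1 ℕ.+ x) ℕ.+ 0 ≡ 1 ℕ.+ (1 ℕ.* x ℕ.+ 0)
    arith = ℕ-Solver.solve-∀
  C-absorption (suc n) (suc j) = begin
    suc (suc j) ℕ.* (suc n C suc (suc j)) ℕ.+ suc j ℕ.* (suc n C suc j)
      ≡⟨ cong₂ (λ x y → suc (suc j) ℕ.* x ℕ.+ suc j ℕ.* y) (sym (nCk+nC[k+1]≡[n+1]C[k+1] n (suc j))) (sym (nCk+nC[k+1]≡[n+1]C[k+1] n j)) ⟩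
    suc (suc j) ℕ.* (b ℕ.+ c) ℕ.+ suc j ℕ.* (a ℕ.+ b)
      ≡⟨ arith₁ j a b c ⟩
    (suc (suc j) ℕ.* c ℕ.+ suc j ℕ.* b) ℕ.+ (suc j ℕ.* b ℕ.+ j ℕ.* a) ℕ.+ (a ℕ.+ b)
      ≡⟨ cong₂ (λ x y → x ℕ.+ y ℕ.+ (a ℕ.+ b)) (C-absorption n (suc j)) (C-absorption n j) ⟩
    n ℕ.* b ℕ.+ n ℕ.* a ℕ.+ (a ℕ.+ b)
      ≡⟨ arith₂ n a b ⟩
    suc n ℕ.* (a ℕ.+ b)
      ≡⟨ cong (suc n ℕ.*_) (nCk+nC[k+1]≡[n+1]C[k+1] n j) ⟩
    suc n ℕ.* (suc n C suc j) ∎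
    where
    open ≡-Reasoning
    a = n C j
    b = n C suc j
    c = n C suc (suc j)
    arith₁ : ∀ j a b c → suc (suc j) ℕ.* (b ℕ.+ c) ℕ.+ suc j ℕ.* (a ℕ.+ b) ≡ (suc (suc j) ℕ.* c ℕ.+ suc j ℕ.* b) ℕ.+ (suc j ℕ.* b ℕ.+ j ℕ.* a) ℕ.+ (a ℕ.+ b)
    arith₁ = ℕ-Solver.solve-∀
    arith₂ : ∀ n a b → n ℕ.* b ℕ.+ n ℕ.* a ℕ.+ (a ℕ.+ b) ≡ suc n ℕ.* (a ℕ.+ b)
    arith₂ = ℕ-Solver.solve-∀

  module _ (h : ℕ) where
    private
      N = h ℕ.+ h

    C-rising : ∀ j → j ℕ.< h → N C j ℕ.≤ N C suc j
    C-rising j j<h = ℕ.*-cancelˡ-≤ (suc j) (ℕ.+-cancelʳ-≤ (j ℕ.* (N C j)) _ _ (begin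
      suc j ℕ.* (N C j) ℕ.+ j ℕ.* (N C j)      ≡⟨ ℕ.*-distribʳ-+ (N C j) (suc j) j ⟨
      (suc j ℕ.+ j) ℕ.* (N C j)                ≤⟨ ℕ.*-monoˡ-≤ (N C j) (ℕ.+-mono-≤ j<h (ℕ.<⇒≤ j<h)) ⟩
      N ℕ.* (N C j)                            ≡⟨ C-absorption N j ⟨
      suc j ℕ.* (N C suc j) ℕ.+ j ℕ.* (N C j)  ∎))
      where open ℕ.≤-Reasoning

    C-falling : ∀ j → h ℕ.≤ j → N C suc j ℕ.≤ N C j
    C-falling j h≤j = ℕ.*-cancelˡ-≤ (suc j) (ℕ.+-cancelʳ-≤ (j ℕ.* (N C j)) _ _ (begin
      suc j ℕ.* (N C suc j) ℕ.+ j ℕ.* (N C j)  ≡⟨ C-absorption N j ⟩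
      N ℕ.* (N C j)                            ≤⟨ ℕ.*-monoˡ-≤ (N C j) (ℕ.+-mono-≤ (ℕ.m≤n⇒m≤1+n h≤j) h≤j) ⟩
      (suc j ℕ.+ j) ℕ.* (N C j)                ≡⟨ ℕ.*-distribʳ-+ (N C j) (suc j) j ⟩
      suc j ℕ.* (N C j) ℕ.+ j ℕ.* (N C j)      ∎))
      where open ℕ.≤-Reasoning

    -- Division by the central binomial then brings all signed binomials into [-1, 1].
    C≤central : ∀ j → N C j ℕ.≤ N C h
    C≤central j with ℕ.≤-total j h
    ... | inj₁ j≤h = up (h ℕ.∸ j) j (ℕ.m+[n∸m]≡n j≤h)
      where
      up : ∀ d j → j ℕ.+ d ≡ h → N C j ℕ.≤ N C h
      up zero    j e = ℕ.≤-reflexive (cong (N C_) (trans (sym (ℕ.+-identityʳ j)) e))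
      up (suc d) j e = ℕ.≤-trans (C-rising j (subst (j ℕ.<_) e (ℕ.m<m+n j (s≤s z≤n)))) (up d (suc j) (trans (sym (ℕ.+-suc j d)) e))
    ... | inj₂ h≤j = subst (λ j → N C j ℕ.≤ N C h) (ℕ.m+[n∸m]≡n h≤j) (down (j ℕ.∸ h))
      where
      down : ∀ d → N C (h ℕ.+ d) ℕ.≤ N C h
      down zero    = ℕ.≤-reflexive (cong (N C_) (ℕ.+-identityʳ h))
      down (suc d) = ℕ.≤-trans (ℕ.≤-trans (ℕ.≤-reflexive (cong (N C_) (ℕ.+-suc h d))) (C-falling (h ℕ.+ d) (ℕ.m≤m+n h d))) (down d)

    0<C : ∀ j → j ℕ.≤ N → 1 ℕ.≤ N C j
    0<C j j≤N = go N j j≤N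
      where
      go : ∀ n j → j ℕ.≤ n → 1 ℕ.≤ n C j
      go n       zero    _         = s≤s z≤n
      go (suc n) (suc j) (s≤s j≤n) = ℕ.≤-trans (go n j j≤n) (ℕ.≤-trans (ℕ.m≤m+n (n C j) (n C suc j)) (ℕ.≤-reflexive (nCk+nC[k+1]≡[n+1]C[k+1] n j)))

  -- Expectations

  Functional : Set → Set
  Functional S = (S → ℚ) → ℚ

  -- Kept apart from `Expectation` because draws whose weights exceed 1 in total are signed: linear,
  -- but not monotone.
  record Linear {S : Set} (E : Functional S) : Set where
    field
      E-cong : ∀ {φ ψ} → (∀ s → φ s ≡ ψ s) → E φ ≡ E ψ
      E-+    : ∀ φ ψ → E (λ s → φ s + ψ s) ≡ E φ + E ψ
      E-*    : ∀ a φ → E (λ s → a * φ s) ≡ a * E φ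

    E-*ʳ : ∀ a φ → E (λ s → φ s * a) ≡ E φ * a
    E-*ʳ a φ = trans (E-cong (λ s → *-comm (φ s) a)) (trans (E-* a φ) (*-comm a (E φ)))

    E-0 : E (λ _ → 0ℚ) ≡ 0ℚ
    E-0 = trans (E-cong (λ _ → sym (*-zeroˡ 0ℚ))) (trans (E-* 0ℚ (λ _ → 0ℚ)) (*-zeroˡ (E (λ _ → 0ℚ))))

    E-∑ : ∀ {n} (φ : Fin n → S → ℚ) → E (λ s → ∑ (λ i → φ i s)) ≡ ∑ (λ i → E (φ i))
    E-∑ {zero}  φ = E-0
    E-∑ {suc n} φ = trans (E-+ (φ zero) _) (cong (E (φ zero) +_) (E-∑ (φ ∘ suc)))

  record Expectation {S : Set} (Supp : S → Set) (E : Functional S) : Set where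
    field
      linear : Linear E
      E-mono : ∀ {φ ψ} → (∀ s → Supp s → φ s ≤ ψ s) → E φ ≤ E ψ
      E-1    : E (λ _ → 1ℚ) ≡ 1ℚ

    open Linear linear public

    E-const : ∀ a → E (λ _ → a) ≡ a
    E-const a = trans (E-cong (λ _ → sym (*-identityʳ a))) (trans (E-* a (λ _ → 1ℚ)) (trans (cong (a *_) E-1) (*-identityʳ a)))

    E-≤const : ∀ {φ a} → (∀ s → Supp s → φ s ≤ a) → E φ ≤ a
    E-≤const {a = a} le = subst (_ ≤_) (E-const a) (E-mono le)

    0≤E : ∀ {φ} → (∀ s → Supp s → 0ℚ ≤ φ s) → 0ℚ ≤ E φ
    0≤E {φ} p = subst (_≤ E φ) E-0 (E-mono p)

    ∣E∣≤ : ∀ {φ ψ} → (∀ s → Supp s → ∣ φ s ∣ ≤ ψ s) → ∣ E φ ∣ ≤ E ψ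
    ∣E∣≤ {φ} {ψ} le = ∣p∣≤
      (E-mono (λ s p → ≤-trans (p≤∣p∣ (φ s)) (le s p)))
      (subst (_≤ E ψ) (trans (E-* (- 1ℚ) φ) (minus (E φ)))
        (E-mono (λ s p → ≤-trans (≤-reflexive (minus (φ s))) (≤-trans (-p≤∣p∣ (φ s)) (le s p)))))
      where
      minus : ∀ x → - 1ℚ * x ≡ - x
      minus = solve-∀ ring

    E-shift : ∀ φ a → E (λ s → φ s - a) ≡ E φ - a
    E-shift φ a = trans (E-+ φ (λ _ → - a)) (cong (E φ +_) (E-const (- a)))

  ∑-linear : ∀ {S : Set} {n} (w : Fin n → ℚ) (x : Fin n → S) → Linear (λ φ → ∑ (λ j → w j * φ (x j)))
  ∑-linear w x = record
    { E-cong = λ e → ∑-cong (λ j → cong (w j *_) (e (x j)))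
    ; E-+    = λ φ ψ → trans (∑-cong (λ j → *-distribˡ-+ (w j) (φ (x j)) (ψ (x j)))) (∑-+ (λ j → w j * φ (x j)) (λ j → w j * ψ (x j)))
    ; E-*    = λ a φ → trans (∑-cong (λ j → lemma (w j) a (φ (x j)))) (∑-*ˡ a (λ j → w j * φ (x j)))
    }
    where
    lemma : ∀ w a b → w * (a * b) ≡ a * (w * b)
    lemma = solve-∀ ring

  -- Points of weight 0 may lie outside the support; this is how a distribution listed over all
  -- nodes can avoid the node 0.
  ∑-expectation : ∀ {S : Set} {Supp : S → Set} {n} (w : Fin n → ℚ) (x : Fin n → S) →
    (∀ j → 0ℚ ≤ w j) → ∑ w ≡ 1ℚ → (∀ j → w j ≡ 0ℚ ⊎ Supp (x j)) →
    Expectation Supp (λ φ → ∑ (λ j → w j * φ (x j)))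
  ∑-expectation {Supp = Supp} w x 0≤w total supp = record
    { linear = ∑-linear w x
    ; E-mono = λ le → ∑-mono (λ j → step j le (supp j))
    ; E-1    = trans (∑-cong (λ j → *-identityʳ (w j))) total
    }
    where
    step : ∀ j {φ ψ : _ → ℚ} → (∀ s → Supp s → φ s ≤ ψ s) → w j ≡ 0ℚ ⊎ Supp (x j) → w j * φ (x j) ≤ w j * ψ (x j)
    step j {φ} {ψ} le (inj₁ e) = ≤-reflexive (trans (cong (_* φ (x j)) e) (trans (*-zeroˡ (φ (x j))) (sym (trans (cong (_* ψ (x j)) e) (*-zeroˡ (ψ (x j)))))))
    step j le (inj₂ s) = *-monoˡ (0≤w j) (le (x j) s)

  Π : ∀ {S : Set} {N} → (Fin N → Functional S) → Functional (Vec S N)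
  Π {N = zero}  E φ = φ []
  Π {N = suc N} E φ = E zero (λ s → Π (E ∘ suc) (λ v → φ (s ∷ v)))

  module _ {S : Set} where

    Π-linear : ∀ {N} {E : Fin N → Functional S} → (∀ i → Linear (E i)) → Linear (Π E)
    Π-linear {zero}  L = record { E-cong = λ e → e [] ; E-+ = λ _ _ → refl ; E-* = λ _ _ → refl }
    Π-linear {suc N} {E} L = record
      { E-cong = λ e → L₀.E-cong (λ s → L′.E-cong (λ v → e (s ∷ v)))
      ; E-+    = λ φ ψ → trans (L₀.E-cong (λ s → L′.E-+ (λ v → φ (s ∷ v)) (λ v → ψ (s ∷ v)))) (L₀.E-+ _ _)
      ; E-*    = λ a φ → trans (L₀.E-cong (λ s → L′.E-* a (λ v → φ (s ∷ v)))) (L₀.E-* a _)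
      }
      where
      module L₀ = Linear (L zero)
      module L′ = Linear (Π-linear (L ∘ suc))

    Π-expectation : ∀ {N} {Supp : Fin N → S → Set} {E : Fin N → Functional S} →
      (∀ i → Expectation (Supp i) (E i)) → Expectation (λ v → ∀ i → Supp i (lookup v i)) (Π E)
    Π-expectation {zero}  X = record
      { linear = Π-linear {zero} (Expectation.linear ∘ X)
      ; E-mono = λ le → le [] (λ ())
      ; E-1    = refl
      }
    Π-expectation {suc N} X = record
      { linear = Π-linear (Expectation.linear ∘ X)
      ; E-mono = λ le → X₀.E-mono (λ s p → X′.E-mono (λ v q → le (s ∷ v) λ { zero → p ; (suc i) → q i }))
      ; E-1    = trans (X₀.E-cong (λ _ → X′.E-1)) X₀.E-1
      }
      where
      module X₀ = Expectation (X zero)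
      module X′ = Expectation (Π-expectation (X ∘ suc))

    Π-∏ : ∀ {N} {E : Fin N → Functional S} → (∀ i → Linear (E i)) → (φ : Fin N → S → ℚ) →
      Π E (λ v → ∏ (λ i → φ i (lookup v i))) ≡ ∏ (λ i → E i (φ i))
    Π-∏ {zero}  L φ = refl
    Π-∏ {suc N} {E} L φ = trans
      (Linear.E-cong (L zero) (λ s → trans (Linear.E-* (Π-linear (L ∘ suc)) (φ zero s) _) (cong (φ zero s *_) (Π-∏ (L ∘ suc) (φ ∘ suc)))))
      (Linear.E-*ʳ (L zero) _ (φ zero))

  -- A pair of distributions with equal low moments

  inverse : ∀ p → 1ℚ ≤ p → ∃ λ i → 0ℚ ≤ i × i * p ≡ 1ℚ
  inverse p 1≤p = 1/ p , <⇒≤ (positive⁻¹ (1/ p) {{1/pos⇒pos p}}) , *-inverseˡ p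
    where
    instance
      p>0 : Positive p
      p>0 = positive (<-≤-trans (positive⁻¹ 1ℚ) 1≤p)
      p≢0 : NonZero p
      p≢0 = pos⇒nonZero p

  1≤ι : ∀ {n} → 1 ℕ.≤ n → 1ℚ ≤ ι n
  1≤ι {suc n} _ = ≤-by (ι n) (0≤ι n) refl

  recip : ℕ → ℚ
  recip zero    = 0ℚ
  recip (suc n) = proj₁ (inverse (ι (suc n)) (1≤ι {suc n} (s≤s z≤n)))

  0≤recip : ∀ n → 0ℚ ≤ recip n
  0≤recip zero    = ≤-refl
  0≤recip (suc n) = proj₁ (proj₂ (inverse (ι (suc n)) (1≤ι {suc n} (s≤s z≤n))))

  recip-ι : ∀ {n} → 1 ℕ.≤ n → recip n * ι n ≡ 1ℚ
  recip-ι {suc n} _ = proj₂ (proj₂ (inverse (ι (suc n)) (1≤ι {suc n} (s≤s z≤n))))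

  recip-antitone : ∀ {m n} → 1 ℕ.≤ m → m ℕ.≤ n → recip n ≤ recip m
  recip-antitone {m} {n} 1≤m m≤n = begin
    recip n                    ≡⟨ *-identityʳ (recip n) ⟨
    recip n * 1ℚ               ≡⟨ cong (recip n *_) (recip-ι 1≤m) ⟨
    recip n * (recip m * ι m)  ≤⟨ *-monoˡ (0≤recip n) (*-monoˡ (0≤recip m) (ι-mono m≤n)) ⟩
    recip n * (recip m * ι n)  ≡⟨ lemma (recip n) (recip m) (ι n) ⟩
    recip m * (recip n * ι n)  ≡⟨ cong (recip m *_) (recip-ι (ℕ.≤-trans 1≤m m≤n)) ⟩
    recip m * 1ℚ               ≡⟨ *-identityʳ (recip m) ⟩
    recip m                    ∎
    where
    open ≤-Reasoning
    lemma : ∀ a b c → a * (b * c) ≡ b * (a * c)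
    lemma = solve-∀ ring

  recip≤1 : ∀ n → recip n ≤ 1ℚ
  recip≤1 zero    = 0≤1
  recip≤1 (suc n) = subst (recip (suc n) ≤_) (recip-ι {suc n} (s≤s z≤n))
    (subst (_≤ recip (suc n) * ι (suc n)) (*-identityʳ (recip (suc n))) (*-monoˡ (0≤recip (suc n)) (1≤ι {suc n} (s≤s z≤n))))

  ι-∸ : ∀ {m n} → m ℕ.≤ n → ι (n ℕ.∸ m) ≡ ι n - ι m
  ι-∸ {m} {n} m≤n = trans (lemma (ι m) (ι (n ℕ.∸ m))) (cong (_- ι m) (trans (sym (ι-+ m (n ℕ.∸ m))) (cong ι (ℕ.m+[n∸m]≡n m≤n))))
    where
    lemma : ∀ a b → b ≡ a + b - a
    lemma = solve-∀ ring

  ι-dist² : ∀ j h → ι (ℕ.∣ j - h ∣ ℕ.* ℕ.∣ j - h ∣) ≡ (ι j - ι h) * (ι j - ι h)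
  ι-dist² j h with ℕ.≤-total j h
  ... | inj₁ j≤h = trans (ι-* ℕ.∣ j - h ∣ ℕ.∣ j - h ∣)
    (trans (cong (λ x → x * x) (trans (cong ι (ℕ.m≤n⇒∣m-n∣≡n∸m j≤h)) (ι-∸ j≤h))) (lemma (ι j) (ι h)))
    where
    lemma : ∀ a b → (b - a) * (b - a) ≡ (a - b) * (a - b)
    lemma = solve-∀ ring
  ... | inj₂ h≤j = trans (ι-* ℕ.∣ j - h ∣ ℕ.∣ j - h ∣)
    (cong (λ x → x * x) (trans (cong ι (ℕ.m≤n⇒∣n-m∣≡n∸m h≤j)) (ι-∸ h≤j)))

  nonzero : ℕ → ℚ
  nonzero zero    = 0ℚ
  nonzero (suc _) = 1ℚ

  sign-cases : ∀ j → (- 1ℚ) ^ j ≡ 1ℚ ⊎ (- 1ℚ) ^ j ≡ - 1ℚ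
  sign-cases zero    = inj₁ refl
  sign-cases (suc j) with sign-cases j
  ... | inj₁ e = inj₂ (cong (- 1ℚ *_) e)
  ... | inj₂ e = inj₁ (cong (- 1ℚ *_) e)

  sign-even : ∀ e → (- 1ℚ) ^ (e ℕ.+ e) ≡ 1ℚ
  sign-even e with sign-cases e
  ... | inj₁ p = trans (^-+ (- 1ℚ) e e) (cong₂ _*_ p p)
  ... | inj₂ p = trans (^-+ (- 1ℚ) e e) (cong₂ _*_ p p)

  Range : ℕ → Bool → ℕ → Set
  Range K true  z = 1 ℕ.≤ z × z ℕ.≤ K
  Range K false z = z ℕ.≤ K

  -- The two size bounds act differently. `K` only has to make single counts small against `H`,
  -- while the mean `W` enters the growth over all M counts; in the construction `W` is of order e
  -- and `K` of order e³ t.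
  record Indistinguishable (h t K W : ℕ) : Set where
    field
      μ            : Bool → Functional ℕ
      expectation  : ∀ b → Expectation (Range K b) (μ b)
      moments      : ∀ l → l ℕ.≤ h → μ true (λ z → ι z ^ l) ≡ μ false (λ z → ι z ^ l)
      concentrated : ι t * μ false nonzero ≤ 1ℚ
      mean         : ∀ b → μ b ι ≤ ι W

  -- Weighting ω by 1 / (z - 1) gives θ with z θ = θ + ω. As ω annihilates the powers below h, all
  -- moments of θ up to order h equal its total mass, so θ minus that mass placed at 1 has vanishing
  -- moments. Up to normalisation this signed measure is the difference of the two distributions: β
  -- plus a mass at 1 for `true`, and β - θ for `false`.
  module Lagrange
    (h N t k K : ℕ) (1≤t : 1 ℕ.≤ t) (h≤N : h ℕ.≤ N) (k≡ : k ≡ 2 ℕ.* (suc N ℕ.* t)) (1≤K : 1 ℕ.≤ K)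
    (node : ℕ → ℕ) (node-h : node h ≡ 0) (node≡0 : ∀ j → node j ≡ 0 → j ≡ h)
    (node-cases : ∀ j → node j ≡ 0 ⊎ ∃ λ n → node j ≡ suc n × k ℕ.≤ n)
    (node≤ : ∀ j → j ℕ.≤ N → node j ℕ.≤ K)
    (ω : ℕ → ℚ) (ω-h : ω h ≡ 1ℚ) (ω-bounds : ∀ j → ω j ≤ 1ℚ × - ω j ≤ 1ℚ)
    (∑ω : ∀ l → l ℕ.< h → ∑ {suc N} (λ j → ω (toℕ j) * ι (node (toℕ j)) ^ l) ≡ 0ℚ)
    where

    1≤k : 1 ℕ.≤ k
    1≤k = subst (1 ℕ.≤_) (sym k≡) (ℕ.*-mono-≤ {1} {2} {1} (s≤s z≤n) (ℕ.*-mono-≤ {1} {suc N} {1} {t} (s≤s z≤n) 1≤t))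

    z : Fin (suc N) → ℕ
    z j = node (toℕ j)

    -- At every node z, `ρ z` is 1 / (z - 1), including -1 at z = 0. `β` is its absolute value with
    -- the contribution of 0 removed, so that `true` avoids 0.
    ρ β : ℕ → ℚ
    ρ zero    = - 1ℚ
    ρ (suc n) = recip n
    β zero    = 0ℚ
    β (suc n) = recip n

    θ : ℕ → ℚ
    θ j = ω j * ρ (node j)

    θ-h : θ h ≡ - 1ℚ
    θ-h = trans (cong₂ _*_ ω-h (cong ρ node-h)) (*-identityˡ (- 1ℚ))

    0≤β : ∀ z → 0ℚ ≤ β z
    0≤β zero    = ≤-refl
    0≤β (suc n) = 0≤recip n

    β-node≤ : ∀ j → β (node j) ≤ recip k
    β-node≤ j with node-cases j
    ... | inj₁ e           = subst (λ z → β z ≤ recip k) (sym e) (0≤recip k)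
    ... | inj₂ (n , e , p) = subst (λ z → β z ≤ recip k) (sym e) (recip-antitone 1≤k p)

    0≤β-θ : ∀ j → 0ℚ ≤ β (node j) - ω j * ρ (node j)
    0≤β-θ j with node j in eq
    ... | zero  = subst (0ℚ ≤_) (sym (lemma (ω j))) (subst (λ j → 0ℚ ≤ ω j) (sym (node≡0 j eq)) (subst (0ℚ ≤_) (sym ω-h) 0≤1))
      where
      lemma : ∀ a → 0ℚ - a * - 1ℚ ≡ a
      lemma = solve-∀ ring
    ... | suc n = subst (0ℚ ≤_) (lemma (ω j) (recip n)) (0≤* (0≤recip n) (0≤q-p (proj₁ (ω-bounds j))))
      where
      lemma : ∀ a r → r * (1ℚ - a) ≡ r - a * r
      lemma = solve-∀ ring

    -- The factor f is any function vanishing at 0, where β - θ is not controlled by β.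
    β-θ≤2β : ∀ (f : ℕ → ℚ) → f 0 ≡ 0ℚ → (∀ z → 0ℚ ≤ f z) → ∀ j → (β (node j) - ω j * ρ (node j)) * f (node j) ≤ 2ℚ * (β (node j) * f (node j))
    β-θ≤2β f f₀ 0≤f j with node j
    ... | zero  = subst (λ y → (0ℚ - ω j * - 1ℚ) * y ≤ 2ℚ * (0ℚ * y)) (sym f₀) (≤-reflexive (lemma (ω j)))
      where
      lemma : ∀ a → (0ℚ - a * - 1ℚ) * 0ℚ ≡ (1ℚ + 1ℚ) * (0ℚ * 0ℚ)
      lemma = solve-∀ ring
    ... | suc n = ≤-by (recip n * (1ℚ - - ω j) * f (suc n)) (0≤* (0≤* (0≤recip n) (0≤q-p (proj₂ (ω-bounds j)))) (0≤f (suc n)))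
                    (lemma (ω j) (recip n) (f (suc n)))
      where
      lemma : ∀ a r f → (r - a * r) * f + r * (1ℚ - - a) * f ≡ (1ℚ + 1ℚ) * (r * f)
      lemma = solve-∀ ring

    β*node≤2 : ∀ j → β (node j) * ι (node j) ≤ 2ℚ
    β*node≤2 j with node-cases j
    ... | inj₁ e           = subst (λ z → β z * ι z ≤ 2ℚ) (sym e) (subst (_≤ 2ℚ) (sym (*-zeroˡ 0ℚ)) 0≤2)
    ... | inj₂ (n , e , p) = subst (λ z → β z * ι z ≤ 2ℚ) (sym e)
      (subst (_≤ 2ℚ) (sym (trans (lemma (recip n) (ι n)) (cong (recip n +_) (recip-ι (ℕ.≤-trans 1≤k p))))) (+-monoˡ-≤ 1ℚ (recip≤1 n)))
      where
      lemma : ∀ r n → r * (1ℚ + n) ≡ r + r * n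
      lemma = solve-∀ ring

    ρ-node : ∀ j → ρ (node j) * ι (node j) ≡ ρ (node j) + 1ℚ
    ρ-node j with node-cases j
    ... | inj₁ e           = subst (λ z → ρ z * ι z ≡ ρ z + 1ℚ) (sym e) refl
    ... | inj₂ (n , e , p) = subst (λ z → ρ z * ι z ≡ ρ z + 1ℚ) (sym e) (trans (lemma (recip n) (ι n)) (cong (recip n +_) (recip-ι (ℕ.≤-trans 1≤k p))))
      where
      lemma : ∀ r n → r * (1ℚ + n) ≡ r + r * n
      lemma = solve-∀ ring

    Θ A : ℕ → ℚ
    Θ l = ∑ (λ (j : Fin (suc N)) → θ (toℕ j) * ι (z j) ^ l)
    A l = ∑ (λ (j : Fin (suc N)) → β (z j) * ι (z j) ^ l)

    Θ-suc : ∀ l → l ℕ.< h → Θ (suc l) ≡ Θ l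
    Θ-suc l l<h = trans (∑-cong {suc N} (λ j → term (toℕ j)))
      (trans (∑-+ {suc N} (λ j → θ (toℕ j) * ι (z j) ^ l) (λ j → ω (toℕ j) * ι (z j) ^ l))
      (trans (cong (Θ l +_) (∑ω l l<h)) (+-identityʳ (Θ l))))
      where
      lemma₁ : ∀ w r x p → w * r * (x * p) ≡ w * (r * x) * p
      lemma₁ = solve-∀ ring
      lemma₂ : ∀ w r p → w * (r + 1ℚ) * p ≡ w * r * p + w * p
      lemma₂ = solve-∀ ring
      term : ∀ j → θ j * ι (node j) ^ suc l ≡ θ j * ι (node j) ^ l + ω j * ι (node j) ^ l
      term j = trans (lemma₁ (ω j) (ρ (node j)) (ι (node j)) (ι (node j) ^ l))
        (trans (cong (λ x → ω j * x * ι (node j) ^ l) (ρ-node j)) (lemma₂ (ω j) (ρ (node j)) (ι (node j) ^ l)))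

    Θ-const : ∀ l → l ℕ.≤ h → Θ l ≡ Θ 0
    Θ-const zero    _   = refl
    Θ-const (suc l) l<h = trans (Θ-suc l l<h) (Θ-const l (ℕ.<⇒≤ l<h))

    w₀ : Fin (suc N) → ℚ
    w₀ j = β (z j) - θ (toℕ j)

    T : ℚ
    T = ∑ w₀

    -- The centre h alone contributes 1, and no term is negative. Hence the normalising factor `i`
    -- never enlarges a mass.
    1≤T : 1ℚ ≤ T
    1≤T = subst (_≤ T) at-h (term≤∑ (λ j → 0≤β-θ (toℕ j)) (fromℕ< h<))
      where
      h< : h ℕ.< suc N
      h< = s≤s h≤N
      at-h : w₀ (fromℕ< h<) ≡ 1ℚ
      at-h = trans (cong (λ j → β (node j) - θ j) (toℕ-fromℕ< h<)) (cong₂ (λ a b → a - b) (cong β node-h) θ-h)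

    i : ℚ
    i = proj₁ (inverse T 1≤T)

    0≤i : 0ℚ ≤ i
    0≤i = proj₁ (proj₂ (inverse T 1≤T))

    i*T : i * T ≡ 1ℚ
    i*T = proj₂ (proj₂ (inverse T 1≤T))

    i≤1 : i ≤ 1ℚ
    i≤1 = subst (i ≤_) i*T (subst (_≤ i * T) (*-identityʳ i) (*-monoˡ 0≤i 1≤T))

    ∑β : ℚ
    ∑β = ∑ (λ (j : Fin (suc N)) → β (z j))

    0≤∑β : 0ℚ ≤ ∑β
    0≤∑β = 0≤∑ (λ j → 0≤β (z j))

    -- The choice of `k`: there are N + 1 terms of at most 1 / k each, and k = 2 (N + 1) t.
    t*2*∑β≤1 : ι t * (2ℚ * ∑β) ≤ 1ℚ
    t*2*∑β≤1 = ≤-trans (*-monoˡ (0≤ι t) (*-monoˡ 0≤2 (∑-≤const {suc N} (λ j → β-node≤ (toℕ j)))))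
      (≤-reflexive (trans (lemma (ι t) (ι (suc N)) (recip k)) (trans (cong (recip k *_) (sym ι-k)) (recip-ι 1≤k))))
      where
      ι-k : ι k ≡ 2ℚ * (ι (suc N) * ι t)
      ι-k = trans (cong ι k≡) (trans (ι-* 2 (suc N ℕ.* t)) (cong (2ℚ *_) (ι-* (suc N) t)))
      lemma : ∀ t n r → t * ((1ℚ + 1ℚ) * (n * r)) ≡ r * ((1ℚ + 1ℚ) * (n * t))
      lemma = solve-∀ ring

    ∑β≤1 : ∑β ≤ 1ℚ
    ∑β≤1 = ≤-trans (≤-trans (≤-by ∑β 0≤∑β (lemma ∑β)) (subst (_≤ ι t * (2ℚ * ∑β)) (*-identityˡ _) (*-monoʳ (0≤* 0≤2 0≤∑β) (1≤ι 1≤t)))) t*2*∑β≤1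
      where
      lemma : ∀ a → a + a ≡ (1ℚ + 1ℚ) * a
      lemma = solve-∀ ring

    -- Each node contributes at most z / (z - 1) ≤ 2 to the mean under β, and the bound for β - θ
    -- costs another factor 2.
    W : ℕ
    W = 4 ℕ.* suc N

    point : Fin (suc (suc N)) → ℕ
    point zero    = 1
    point (suc j) = z j

    weight : Bool → Fin (suc (suc N)) → ℚ
    weight true  zero    = i * (T - ∑β)
    weight true  (suc j) = i * β (z j)
    weight false zero    = 0ℚ
    weight false (suc j) = i * w₀ j

    ν : Bool → Functional ℕ
    ν b φ = ∑ (λ j → weight b j * φ (point j))

    z≤K : ∀ j → z j ℕ.≤ K
    z≤K j = node≤ (toℕ j) (ℕ.≤-pred (toℕ<n j))

    0≤T-∑β : 0ℚ ≤ T - ∑β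
    0≤T-∑β = 0≤q-p (≤-trans ∑β≤1 1≤T)

    0≤weight : ∀ b j → 0ℚ ≤ weight b j
    0≤weight true  zero    = 0≤* 0≤i 0≤T-∑β
    0≤weight true  (suc j) = 0≤* 0≤i (0≤β (z j))
    0≤weight false zero    = ≤-refl
    0≤weight false (suc j) = 0≤* 0≤i (0≤β-θ (toℕ j))

    weight-total : ∀ b → ∑ (weight b) ≡ 1ℚ
    weight-total true  = trans (cong (i * (T - ∑β) +_) (∑-*ˡ i (λ (j : Fin (suc N)) → β (z j)))) (trans (lemma i T ∑β) i*T)
      where
      lemma : ∀ i t b → i * (t - b) + i * b ≡ i * t
      lemma = solve-∀ ring
    weight-total false = trans (+-identityˡ _) (trans (∑-*ˡ i w₀) i*T)

    weight-supp : ∀ b j → weight b j ≡ 0ℚ ⊎ Range K b (point j)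
    weight-supp true  zero    = inj₂ (s≤s z≤n , 1≤K)
    weight-supp true  (suc j) with node-cases (toℕ j)
    ... | inj₁ e           = inj₁ (trans (cong (λ z → i * β z) e) (*-zeroʳ i))
    ... | inj₂ (n , e , p) = inj₂ (subst (1 ℕ.≤_) (sym e) (s≤s z≤n) , z≤K j)
    weight-supp false zero    = inj₂ 1≤K
    weight-supp false (suc j) = inj₂ (z≤K j)

    pull-i : ∀ (w f : Fin (suc N) → ℚ) → ∑ (λ j → i * w j * f j) ≡ i * ∑ (λ j → w j * f j)
    pull-i w f = trans (∑-cong (λ j → *-assoc i (w j) (f j))) (∑-*ˡ i (λ j → w j * f j))

    w₀-moment : ∀ l → ∑ (λ j → w₀ j * ι (z j) ^ l) ≡ A l - Θ l
    w₀-moment l = trans (∑-cong (λ j → lemma₁ (β (z j)) (θ (toℕ j)) (ι (z j) ^ l)))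
      (trans (∑-+ (λ j → β (z j) * ι (z j) ^ l) (λ j → - 1ℚ * (θ (toℕ j) * ι (z j) ^ l)))
      (trans (cong (A l +_) (∑-*ˡ (- 1ℚ) (λ (j : Fin (suc N)) → θ (toℕ j) * ι (z j) ^ l))) (lemma₂ (A l) (Θ l))))
      where
      lemma₁ : ∀ a b x → (a - b) * x ≡ a * x + - 1ℚ * (b * x)
      lemma₁ = solve-∀ ring
      lemma₂ : ∀ a b → a + - 1ℚ * b ≡ a - b
      lemma₂ = solve-∀ ring

    T≡ : T ≡ ∑β - Θ 0
    T≡ = trans (∑-cong (λ j → sym (*-identityʳ (w₀ j)))) (trans (w₀-moment 0) (cong (_- Θ 0) (∑-cong (λ (j : Fin (suc N)) → *-identityʳ (β (z j))))))

    moment-match : ∀ l → l ℕ.≤ h → ν true (λ z → ι z ^ l) ≡ ν false (λ z → ι z ^ l)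
    moment-match l l≤h = begin
      i * (T - ∑β) * (1ℚ + 0ℚ) ^ l + ∑ (λ j → i * β (z j) * ι (z j) ^ l)
        ≡⟨ cong₂ _+_ (trans (cong (i * (T - ∑β) *_) (1^ l)) (*-identityʳ (i * (T - ∑β)))) (pull-i (λ j → β (z j)) (λ j → ι (z j) ^ l)) ⟩
      i * (T - ∑β) + i * A l
        ≡⟨ cong (λ t → i * (t - ∑β) + i * A l) T≡ ⟩
      i * (∑β - Θ 0 - ∑β) + i * A l
        ≡⟨ lemma i ∑β (Θ 0) (A l) ⟩
      i * (A l - Θ 0)
        ≡⟨ cong (λ x → i * (A l - x)) (Θ-const l l≤h) ⟨
      i * (A l - Θ l)
        ≡⟨ cong (i *_) (w₀-moment l) ⟨
      i * ∑ (λ j → w₀ j * ι (z j) ^ l)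
        ≡⟨ pull-i w₀ (λ j → ι (z j) ^ l) ⟨
      ∑ (λ j → i * w₀ j * ι (z j) ^ l)
        ≡⟨ +-identityˡ _ ⟨
      0ℚ + ∑ (λ j → i * w₀ j * ι (z j) ^ l)
        ≡⟨ cong (_+ ∑ (λ j → i * w₀ j * ι (z j) ^ l)) (*-zeroˡ ((1ℚ + 0ℚ) ^ l)) ⟨
      0ℚ * (1ℚ + 0ℚ) ^ l + ∑ (λ j → i * w₀ j * ι (z j) ^ l) ∎
      where
      open ≡-Reasoning
      lemma : ∀ i b t a → i * (b - t - b) + i * a ≡ i * (a - t)
      lemma = solve-∀ ring

    i*≤ : ∀ {x} → 0ℚ ≤ x → i * x ≤ x
    i*≤ {x} 0≤x = subst (i * x ≤_) (*-identityˡ x) (*-monoʳ 0≤x i≤1)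

    ν-false≤ : ∀ (f : ℕ → ℚ) → f 0 ≡ 0ℚ → (∀ z → 0ℚ ≤ f z) → ν false f ≤ 2ℚ * ∑ (λ (j : Fin (suc N)) → β (z j) * f (z j))
    ν-false≤ f f₀ 0≤f = begin
      0ℚ * f 1 + ∑ (λ j → i * w₀ j * f (z j))  ≡⟨ trans (cong (_+ ∑ (λ j → i * w₀ j * f (z j))) (*-zeroˡ (f 1))) (+-identityˡ _) ⟩
      ∑ (λ j → i * w₀ j * f (z j))             ≡⟨ pull-i w₀ (λ j → f (z j)) ⟩
      i * ∑ (λ j → w₀ j * f (z j))             ≤⟨ i*≤ (0≤∑ (λ j → 0≤* (0≤β-θ (toℕ j)) (0≤f (z j)))) ⟩
      ∑ (λ j → w₀ j * f (z j))                 ≤⟨ ∑-mono {suc N} (λ j → β-θ≤2β f f₀ 0≤f (toℕ j)) ⟩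
      ∑ (λ j → 2ℚ * (β (z j) * f (z j)))       ≡⟨ ∑-*ˡ 2ℚ (λ (j : Fin (suc N)) → β (z j) * f (z j)) ⟩
      2ℚ * ∑ (λ j → β (z j) * f (z j))         ∎
      where open ≤-Reasoning

    nonzero-bounds : ∀ z → 0ℚ ≤ nonzero z × nonzero z ≤ 1ℚ
    nonzero-bounds zero    = ≤-refl , 0≤1
    nonzero-bounds (suc z) = 0≤1 , ≤-refl

    ν-false-nonzero : ι t * ν false nonzero ≤ 1ℚ
    ν-false-nonzero = ≤-trans (*-monoˡ (0≤ι t) (≤-trans (ν-false≤ nonzero refl (proj₁ ∘ nonzero-bounds))
      (*-monoˡ 0≤2 (∑-mono (λ j → subst (β (z j) * nonzero (z j) ≤_) (*-identityʳ (β (z j))) (*-monoˡ (0≤β (z j)) (proj₂ (nonzero-bounds (z j))))))))) t*2*∑β≤1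

    ∑β*z≤ : ∑ (λ (j : Fin (suc N)) → β (z j) * ι (z j)) ≤ ι (suc N) * 2ℚ
    ∑β*z≤ = ∑-≤const {suc N} (λ j → β*node≤2 (toℕ j))

    ν-mean : ∀ b → ν b ι ≤ ι W
    ν-mean true  = begin
      i * (T - ∑β) * (1ℚ + 0ℚ) + ∑ (λ j → i * β (z j) * ι (z j))
        ≡⟨ cong₂ _+_ (*-identityʳ (i * (T - ∑β))) (pull-i (λ j → β (z j)) (λ j → ι (z j))) ⟩
      i * (T - ∑β) + i * ∑ (λ j → β (z j) * ι (z j))
        ≤⟨ +-mono-≤ (subst (i * (T - ∑β) ≤_) i*T (*-monoˡ 0≤i (≤-by ∑β 0≤∑β (lemma T ∑β))))
             (≤-trans (i*≤ (0≤∑ (λ j → 0≤* (0≤β (z j)) (0≤ι (z j))))) ∑β*z≤) ⟩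
      1ℚ + ι (suc N) * 2ℚ
        ≤⟨ ≤-by (1ℚ + 2ℚ * ι N) (0≤+ 0≤1 (0≤* 0≤2 (0≤ι N))) (lemma′ (ι N)) ⟩
      ι 4 * ι (suc N)
        ≡⟨ ι-* 4 (suc N) ⟨
      ι W ∎
      where
      open ≤-Reasoning
      lemma : ∀ t b → t - b + b ≡ t
      lemma = solve-∀ ring
      lemma′ : ∀ n → 1ℚ + (1ℚ + n) * (1ℚ + 1ℚ) + (1ℚ + (1ℚ + 1ℚ) * n) ≡ (1ℚ + (1ℚ + (1ℚ + (1ℚ + 0ℚ)))) * (1ℚ + n)
      lemma′ = solve-∀ ring
    ν-mean false = begin
      ν false ι                                          ≤⟨ ν-false≤ ι refl 0≤ι ⟩
      2ℚ * ∑ (λ (j : Fin (suc N)) → β (z j) * ι (z j))   ≤⟨ *-monoˡ 0≤2 ∑β*z≤ ⟩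
      2ℚ * (ι (suc N) * 2ℚ)                              ≡⟨ lemma (ι (suc N)) ⟩
      ι 4 * ι (suc N)                                    ≡⟨ ι-* 4 (suc N) ⟨
      ι W                                                ∎
      where
      open ≤-Reasoning
      lemma : ∀ n → (1ℚ + 1ℚ) * (n * (1ℚ + 1ℚ)) ≡ (1ℚ + (1ℚ + (1ℚ + (1ℚ + 0ℚ)))) * n
      lemma = solve-∀ ring

    pair : Indistinguishable h t K W
    pair = record
      { μ            = ν
      ; expectation  = λ b → ∑-expectation (weight b) point (0≤weight b) (weight-total b) (weight-supp b)
      ; moments      = moment-match
      ; concentrated = ν-false-nonzero
      ; mean         = ν-mean
      }

  -- Lagrange weights at the nodes 1 and c (j - h)², j = 0, …, 2h: at the squares they are signed
  -- binomials centred at j = h, i.e. at 0, divided by (node - 1).  That factor, together with a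
  -- large c, leaves almost all the mass at 0 and 1.
  module Construct (e t : ℕ) (1≤t : 1 ℕ.≤ t) where
    h N k c K : ℕ
    -- Even, so that the central signed binomial is positive and ω can be normalised to 1 there.
    h = e ℕ.+ e
    N = h ℕ.+ h
    k = 2 ℕ.* (suc N ℕ.* t)
    -- Nonzero nodes are multiples of c, so that z - 1 is at least k on them.
    c = suc k
    K = suc (c ℕ.* (h ℕ.* h))

    node : ℕ → ℕ
    node j = c ℕ.* (ℕ.∣ j - h ∣ ℕ.* ℕ.∣ j - h ∣)

    node-h : node h ≡ 0
    node-h = trans (cong (λ d → c ℕ.* (d ℕ.* d)) (ℕ.∣n-n∣≡0 h)) (ℕ.*-zeroʳ c)

    node-cases : ∀ j → node j ≡ 0 ⊎ ∃ λ n → node j ≡ suc n × k ℕ.≤ n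
    node-cases j with ℕ.∣ j - h ∣
    ... | zero  = inj₁ (ℕ.*-zeroʳ c)
    ... | suc d = inj₂ (_ , refl , ℕ.≤-trans (ℕ.≤-reflexive (sym (ℕ.*-identityʳ k)))
                    (ℕ.≤-trans (ℕ.*-monoʳ-≤ k (s≤s z≤n)) (ℕ.m≤n+m _ _)))

    node≤ : ∀ j → j ℕ.≤ N → node j ℕ.≤ K
    node≤ j j≤N = ℕ.m≤n⇒m≤1+n (ℕ.*-monoʳ-≤ c (ℕ.*-mono-≤ d≤h d≤h))
      where
      d≤h : ℕ.∣ j - h ∣ ℕ.≤ h
      d≤h with ℕ.≤-total j h
      ... | inj₁ j≤h = ℕ.≤-trans (ℕ.≤-reflexive (ℕ.m≤n⇒∣m-n∣≡n∸m j≤h)) (ℕ.m∸n≤m h j)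
      ... | inj₂ h≤j = ℕ.≤-trans (ℕ.≤-reflexive (ℕ.m≤n⇒∣n-m∣≡n∸m h≤j)) (ℕ.≤-trans (ℕ.∸-monoˡ-≤ h j≤N) (ℕ.≤-reflexive (ℕ.m+n∸n≡m h h)))

    node≡0 : ∀ j → node j ≡ 0 → j ≡ h
    node≡0 j p with ℕ.m*n≡0⇒m≡0∨n≡0 c p
    ... | inj₂ q with ℕ.m*n≡0⇒m≡0∨n≡0 ℕ.∣ j - h ∣ q
    ... | inj₁ r = ℕ.∣m-n∣≡0⇒m≡n r
    ... | inj₂ r = ℕ.∣m-n∣≡0⇒m≡n r

    ω : ℕ → ℚ
    ω j = signedC N j * recip (N C h)

    ω-h : ω h ≡ 1ℚ
    ω-h = trans (cong (λ s → s * ι (N C h) * recip (N C h)) (sign-even e))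
      (trans (lemma (ι (N C h)) (recip (N C h))) (recip-ι (0<C h h (ℕ.m≤m+n h h))))
      where
      lemma : ∀ a b → 1ℚ * a * b ≡ b * a
      lemma = solve-∀ ring

    C-ratio≤1 : ∀ j → ι (N C j) * recip (N C h) ≤ 1ℚ
    C-ratio≤1 j = ≤-trans (*-monoʳ (0≤recip (N C h)) (ι-mono (C≤central h j)))
      (≤-reflexive (trans (*-comm (ι (N C h)) (recip (N C h))) (recip-ι (0<C h h (ℕ.m≤m+n h h)))))

    0≤C-ratio : ∀ j → 0ℚ ≤ ι (N C j) * recip (N C h)
    0≤C-ratio j = 0≤* (0≤ι (N C j)) (0≤recip (N C h))

    ω-bounds : ∀ j → ω j ≤ 1ℚ × - ω j ≤ 1ℚ
    ω-bounds j with sign-cases j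
    ... | inj₁ s = subst (λ s → s * ι (N C j) * recip (N C h) ≤ 1ℚ × - (s * ι (N C j) * recip (N C h)) ≤ 1ℚ) (sym s)
      ( subst (_≤ 1ℚ) (lemma₁ (ι (N C j)) (recip (N C h))) (C-ratio≤1 j)
      , ≤-trans (subst (_≤ 0ℚ) (lemma₂ (ι (N C j)) (recip (N C h))) (neg-antimono-≤ (0≤C-ratio j))) 0≤1)
      where
      lemma₁ : ∀ a b → a * b ≡ 1ℚ * a * b
      lemma₁ = solve-∀ ring
      lemma₂ : ∀ a b → - (a * b) ≡ - (1ℚ * a * b)
      lemma₂ = solve-∀ ring
    ... | inj₂ s = subst (λ s → s * ι (N C j) * recip (N C h) ≤ 1ℚ × - (s * ι (N C j) * recip (N C h)) ≤ 1ℚ) (sym s)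
      ( ≤-trans (subst (_≤ 0ℚ) (lemma₂ (ι (N C j)) (recip (N C h))) (neg-antimono-≤ (0≤C-ratio j))) 0≤1
      , subst (_≤ 1ℚ) (lemma₁ (ι (N C j)) (recip (N C h))) (C-ratio≤1 j))
      where
      lemma₁ : ∀ a b → a * b ≡ - (- 1ℚ * a * b)
      lemma₁ = solve-∀ ring
      lemma₂ : ∀ a b → - (a * b) ≡ - 1ℚ * a * b
      lemma₂ = solve-∀ ring

    ∑ω-below : ∀ G → Below N G → ∑ {suc N} (λ j → ω (toℕ j) * G (toℕ j)) ≡ 0ℚ
    ∑ω-below G p = trans (∑-cong {suc N} (λ j → lemma (signedC N (toℕ j)) (recip (N C h)) (G (toℕ j))))
      (trans (∑-*ˡ (recip (N C h)) (λ (j : Fin (suc N)) → signedC N (toℕ j) * G (toℕ j)))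
      (trans (cong (recip (N C h) *_) (trans (sym (iterδ-∑ N G)) (iterδ-below N p))) (*-zeroʳ (recip (N C h)))))
      where
      lemma : ∀ a r g → a * r * g ≡ r * (a * g)
      lemma = solve-∀ ring

    -- A node is quadratic in j, so its l-th power has degree 2l in j; for l < h this is below N =
    -- 2h, the order of the difference.
    below-node^ : ∀ l → Below (suc (l ℕ.+ l)) (λ j → ι (node j) ^ l)
    below-node^ zero    = below-const 1ℚ
    below-node^ (suc l) = subst (λ n → Below (suc (suc n)) (λ j → ι (node j) ^ suc l)) (sym (ℕ.+-suc l l))
      (below-cong (suc (suc (suc (l ℕ.+ l)))) (λ j → trans (lemma (ι c) (ι j - ι h) (ι (node j) ^ l))
          (cong (_* ι (node j) ^ l) (sym (trans (ι-* c (ℕ.∣ j - h ∣ ℕ.* ℕ.∣ j - h ∣)) (cong (ι c *_) (ι-dist² j h))))))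
        (below-* (suc (suc (suc (l ℕ.+ l)))) (ι c) {λ j → (ι j - ι h) * ((ι j - ι h) * ι (node j) ^ l)}
          (below-affine* (suc (suc (l ℕ.+ l))) (ι h) {λ j → (ι j - ι h) * ι (node j) ^ l}
            (below-affine* (suc (l ℕ.+ l)) (ι h) {λ j → ι (node j) ^ l} (below-node^ l)))))
      where
      lemma : ∀ c a g → c * (a * (a * g)) ≡ c * (a * a) * g
      lemma = solve-∀ ring

    ∑ω : ∀ l → l ℕ.< h → ∑ {suc N} (λ j → ω (toℕ j) * ι (node (toℕ j)) ^ l) ≡ 0ℚ
    ∑ω l l<h = ∑ω-below (λ j → ι (node j) ^ l) (below-≤ (ℕ.+-mono-≤ l<h (ℕ.<⇒≤ l<h)) (below-node^ l))

    indistinguishable : Indistinguishable h t K (4 ℕ.* suc N)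
    indistinguishable = Lagrange.pair h N t k K 1≤t (ℕ.m≤m+n h h) refl (s≤s z≤n)
      node node-h node≡0 node-cases node≤ ω ω-h ω-bounds ∑ω

  -- Polynomials under expectations

  -- The same folds as `evalMono` and `evalPoly`, with rational values on any index set: a value of
  -- `evalPoly` is by definition one of `evalP`.
  mono : ∀ {I : Set} → (I → ℚ) → List I → ℚ
  mono y is = foldr (λ i r → y i * r) 1ℚ is

  evalP : ∀ {I : Set} → (I → ℚ) → List (ℚ × List I) → ℚ
  evalP y p = foldr (λ t r → proj₁ t * mono y (proj₂ t) + r) 0ℚ p

  DegP : ∀ {I : Set} → ℕ → List (ℚ × List I) → Set
  DegP d p = All (λ t → length (proj₂ t) ℕ.≤ d) p

  mono-cong : ∀ {I : Set} {y y′ : I → ℚ} → (∀ i → y i ≡ y′ i) → ∀ is → mono y is ≡ mono y′ is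
  mono-cong e []       = refl
  mono-cong e (i ∷ is) = cong₂ _*_ (e i) (mono-cong e is)

  evalP-cong : ∀ {I : Set} {y y′ : I → ℚ} → (∀ i → y i ≡ y′ i) → ∀ p → evalP y p ≡ evalP y′ p
  evalP-cong e []             = refl
  evalP-cong e ((a , is) ∷ p) = cong₂ (λ m r → a * m + r) (mono-cong e is) (evalP-cong e p)

  -- F is a polynomial of degree at most d in the coordinates y x of the point x.
  record IsPoly {X I : Set} (y : X → I → ℚ) (d : ℕ) (F : X → ℚ) : Set where
    constructor mkPoly
    field
      poly   : List (ℚ × List I)
      degree : DegP d poly
      value  : ∀ x → F x ≡ evalP (y x) poly

  module _ {X I : Set} {y : X → I → ℚ} where

    poly-cong : ∀ {d F G} → (∀ x → G x ≡ F x) → IsPoly y d F → IsPoly y d G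
    poly-cong e (mkPoly p dp q) = mkPoly p dp λ x → trans (e x) (q x)

    poly-≤ : ∀ {d e F} → d ℕ.≤ e → IsPoly y d F → IsPoly y e F
    poly-≤ d≤e (mkPoly p dp q) = mkPoly p (All.map (λ l → ℕ.≤-trans l d≤e) dp) q

    poly-const : ∀ a → IsPoly y 0 (λ _ → a)
    poly-const a = mkPoly ((a , []) ∷ []) (z≤n ∷ []) λ _ → lemma a
      where
      lemma : ∀ a → a ≡ a * 1ℚ + 0ℚ
      lemma = solve-∀ ring

    evalP-++ : ∀ (z : I → ℚ) p q → evalP z (p ++ q) ≡ evalP z p + evalP z q
    evalP-++ z []            q = sym (+-identityˡ (evalP z q))
    evalP-++ z ((a , is) ∷ p) q = trans (cong (a * mono z is +_) (evalP-++ z p q)) (sym (+-assoc (a * mono z is) (evalP z p) (evalP z q)))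

    poly-+ : ∀ {d F G} → IsPoly y d F → IsPoly y d G → IsPoly y d (λ x → F x + G x)
    poly-+ (mkPoly p dp e) (mkPoly q dq f) = mkPoly (p ++ q) (All.++⁺ dp dq) λ x → trans (cong₂ _+_ (e x) (f x)) (sym (evalP-++ (y x) p q))

    poly-scale : ∀ {d F} a → IsPoly y d F → IsPoly y d (λ x → a * F x)
    poly-scale {d} {F} a (mkPoly p dp e) = mkPoly (scale p) (scale-deg dp) λ x → trans (cong (a *_) (e x)) (scale-eval (y x) p)
      where
      scale : List (ℚ × List I) → List (ℚ × List I)
      scale = map λ t → a * proj₁ t , proj₂ t
      scale-deg : ∀ {p} → DegP d p → DegP d (scale p)
      scale-deg []       = []
      scale-deg (l ∷ ls) = l ∷ scale-deg ls
      lemma : ∀ a b m r → a * (b * m + r) ≡ a * b * m + a * r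
      lemma = solve-∀ ring
      scale-eval : ∀ z p → a * evalP z p ≡ evalP z (scale p)
      scale-eval z []             = *-zeroʳ a
      scale-eval z ((b , is) ∷ p) = trans (lemma a b (mono z is) (evalP z p)) (cong (a * b * mono z is +_) (scale-eval z p))

    poly-var* : ∀ {d F} i → IsPoly y d F → IsPoly y (suc d) (λ x → y x i * F x)
    poly-var* {d} {F} i (mkPoly p dp e) = mkPoly (raise p) (raise-deg dp) λ x → trans (cong (y x i *_) (e x)) (raise-eval (y x) p)
      where
      raise : List (ℚ × List I) → List (ℚ × List I)
      raise = map λ t → proj₁ t , i ∷ proj₂ t
      raise-deg : ∀ {p} → DegP d p → DegP (suc d) (raise p)
      raise-deg []       = []
      raise-deg (l ∷ ls) = s≤s l ∷ raise-deg ls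
      lemma : ∀ v a m r → v * (a * m + r) ≡ a * (v * m) + v * r
      lemma = solve-∀ ring
      raise-eval : ∀ z p → z i * evalP z p ≡ evalP z (raise p)
      raise-eval z []             = *-zeroʳ (z i)
      raise-eval z ((a , is) ∷ p) = trans (lemma (z i) a (mono z is) (evalP z p)) (cong (a * (z i * mono z is) +_) (raise-eval z p))

    poly-mono* : ∀ {d G} is → IsPoly y d G → IsPoly y (length is ℕ.+ d) (λ x → mono (y x) is * G x)
    poly-mono* {G = G} []       q = poly-cong (λ x → *-identityˡ (G x)) q
    poly-mono* {G = G} (i ∷ is) q = poly-cong (λ x → *-assoc (y x i) (mono (y x) is) (G x)) (poly-var* i (poly-mono* is q))

    poly-* : ∀ {d e F G} → IsPoly y d F → IsPoly y e G → IsPoly y (d ℕ.+ e) (λ x → F x * G x)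
    poly-* {d} {e} {F} {G} (mkPoly p dp f) q = poly-cong (λ x → cong (_* G x) (f x)) (go p dp)
      where
      lemma : ∀ a m r g → (a * m + r) * g ≡ a * (m * g) + r * g
      lemma = solve-∀ ring
      go : ∀ p → DegP d p → IsPoly y (d ℕ.+ e) (λ x → evalP (y x) p * G x)
      go []             []       = poly-cong (λ x → *-zeroˡ (G x)) (poly-≤ z≤n (poly-const 0ℚ))
      go ((a , is) ∷ p) (l ∷ ls) = poly-cong (λ x → lemma a (mono (y x) is) (evalP (y x) p) (G x))
        (poly-+ (poly-scale a (poly-≤ (ℕ.+-monoˡ-≤ e l) (poly-mono* is q))) (go p ls))

    poly-∑ : ∀ {d n} {F : Fin n → X → ℚ} → (∀ j → IsPoly y d (F j)) → IsPoly y d (λ x → ∑ (λ j → F j x))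
    poly-∑ {n = zero}  P = poly-≤ z≤n (poly-const 0ℚ)
    poly-∑ {n = suc n} P = poly-+ (P zero) (poly-∑ (P ∘ suc))

    poly-var : ∀ i → IsPoly y 1 (λ x → y x i)
    poly-var i = poly-cong (λ x → sym (*-identityʳ (y x i))) (poly-var* i (poly-const 1ℚ))

  -- If one factor of a product measure depends on a parameter x through polynomials, and the factor
  -- only sees x through at least κ of its own variables per degree in x, then the expectation of a
  -- polynomial of degree D is a polynomial of degree at most D / κ in x.
  module _ {X I : Set} (y : X → I → ℚ) (κ : ℕ) {S Z : Set} (b : S → Z → ℚ) where

    private
      split : ∀ {N} → List (Fin (suc N) × Z) → List Z × List (Fin N × Z)
      split []                = [] , []
      split ((zero  , z) ∷ l) = z ∷ proj₁ (split l) , proj₂ (split l)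
      split ((suc i , z) ∷ l) = proj₁ (split l) , (i , z) ∷ proj₂ (split l)

      split-length : ∀ {N} (l : List (Fin (suc N) × Z)) → length (proj₁ (split l)) ℕ.+ length (proj₂ (split l)) ≡ length l
      split-length []                = refl
      split-length ((zero  , z) ∷ l) = cong suc (split-length l)
      split-length ((suc i , z) ∷ l) = trans (ℕ.+-suc (length (proj₁ (split l))) (length (proj₂ (split l)))) (cong suc (split-length l))

      at : ∀ {N} → Vec S N → Fin N × Z → ℚ
      at v (i , z) = b (lookup v i) z

      split-mono : ∀ {N} s (v : Vec S N) l → mono (at (s ∷ v)) l ≡ mono (b s) (proj₁ (split l)) * mono (at v) (proj₂ (split l))
      split-mono s v []                = sym (*-identityˡ 1ℚ)
      split-mono s v ((zero  , z) ∷ l) = trans (cong (b s z *_) (split-mono s v l)) (sym (*-assoc (b s z) (mono (b s) (proj₁ (split l))) (mono (at v) (proj₂ (split l)))))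
      split-mono s v ((suc i , z) ∷ l) = trans (cong (at v (i , z) *_) (split-mono s v l)) (lemma (at v (i , z)) (mono (b s) (proj₁ (split l))) (mono (at v) (proj₂ (split l))))
        where
        lemma : ∀ a b c → a * (b * c) ≡ b * (a * c)
        lemma = solve-∀ ring

    -- Instantiated twice: for the items with κ = 1, the parameter being the weights, and for the
    -- counts with κ = e, the parameter being the Boolean input of the outer DNF.
    Factor : Set
    Factor = Σ (X → Functional S) λ E → (∀ x → Linear (E x)) ×
      (∀ zs → ∃ λ e → κ ℕ.* e ℕ.≤ length zs × IsPoly y e (λ x → E x (λ s → mono (b s) zs)))

    Π-mono : ∀ {N} (E : Fin N → Factor) (l : List (Fin N × Z)) →
      ∃ λ e → κ ℕ.* e ℕ.≤ length l × IsPoly y e (λ x → Π (λ i → proj₁ (E i) x) (λ v → mono (at v) l))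
    Π-mono {zero}  E [] = 0 , ℕ.≤-reflexive (ℕ.*-zeroʳ κ) , poly-const 1ℚ
    Π-mono {suc N} E l with proj₂ (proj₂ (E zero)) (proj₁ (split l)) | Π-mono (E ∘ suc) (proj₂ (split l))
    ... | e₀ , le₀ , q₀ | e₁ , le₁ , q₁ =
      e₀ ℕ.+ e₁ ,
      ℕ.≤-trans (ℕ.≤-reflexive (ℕ.*-distribˡ-+ κ e₀ e₁)) (ℕ.≤-trans (ℕ.+-mono-≤ le₀ le₁) (ℕ.≤-reflexive (split-length l))) ,
      poly-cong factorise (poly-* q₀ q₁)
      where
      L : ∀ x i → Linear (proj₁ (E i) x)
      L x i = proj₁ (proj₂ (E i)) x
      factorise : ∀ x → Π (λ i → proj₁ (E i) x) (λ v → mono (at v) l) ≡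
        proj₁ (E zero) x (λ s → mono (b s) (proj₁ (split l))) * Π (λ i → proj₁ (E (suc i)) x) (λ v → mono (at v) (proj₂ (split l)))
      factorise x = trans
        (Linear.E-cong (L x zero) (λ s → trans (L′.E-cong (λ v → split-mono s v l)) (L′.E-* (mono (b s) (proj₁ (split l))) (λ v → mono (at v) (proj₂ (split l))))))
        (Linear.E-*ʳ (L x zero) _ (λ s → mono (b s) (proj₁ (split l))))
        where module L′ = Linear (Π-linear (L x ∘ suc))

    Π-poly : ∀ {N} (E : Fin N → Factor) (item : Z → Fin N) {D e*} → (∀ e → κ ℕ.* e ℕ.≤ D → e ℕ.≤ e*) →
      ∀ p → DegP D p → IsPoly y e* (λ x → Π (λ i → proj₁ (E i) x) (λ v → evalP (λ z → b (lookup v (item z)) z) p))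
    Π-poly E item bound [] [] = poly-cong (λ x → Linear.E-0 (Π-linear (λ i → proj₁ (proj₂ (E i)) x))) (poly-≤ z≤n (poly-const 0ℚ))
    Π-poly {N} E item {D} {e*} bound ((a , zs) ∷ p) (l ∷ ls) with Π-mono E (map (λ z → item z , z) zs)
    ... | e , le , q = poly-cong linearise (poly-+ (poly-scale a (poly-≤ (bound e e≤) q)) (Π-poly E item bound p ls))
      where
      e≤ : κ ℕ.* e ℕ.≤ D
      e≤ = ℕ.≤-trans le (ℕ.≤-trans (ℕ.≤-reflexive (length-map (λ z → item z , z) zs)) l)
      relabel : ∀ (v : Vec S N) zs → mono (λ z → b (lookup v (item z)) z) zs ≡ mono (at v) (map (λ z → item z , z) zs)
      relabel v []       = refl
      relabel v (z ∷ zs) = cong (b (lookup v (item z)) z *_) (relabel v zs)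
      linearise : ∀ x → _
      linearise x = trans (L.E-+ (λ v → a * mono (λ z → b (lookup v (item z)) z) zs) _)
        (cong₂ _+_ (trans (L.E-* a _) (cong (a *_) (L.E-cong (λ v → relabel v zs)))) refl)
        where module L = Linear (Π-linear (λ i → proj₁ (proj₂ (E i)) x))

  -- Growth of polynomials along a ray

  below-ray : ∀ {I : Set} (w : I → ℚ) D p → DegP D p → Below (suc D) (λ i → evalP (λ v → ι i * w v) p)
  below-ray w D []             []       = below-0 (suc D) (λ _ → refl)
  below-ray w D ((a , is) ∷ p) (l ∷ ls) = below-+ (suc D) {λ i → a * mono (λ v → ι i * w v) is} {λ i → evalP (λ v → ι i * w v) p}
    (below-* (suc D) a {λ i → mono (λ v → ι i * w v) is} (below-≤ {G = λ i → mono (λ v → ι i * w v) is} (s≤s l) (ray is))) (below-ray w D p ls)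
    where
    lemma : ∀ a b c → b * (a * c) ≡ a * b * c
    lemma = solve-∀ ring
    ray : ∀ is → Below (suc (length is)) (λ i → mono (λ v → ι i * w v) is)
    ray []       = below-const 1ℚ
    ray (j ∷ is) = below-cong (suc (suc (length is))) (λ i → lemma (ι i) (w j) (mono (λ v → ι i * w v) is))
      (below-* (suc (suc (length is))) (w j) {λ i → ι i * mono (λ v → ι i * w v) is} (below-ι* (suc (length is)) (ray is)))

  3ℚ : ℚ
  3ℚ = 1ℚ + 2ℚ

  0≤3 : 0ℚ ≤ 3ℚ
  0≤3 = nonNegative⁻¹ 3ℚ

  1≤3 : 1ℚ ≤ 3ℚ
  1≤3 = ≤-by 2ℚ 0≤2 refl

  -- By induction on the degree: the difference of G is bounded by 2 B on the first D points, hence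
  -- by 2 B 3 ^ T, and adding one difference to G turns B 3 ^ T into at most B 3 ^ (T + 1).
  growth : ∀ D {G B} → 0ℚ ≤ B → Below (suc D) G → (∀ i → i ℕ.≤ D → ∣ G i ∣ ≤ B) → ∀ T → ∣ G T ∣ ≤ B * 3ℚ ^ T
  growth zero {G} {B} 0≤B G≡ bound T = ≤-trans (≤-reflexive (cong ∣_∣ (const T))) (≤-trans (bound 0 z≤n)
    (subst (_≤ B * 3ℚ ^ T) (*-identityʳ B) (*-monoˡ 0≤B (1≤^ 1≤3 T))))
    where
    lemma : ∀ a b → a ≡ b - (b - a)
    lemma = solve-∀ ring
    const : ∀ T → G T ≡ G 0
    const zero    = refl
    const (suc T) = trans (lemma (G (suc T)) (G T)) (trans (cong (λ d → G T - d) (G≡ T)) (trans (+-identityʳ (G T)) (const T)))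
  growth (suc D) {G} {B} 0≤B G< bound = go
    where
    δ-bound : ∀ i → i ℕ.≤ D → ∣ δ G i ∣ ≤ 2ℚ * B
    δ-bound i i≤D = ≤-trans (∣p-q∣≤∣p∣+∣q∣ (G i) (G (suc i)))
      (≤-trans (+-mono-≤ (bound i (ℕ.m≤n⇒m≤1+n i≤D)) (bound (suc i) (s≤s i≤D))) (≤-reflexive (lemma B)))
      where
      lemma : ∀ b → b + b ≡ (1ℚ + 1ℚ) * b
      lemma = solve-∀ ring
    lemma₁ : ∀ a b → b ≡ a - (a - b)
    lemma₁ = solve-∀ ring
    lemma₂ : ∀ b p → b * p + (1ℚ + 1ℚ) * b * p ≡ b * ((1ℚ + (1ℚ + 1ℚ)) * p)
    lemma₂ = solve-∀ ring
    go : ∀ T → ∣ G T ∣ ≤ B * 3ℚ ^ T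
    go zero    = subst (∣ G 0 ∣ ≤_) (sym (*-identityʳ B)) (bound 0 z≤n)
    go (suc T) = begin
      ∣ G (suc T) ∣                   ≡⟨ cong ∣_∣ (lemma₁ (G T) (G (suc T))) ⟩
      ∣ G T - δ G T ∣                 ≤⟨ ∣p-q∣≤∣p∣+∣q∣ (G T) (δ G T) ⟩
      ∣ G T ∣ + ∣ δ G T ∣             ≤⟨ +-mono-≤ (go T) (growth D (0≤* 0≤2 0≤B) G< δ-bound T) ⟩
      B * 3ℚ ^ T + 2ℚ * B * 3ℚ ^ T    ≡⟨ lemma₂ B (3ℚ ^ T) ⟩
      B * (3ℚ * 3ℚ ^ T)               ∎
      where open ≤-Reasoning

  -- Composition of a DNF with AND ∘ OR

  module _ {A : Set} where

    any-cong : ∀ {p q : A → Bool} → (∀ x → p x ≡ q x) → ∀ xs → any p xs ≡ any q xs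
    any-cong e []       = refl
    any-cong e (x ∷ xs) = cong₂ _∨_ (e x) (any-cong e xs)

    all-cong : ∀ {p q : A → Bool} → (∀ x → p x ≡ q x) → ∀ xs → all p xs ≡ all q xs
    all-cong e []       = refl
    all-cong e (x ∷ xs) = cong₂ _∧_ (e x) (all-cong e xs)

    any-++ : ∀ (p : A → Bool) xs ys → any p (xs ++ ys) ≡ any p xs ∨ any p ys
    any-++ p []       ys = refl
    any-++ p (x ∷ xs) ys = trans (cong (p x ∨_) (any-++ p xs ys)) (sym (∨-assoc (p x) (any p xs) (any p ys)))

    all-++ : ∀ (p : A → Bool) xs ys → all p (xs ++ ys) ≡ all p xs ∧ all p ys
    all-++ p []       ys = refl
    all-++ p (x ∷ xs) ys = trans (cong (p x ∧_) (all-++ p xs ys)) (sym (∧-assoc (p x) (all p xs) (all p ys)))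

    any-∧ : ∀ (p : A → Bool) b xs → any (λ x → p x ∧ b) xs ≡ any p xs ∧ b
    any-∧ p b []       = refl
    any-∧ p b (x ∷ xs) = trans (cong (p x ∧ b ∨_) (any-∧ p b xs)) (sym (∧-distribʳ-∨ b (p x) (any p xs)))

  module _ {A B : Set} where

    any-map : ∀ (p : B → Bool) (f : A → B) xs → any p (map f xs) ≡ any (p ∘ f) xs
    any-map p f []       = refl
    any-map p f (x ∷ xs) = cong (p (f x) ∨_) (any-map p f xs)

    all-map : ∀ (p : B → Bool) (f : A → B) xs → all p (map f xs) ≡ all (p ∘ f) xs
    all-map p f []       = refl
    all-map p f (x ∷ xs) = cong (p (f x) ∧_) (all-map p f xs)

    any-concatMap : ∀ (p : B → Bool) (f : A → List B) xs → any p (concatMap f xs) ≡ any (any p ∘ f) xs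
    any-concatMap p f []       = refl
    any-concatMap p f (x ∷ xs) = trans (any-++ p (f x) (concatMap f xs)) (cong (any p (f x) ∨_) (any-concatMap p f xs))

    all-concatMap : ∀ (p : B → Bool) (f : A → List B) xs → all p (concatMap f xs) ≡ all (all p ∘ f) xs
    all-concatMap p f []       = refl
    all-concatMap p f (x ∷ xs) = trans (all-++ p (f x) (concatMap f xs)) (cong (all p (f x) ∧_) (all-concatMap p f xs))

    length-concatMap≤ : ∀ {f : A → List B} {k xs} → All (λ x → length (f x) ℕ.≤ k) xs → length (concatMap f xs) ℕ.≤ length xs ℕ.* k
    length-concatMap≤ []                         = z≤n
    length-concatMap≤ {f} {xs = x ∷ xs} (l ∷ ls) = ℕ.≤-trans (ℕ.≤-reflexive (length-++ (f x))) (ℕ.+-mono-≤ l (length-concatMap≤ ls))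

  all-tabulate⁺ : ∀ {A : Set} {n} (p : A → Bool) (f : Fin n → A) → (∀ i → p (f i) ≡ true) → all p (tabulate f) ≡ true
  all-tabulate⁺ {n = zero}  p f e = refl
  all-tabulate⁺ {n = suc n} p f e = cong₂ _∧_ (e zero) (all-tabulate⁺ p (f ∘ suc) (e ∘ suc))

  all-tabulate⁻ : ∀ {A : Set} {n} (p : A → Bool) (f : Fin n → A) → all p (tabulate f) ≡ true → ∀ i → p (f i) ≡ true
  all-tabulate⁻ {n = suc n} p f e i with p (f zero) in p₀
  all-tabulate⁻ {n = suc n} p f e zero    | true = p₀
  all-tabulate⁻ {n = suc n} p f e (suc i) | true = all-tabulate⁻ p (f ∘ suc) e i

  does-refl : ∀ {n} (i : Fin n) → does (i Fin.≟ i) ≡ true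
  does-refl i with i Fin.≟ i
  ... | yes _  = refl
  ... | no i≢i = contradiction refl i≢i

  does-sound : ∀ {n} {i j : Fin n} → does (i Fin.≟ j) ≡ true → i ≡ j
  does-sound {i = i} {j} e with i Fin.≟ j
  ... | yes i≡j = i≡j

  finToFun-injective : ∀ {m n} (i j : Fin (m ℕ.^ n)) → (∀ k → finToFun {m} {n} i k ≡ finToFun j k) → i ≡ j
  finToFun-injective {m} {n} i j e = trans (sym (funToFin-finToFin {n} {m} i)) (trans (funToFin-cong e) (funToFin-finToFin {n} {m} j))
    where
    funToFin-cong : ∀ {n} {f g : Fin n → Fin m} → (∀ k → f k ≡ g k) → funToFin f ≡ funToFin g
    funToFin-cong {zero}  e = refl
    funToFin-cong {suc n} e = cong₂ combine (e zero) (funToFin-cong (e ∘ suc))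

  is : ∀ {M} → Maybe (Fin M) → Fin M → Bool
  is nothing  v = false
  is (just u) v = does (u Fin.≟ v)

  -- An input encodes N items.  An item is empty or a pair v = (r , a), a < m, written in one-hot
  -- fashion through c digits in base t.  The DNF replaces the variable r of D by the condition that
  -- each of (r , 0), …, (r , m - 1) occurs among the items.
  module Compose (R m N c₀ t : ℕ) (fits : R ℕ.* m ℕ.≤ t ℕ.^ suc c₀) where
    M c : ℕ
    M = R ℕ.* m
    c = suc c₀

    Item : Set
    Item = Maybe (Fin M)

    code : Fin M → Fin c → Fin t
    code v = finToFun (inject≤ v fits)

    code-injective : ∀ u v → (∀ e → code u e ≡ code v e) → u ≡ v
    code-injective u v e = inject≤-injective fits fits u v (finToFun-injective {t} {c} (inject≤ u fits) (inject≤ v fits) e)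

    digit : Item → Fin (c ℕ.* t) → Bool
    digit nothing  _ = false
    digit (just v) j = does (code v (quotient {c} t j) Fin.≟ remainder {c} t j)

    enc : Vec Item N → Fin (N ℕ.* (c ℕ.* t)) → Bool
    enc s x = digit (lookup s (quotient {N} (c ℕ.* t) x)) (remainder {N} (c ℕ.* t) x)

    slot : Fin c → Fin t → Fin (c ℕ.* t)
    slot = combine

    -- In one-hot form, equality of a digit is a single unnegated variable. Digits in base t need
    -- only c t variables per item instead of one for each of the M values, at the cost of width c.
    itemClause : Fin N → Fin M → Clause (N ℕ.* (c ℕ.* t))
    itemClause i v = map (λ e → combine i (slot e (code v e))) (allFin c)

    enc-combine : ∀ s i e d → enc s (combine i (slot e d)) ≡ digit (lookup s i) (slot e d)
    enc-combine s i e d = cong (λ p → digit (lookup s (proj₁ p)) (proj₂ p)) (remQuot-combine {N} {c ℕ.* t} i (slot e d))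

    digit-just : ∀ u e d → digit (just u) (slot e d) ≡ does (code u e Fin.≟ d)
    digit-just u e d = cong (λ p → does (code u (proj₁ p) Fin.≟ proj₂ p)) (remQuot-combine {c} {t} e d)

    itemClause-correct : ∀ s i v → all (enc s) (itemClause i v) ≡ is (lookup s i) v
    itemClause-correct s i v = trans (all-map (enc s) (λ e → combine i (slot e (code v e))) (allFin c))
      (trans (all-cong (λ e → enc-combine s i e (code v e)) (allFin c)) (go (lookup s i)))
      where
      go : ∀ x → all (λ e → digit x (slot e (code v e))) (allFin c) ≡ is x v
      go nothing  = refl
      go (just u) with u Fin.≟ v
      ... | yes refl = all-tabulate⁺ (λ e → digit (just u) (slot e (code u e))) (λ e → e)
                         (λ e → trans (digit-just u e (code u e)) (does-refl (code u e)))
      ... | no u≢v with all (λ e → digit (just u) (slot e (code v e))) (allFin c) in eq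
      ...   | false = refl
      ...   | true  = contradiction (code-injective u v λ e → does-sound
                        (trans (sym (digit-just u e (code v e))) (all-tabulate⁻ _ (λ e → e) eq e))) u≢v

    hit : Vec Item N → Fin M → Bool
    hit s v = any (λ i → is (lookup s i) v) (allFin N)

    -- Distributes the AND over the ORs by choosing an item for every pair. The number of pairs per
    -- clause will be constant, so the blow-up is polynomial in N.
    choose : List (Fin M) → MDNF (N ℕ.* (c ℕ.* t))
    choose []       = [] ∷ []
    choose (v ∷ vs) = concatMap (λ i → map (itemClause i v ++_) (choose vs)) (allFin N)

    choose-correct : ∀ s vs → evalDNF (choose vs) (enc s) ≡ all (hit s) vs
    choose-correct s []       = refl
    choose-correct s (v ∷ vs) = begin
      any (all (enc s)) (concatMap (λ i → map (itemClause i v ++_) (choose vs)) (allFin N))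
        ≡⟨ any-concatMap (all (enc s)) (λ i → map (itemClause i v ++_) (choose vs)) (allFin N) ⟩
      any (λ i → any (all (enc s)) (map (itemClause i v ++_) (choose vs))) (allFin N)
        ≡⟨ any-cong (λ i → trans (any-map (all (enc s)) (itemClause i v ++_) (choose vs)) (factor i (choose vs))) (allFin N) ⟩
      any (λ i → is (lookup s i) v ∧ evalDNF (choose vs) (enc s)) (allFin N)
        ≡⟨ any-∧ (λ i → is (lookup s i) v) (evalDNF (choose vs) (enc s)) (allFin N) ⟩
      hit s v ∧ evalDNF (choose vs) (enc s)
        ≡⟨ cong (hit s v ∧_) (choose-correct s vs) ⟩
      hit s v ∧ all (hit s) vs ∎
      where
      open ≡-Reasoning
      factor : ∀ i L → any (λ cl → all (enc s) (itemClause i v ++ cl)) L ≡ is (lookup s i) v ∧ any (all (enc s)) L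
      factor i L = trans (any-cong (λ cl → trans (all-++ (enc s) (itemClause i v) cl)
          (trans (cong (_∧ all (enc s) cl) (itemClause-correct s i v)) (∧-comm (is (lookup s i) v) (all (enc s) cl)))) L)
        (trans (any-∧ (all (enc s)) (is (lookup s i) v) L) (∧-comm (any (all (enc s)) L) (is (lookup s i) v)))

    block : Fin R → List (Fin M)
    block r = map (combine r) (allFin m)

    compose : MDNF R → MDNF (N ℕ.* (c ℕ.* t))
    compose = concatMap (λ cl → choose (concatMap block cl))

    -- Stated on encodings of item vectors, which carry all the mass of the averages below.
    compose-correct : ∀ D s → evalDNF (compose D) (enc s) ≡ evalDNF D (λ r → all (hit s) (block r))
    compose-correct D s = trans (any-concatMap (all (enc s)) (λ cl → choose (concatMap block cl)) D)
      (any-cong (λ cl → trans (choose-correct s (concatMap block cl)) (all-concatMap (hit s) block cl)) D)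

    choose-width : ∀ vs → widthAtMost (length vs ℕ.* c) (choose vs)
    choose-width []       = z≤n ∷ []
    choose-width (v ∷ vs) = All.concat⁺ (All.map⁺ (All.universal (λ i → All.map⁺ (All.map (step i) (choose-width vs))) (allFin N)))
      where
      step : ∀ i {cl} → length cl ℕ.≤ length vs ℕ.* c → length (itemClause i v ++ cl) ℕ.≤ c ℕ.+ length vs ℕ.* c
      step i l = ℕ.≤-trans (ℕ.≤-reflexive (length-++ (itemClause i v)))
        (ℕ.+-mono-≤ (ℕ.≤-reflexive (trans (length-map (λ e → combine i (slot e (code v e))) (allFin c)) (length-tabulate {n = c} (λ e → e)))) l)

    choose-size : ∀ vs → length (choose vs) ℕ.≤ N ℕ.^ length vs
    choose-size []       = s≤s z≤n
    choose-size (v ∷ vs) = ℕ.≤-trans (length-concatMap≤ (All.universal (λ i → ℕ.≤-trans (ℕ.≤-reflexive (length-map (itemClause i v ++_) (choose vs))) (choose-size vs)) (allFin N)))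
      (ℕ.≤-reflexive (cong (ℕ._* N ℕ.^ length vs) (length-tabulate {n = N} (λ i → i))))

    blocks-length : ∀ {w} cl → length cl ℕ.≤ w → length (concatMap block cl) ℕ.≤ w ℕ.* m
    blocks-length cl l = ℕ.≤-trans
      (length-concatMap≤ (All.universal (λ r → ℕ.≤-reflexive (trans (length-map (combine r) (allFin m)) (length-tabulate {n = m} (λ a → a)))) cl))
      (ℕ.*-monoˡ-≤ m l)

    compose-width : ∀ {w D} → widthAtMost w D → widthAtMost (w ℕ.* m ℕ.* c) (compose D)
    compose-width {w} W = All.concat⁺ (All.map⁺ (All.map (λ {cl} l →
      All.map (λ le → ℕ.≤-trans le (ℕ.*-monoˡ-≤ c (blocks-length cl l))) (choose-width (concatMap block cl))) W))

    compose-size : ∀ {w s D} → 1 ℕ.≤ N → widthAtMost w D → sizeAtMost s D → sizeAtMost (s ℕ.* N ℕ.^ (w ℕ.* m)) (compose D)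
    compose-size {w} 1≤N W S = ℕ.≤-trans
      (length-concatMap≤ (All.map (λ {cl} l → ℕ.≤-trans (choose-size (concatMap block cl)) (ℕ.^-monoʳ-≤ N {{ℕ.>-nonZero 1≤N}} (blocks-length cl l))) W))
      (ℕ.*-monoˡ-≤ (N ℕ.^ (w ℕ.* m)) S)

  -- Random items

  ind : Bool → ℚ
  ind true  = 1ℚ
  ind false = 0ℚ

  0≤ind : ∀ b → 0ℚ ≤ ind b
  0≤ind true  = 0≤1
  0≤ind false = ≤-refl

  ind≤1 : ∀ b → ind b ≤ 1ℚ
  ind≤1 true  = ≤-refl
  ind≤1 false = 0≤1

  ind-not : ∀ b → ind b ≡ 1ℚ - ind (not b)
  ind-not true  = refl
  ind-not false = refl

  ind-not-any : ∀ {A : Set} {n} (p : A → Bool) (f : Fin n → A) → ind (not (any p (tabulate f))) ≡ ∏ (λ i → ind (not (p (f i))))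
  ind-not-any {n = zero}  p f = refl
  ind-not-any {n = suc n} p f with p (f zero)
  ... | true  = sym (*-zeroˡ (∏ (λ i → ind (not (p (f (suc i)))))))
  ... | false = trans (ind-not-any p (f ∘ suc)) (sym (*-identityˡ (∏ (λ i → ind (not (p (f (suc i))))))))

  ind-not-all : ∀ {A : Set} {n} (p : A → Bool) (f : Fin n → A) → ind (not (all p (tabulate f))) ≤ ∑ (λ i → ind (not (p (f i))))
  ind-not-all {n = zero}  p f = ≤-refl
  ind-not-all {n = suc n} p f with p (f zero)
  ... | true  = subst (ind (not (all p (tabulate (f ∘ suc)))) ≤_) (sym (+-identityˡ (∑ (λ i → ind (not (p (f (suc i)))))))) (ind-not-all p (f ∘ suc))
  ... | false = ≤-by (∑ (λ i → ind (not (p (f (suc i)))))) (0≤∑ (λ i → 0≤ind (not (p (f (suc i)))))) refl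

  ind-all : ∀ {A : Set} {n} (p : A → Bool) (f : Fin n → A) i → ind (all p (tabulate f)) ≤ ind (p (f i))
  ind-all {n = suc n} p f zero    with p (f zero)
  ... | true  = ind≤1 (all p (tabulate (f ∘ suc)))
  ... | false = ≤-refl
  ind-all {n = suc n} p f (suc i) with p (f zero)
  ... | true  = ind-all p (f ∘ suc) i
  ... | false = 0≤ind (p (f (suc i)))

  Fin-choice : ∀ {n} {P Q : Fin n → Set} → (∀ i → P i ⊎ Q i) → (∀ i → P i) ⊎ ∃ Q
  Fin-choice {zero}  d = inj₁ λ ()
  Fin-choice {suc n} d with d zero | Fin-choice (d ∘ suc)
  ... | inj₂ q | _            = inj₂ (zero , q)
  ... | inj₁ p | inj₂ (i , q) = inj₂ (suc i , q)
  ... | inj₁ p | inj₁ ps      = inj₁ λ { zero → p ; (suc i) → ps i }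

  ∑-delta : ∀ {n} (w : Fin n → ℚ) v → ∑ (λ u → w u * ind (does (u Fin.≟ v))) ≡ w v
  ∑-delta {suc n} w zero    = trans (cong₂ _+_ (*-identityʳ (w zero)) (trans (∑-cong (λ u → *-zeroʳ (w (suc u)))) (trans (∑-const n 0ℚ) (*-zeroʳ (ι n))))) (+-identityʳ (w zero))
  ∑-delta {suc n} w (suc v) = trans (cong₂ _+_ (*-zeroʳ (w zero)) (∑-delta (w ∘ suc) v)) (+-identityˡ (w (suc v)))

  -- A random item: v with probability w v, and the empty item with the remaining probability,
  -- which is negative if the weights w add up to more than 1.
  module _ {M : ℕ} where

    drawWeight : (Fin M → ℚ) → Fin (suc M) → ℚ
    drawWeight w zero    = 1ℚ - ∑ w
    drawWeight w (suc v) = w v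

    drawItem : Fin (suc M) → Maybe (Fin M)
    drawItem zero    = nothing
    drawItem (suc v) = just v

    draw : (Fin M → ℚ) → Functional (Maybe (Fin M))
    draw w φ = ∑ (λ j → drawWeight w j * φ (drawItem j))

    draw-linear : ∀ w → Linear (draw w)
    draw-linear w = ∑-linear (drawWeight w) drawItem

    drawWeight-total : ∀ w → ∑ (drawWeight w) ≡ 1ℚ
    drawWeight-total w = lemma (∑ w)
      where
      lemma : ∀ s → 1ℚ - s + s ≡ 1ℚ
      lemma = solve-∀ ring

    draw-expectation : ∀ {w} → (∀ v → 0ℚ ≤ w v) → ∑ w ≤ 1ℚ → Expectation (λ _ → ⊤) (draw w)
    draw-expectation {w} 0≤w ∑w≤1 = ∑-expectation (drawWeight w) drawItem
      (λ { zero → 0≤q-p ∑w≤1 ; (suc v) → 0≤w v }) (drawWeight-total w) (λ _ → inj₂ tt)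

    draw-1 : ∀ w → draw w (λ _ → 1ℚ) ≡ 1ℚ
    draw-1 w = trans (∑-cong (λ j → *-identityʳ (drawWeight w j))) (drawWeight-total w)

    draw-poly : ∀ φ → IsPoly (λ w v → w v) 1 (λ w → draw w φ)
    draw-poly φ = poly-cong rearrange
      (poly-+ (poly-≤ z≤n (poly-const (φ nothing))) (poly-∑ (λ v → poly-scale (φ (just v) - φ nothing) (poly-var v))))
      where
      lemma₁ : ∀ a x y → (a - x) * y ≡ a * y + - x * y
      lemma₁ = solve-∀ ring
      lemma₂ : ∀ s f t → (1ℚ - s) * f + t ≡ f + (t + - f * s)
      lemma₂ = solve-∀ ring
      lemma₃ : ∀ w a b → w * a + - b * w ≡ (a - b) * w
      lemma₃ = solve-∀ ring
      rearrange : ∀ w → draw w φ ≡ φ nothing + ∑ (λ v → (φ (just v) - φ nothing) * w v)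
      rearrange w = trans (lemma₂ (∑ w) (φ nothing) (∑ (λ v → w v * φ (just v))))
        (cong (φ nothing +_) (trans (cong (∑ (λ v → w v * φ (just v)) +_) (sym (∑-*ˡ (- φ nothing) w)))
          (trans (sym (∑-+ (λ v → w v * φ (just v)) (λ v → - φ nothing * w v))) (∑-cong (λ v → lemma₃ (w v) (φ (just v)) (φ nothing))))))

    draw-miss : ∀ w v → draw w (λ s → ind (not (is s v))) ≡ 1ℚ - w v
    draw-miss w v = begin
      (1ℚ - ∑ w) * 1ℚ + ∑ (λ u → w u * ind (not (does (u Fin.≟ v))))
        ≡⟨ cong ((1ℚ - ∑ w) * 1ℚ +_) (∑-cong (λ u → trans (cong (w u *_) (ind-not′ (does (u Fin.≟ v)))) (lemma₁ (w u) (ind (does (u Fin.≟ v)))))) ⟩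
      (1ℚ - ∑ w) * 1ℚ + ∑ (λ u → w u + - 1ℚ * (w u * ind (does (u Fin.≟ v))))
        ≡⟨ cong ((1ℚ - ∑ w) * 1ℚ +_) (trans (∑-+ w (λ u → - 1ℚ * (w u * ind (does (u Fin.≟ v)))))
             (cong (∑ w +_) (trans (∑-*ˡ (- 1ℚ) (λ u → w u * ind (does (u Fin.≟ v)))) (cong (- 1ℚ *_) (∑-delta w v))))) ⟩
      (1ℚ - ∑ w) * 1ℚ + (∑ w + - 1ℚ * w v)
        ≡⟨ lemma₂ (∑ w) (w v) ⟩
      1ℚ - w v ∎
      where
      open ≡-Reasoning
      ind-not′ : ∀ b → ind (not b) ≡ 1ℚ - ind b
      ind-not′ true  = refl
      ind-not′ false = refl
      lemma₁ : ∀ w b → w * (1ℚ - b) ≡ w + - 1ℚ * (w * b)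
      lemma₁ = solve-∀ ring
      lemma₂ : ∀ s w → (1ℚ - s) * 1ℚ + (s + - 1ℚ * w) ≡ 1ℚ - w
      lemma₂ = solve-∀ ring

    Π-draw-miss : ∀ {N} w v → Π {N = N} (λ _ → draw w) (λ s → ind (not (any (λ i → is (lookup s i) v) (allFin N)))) ≡ (1ℚ - w v) ^ N
    Π-draw-miss {N} w v = trans (Linear.E-cong (Π-linear {N = N} (λ _ → draw-linear w)) (λ s → ind-not-any (λ i → is (lookup s i) v) (λ i → i)))
      (trans (Π-∏ {N = N} (λ _ → draw-linear w) (λ _ x → ind (not (is x v)))) (trans (∏-cong (λ (_ : Fin N) → draw-miss w v)) (∏-const N (1ℚ - w v))))

  4ℚ 12ℚ ¼ : ℚ
  4ℚ  = 2ℚ * 2ℚ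
  12ℚ = 1ℚ + ι 11
  ¼   = ½ * ½

  0≤½ : 0ℚ ≤ ½
  0≤½ = nonNegative⁻¹ ½

  0≤¼ : 0ℚ ≤ ¼
  0≤¼ = nonNegative⁻¹ ¼

  1≤4 : 1ℚ ≤ 4ℚ
  1≤4 = ≤-by 3ℚ 0≤3 refl

  -- With y = 1 / X, the product of (1 - y) ^ X and (1 + y) ^ X is at most 1, and the second factor
  -- is at least 2 by Bernoulli.
  halving : ∀ {X} → 1 ℕ.≤ X → (1ℚ - recip X) ^ X ≤ ½
  halving {X} 1≤X = begin
    (1ℚ - y) ^ X              ≡⟨ lemma₁ ((1ℚ - y) ^ X) ⟩
    ½ * ((1ℚ - y) ^ X * 2ℚ)   ≤⟨ *-monoˡ 0≤½ (begin
      (1ℚ - y) ^ X * 2ℚ                ≤⟨ *-monoˡ (0≤^ 0≤1-y X) 2≤ ⟩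
      (1ℚ - y) ^ X * (1ℚ + y) ^ X      ≡⟨ ^-*-distrib (1ℚ - y) (1ℚ + y) X ⟨
      ((1ℚ - y) * (1ℚ + y)) ^ X        ≤⟨ ^-mono (0≤* 0≤1-y (0≤+ 0≤1 (0≤recip X))) (≤-by (y * y) (0≤* (0≤recip X) (0≤recip X)) (lemma₂ y)) X ⟩
      1ℚ ^ X                           ≡⟨ 1^ X ⟩
      1ℚ                               ∎) ⟩
    ½                         ∎
    where
    open ≤-Reasoning
    y = recip X
    0≤1-y : 0ℚ ≤ 1ℚ - y
    0≤1-y = 0≤q-p (recip≤1 X)
    2≤ : 2ℚ ≤ (1ℚ + y) ^ X
    2≤ = subst (λ a → 1ℚ + a ≤ (1ℚ + y) ^ X) (trans (*-comm (ι X) y) (recip-ι 1≤X)) (bernoulli (0≤recip X) X)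
    lemma₁ : ∀ a → a ≡ ½ * (a * 2ℚ)
    lemma₁ a = sym (trans (cong (½ *_) (*-comm a 2ℚ)) (trans (sym (*-assoc ½ 2ℚ a)) (*-identityˡ a)))
    lemma₂ : ∀ y → (1ℚ - y) * (1ℚ + y) + y * y ≡ 1ℚ
    lemma₂ = solve-∀ ring

  ι-sum : ∀ {M} (z : Vec ℕ M) → ι (sum z) ≡ ∑ (λ v → ι (lookup z v))
  ι-sum []      = refl
  ι-sum (k ∷ z) = trans (ι-+ k (sum z)) (cong (ι k +_) (ι-sum z))

  ^-sum : ∀ x {M} (z : Vec ℕ M) → x ^ sum z ≡ ∏ (λ v → x ^ lookup z v)
  ^-sum x []      = refl
  ^-sum x (k ∷ z) = trans (^-+ x k (sum z)) (cong (x ^ k *_) (^-sum x z))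

  recip-* : ∀ {X T} → 1 ℕ.≤ X → 1 ℕ.≤ T → ι T * recip (X ℕ.* T) ≡ recip X
  recip-* {X} {T} 1≤X 1≤T = begin
    ι T * recip (X ℕ.* T)                        ≡⟨ *-identityˡ _ ⟨
    1ℚ * (ι T * recip (X ℕ.* T))                 ≡⟨ cong (_* (ι T * recip (X ℕ.* T))) (recip-ι 1≤X) ⟨
    recip X * ι X * (ι T * recip (X ℕ.* T))      ≡⟨ lemma (recip X) (ι X) (ι T) (recip (X ℕ.* T)) ⟩
    recip X * (recip (X ℕ.* T) * (ι X * ι T))    ≡⟨ cong (λ a → recip X * (recip (X ℕ.* T) * a)) (ι-* X T) ⟨
    recip X * (recip (X ℕ.* T) * ι (X ℕ.* T))    ≡⟨ cong (recip X *_) (recip-ι (ℕ.*-mono-≤ 1≤X 1≤T)) ⟩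
    recip X * 1ℚ                                 ≡⟨ *-identityʳ (recip X) ⟩
    recip X                                      ∎
    where
    open ≡-Reasoning
    lemma : ∀ a b c d → a * b * (c * d) ≡ a * (d * (b * c))
    lemma = solve-∀ ring

  val-abs : ∀ b → ∣ val b ∣ ≤ 1ℚ
  val-abs true  = ≤-refl
  val-abs false = ≤-refl

  ∣p+q∣≤ : ∀ p q {a b} → ∣ p ∣ ≤ a → ∣ q ∣ ≤ b → ∣ p + q ∣ ≤ a + b
  ∣p+q∣≤ p q l m = ≤-trans (∣p+q∣≤∣p∣+∣q∣ p q) (+-mono-≤ l m)

  ∣-∣-triangle : ∀ p q r {a b} → ∣ p - q ∣ ≤ a → ∣ q - r ∣ ≤ b → ∣ p - r ∣ ≤ a + b
  ∣-∣-triangle p q r {a} {b} l m = subst (λ x → ∣ x ∣ ≤ a + b) (lemma p q r) (∣p+q∣≤ (p - q) (q - r) l m)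
    where
    lemma : ∀ p q r → p - q + (q - r) ≡ p - r
    lemma = solve-∀ ring

  -- Averaging an approximating polynomial

  -- `D` is the lower bound aimed at and `D′` the degree of p. Items take the value v with
  -- probability z v / X for X = D H, and t X items miss a value of count at least 1 with
  -- probability at most 1 / 2 ^ t. The factor D in X ensures that counts overflowing X lie at least
  -- D multiples of H out, where the tail bound gains ¼ ^ D.
  module Average
    (R m M N n : ℕ) (row : Fin M → Fin R) (cell : Fin R → Fin m → Fin M)
    (row-cell : ∀ r a → row (cell r a) ≡ r) (cell-row : ∀ v → ∃ λ a → cell (row v) a ≡ v)
    (fibre : ∀ r ε → ∏ (λ v → if does (row v Fin.≟ r) then ε else 1ℚ) ≡ ε ^ m)
    (item : Fin n → Fin N) (digit : Maybe (Fin M) → Fin n → Bool)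
    (f : BoolFun R) (f-cong : ∀ {u u′} → (∀ r → u r ≡ u′ r) → f u ≡ f u′)
    (F : BoolFun n)
    (F-enc : ∀ (s : Vec (Maybe (Fin M)) N) → F (λ z → digit (lookup s (item z)) z) ≡
      f (λ r → all (λ v → any (λ i → is (lookup s i) v) (allFin N)) (map (cell r) (allFin m))))
    {h t K W : ℕ} (pair : Indistinguishable h t K W)
    (H D : ℕ) (1≤H : 1 ℕ.≤ H) (1≤D : 1 ℕ.≤ D) (N≡ : N ≡ t ℕ.* (D ℕ.* H)) (1≤t : 1 ℕ.≤ t)
    (K-small : 2ℚ * (ι K * (ι 11 * recip H)) ≤ 1ℚ)
    (p : Poly n) (D′ : ℕ) (D′≤D : D′ ℕ.≤ D) (deg-p : degAtMost D′ p) (η : ℚ) (η≤1 : η ≤ 1ℚ)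
    (p-close : ∀ x → ∣ evalPoly p x - val (F x) ∣ ≤ η)
    where

    open Indistinguishable pair

    Items : Set
    Items = Vec (Maybe (Fin M)) N

    X : ℕ
    X = D ℕ.* H

    1≤X : 1 ℕ.≤ X
    1≤X = ℕ.*-mono-≤ 1≤D 1≤H

    enc : Items → Fin n → Bool
    enc s z = digit (lookup s (item z)) z

    hit : Items → Fin M → Bool
    hit s v = any (λ i → is (lookup s i) v) (allFin N)

    decode : Items → Fin R → Bool
    decode s r = all (hit s) (map (cell r) (allFin m))

    sampled : (Fin M → ℚ) → Functional Items
    sampled w = Π (λ _ → draw w)

    avg-poly : IsPoly (λ (w : Fin M → ℚ) v → w v) D′ (λ w → sampled w (λ s → evalPoly p (enc s)))
    avg-poly = Π-poly (λ w v → w v) 1 (λ s z → val (digit s z)) factor item (λ e le → subst (ℕ._≤ D′) (ℕ.*-identityˡ e) le) p deg-p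
      where
      -- The law of one item is affine in the weights, so reading any number of its bits costs one
      -- degree.
      factor : Fin N → Factor (λ w v → w v) 1 (λ s z → val (digit s z))
      factor _ = draw , draw-linear , λ
        { []       → 0 , z≤n , poly-cong draw-1 (poly-const 1ℚ)
        ; (z ∷ zs) → 1 , s≤s z≤n , draw-poly (λ s → mono (λ z → val (digit s z)) (z ∷ zs)) }

    pw : List (ℚ × List (Fin M))
    pw = IsPoly.poly avg-poly

    pw-value : ∀ w → sampled w (λ s → evalPoly p (enc s)) ≡ evalP w pw
    pw-value = IsPoly.value avg-poly

    ∣p∣≤2 : ∀ x → ∣ evalPoly p x ∣ ≤ 2ℚ
    ∣p∣≤2 x = subst (λ a → ∣ a ∣ ≤ 2ℚ) (lemma (evalPoly p x) (val (F x))) (∣p+q∣≤ (evalPoly p x - val (F x)) (val (F x)) (≤-trans (p-close x) η≤1) (val-abs (F x)))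
      where
      lemma : ∀ a b → a - b + b ≡ a
      lemma = solve-∀ ring

    module Valid (w : Fin M → ℚ) (0≤w : ∀ v → 0ℚ ≤ w v) (∑w≤1 : ∑ w ≤ 1ℚ) where

      open Expectation (Π-expectation {N = N} (λ _ → draw-expectation 0≤w ∑w≤1)) public

      ∣avg∣≤2 : ∣ evalP w pw ∣ ≤ 2ℚ
      ∣avg∣≤2 = subst (λ a → ∣ a ∣ ≤ 2ℚ) (pw-value w)
        (≤-trans (∣E∣≤ (λ s _ → ∣p∣≤2 (enc s))) (≤-reflexive (E-const 2ℚ)))

      E-ind≤1 : ∀ (b : Items → Bool) → sampled w (λ s → ind (b s)) ≤ 1ℚ
      E-ind≤1 b = E-≤const (λ s _ → ind≤1 (b s))

      hit-prob : ∀ v → sampled w (λ s → ind (hit s v)) ≡ 1ℚ - (1ℚ - w v) ^ N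
      hit-prob v = trans (E-cong (λ s → trans (ind-not (hit s v)) (lemma (ind (not (hit s v))))))
        (trans (E-+ (λ _ → 1ℚ) (λ s → - 1ℚ * ind (not (hit s v))))
        (trans (cong₂ _+_ E-1 (trans (E-* (- 1ℚ) (λ s → ind (not (hit s v)))) (cong (- 1ℚ *_) (Π-draw-miss {N = N} w v)))) (sym (lemma ((1ℚ - w v) ^ N)))))
        where
        lemma : ∀ a → 1ℚ - a ≡ 1ℚ + - 1ℚ * a
        lemma = solve-∀ ring

    weights : Vec ℕ M → Fin M → ℚ
    weights z v = ι (lookup z v) * recip X

    0≤weights : ∀ z v → 0ℚ ≤ weights z v
    0≤weights z v = 0≤* (0≤ι (lookup z v)) (0≤recip X)

    ∑-weights : ∀ z → ∑ (weights z) ≡ ι (sum z) * recip X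
    ∑-weights z = trans (∑-*ʳ (recip X) (λ v → ι (lookup z v))) (cong (_* recip X) (sym (ι-sum z)))

    miss : ℚ
    miss = ι m * ½ ^ t

    0≤miss : 0ℚ ≤ miss
    0≤miss = 0≤* (0≤ι m) (0≤^ 0≤½ t)

    -- The product over all v indicates that every count of row r is nonzero. Padding the other rows
    -- with 1 makes it a product over all counts, to which independence applies.
    near : Fin R → Fin M → ℕ → ℚ
    near r v k = if does (row v Fin.≟ r) then nonzero k else 1ℚ

    0≤nonzero : ∀ k → 0ℚ ≤ nonzero k
    0≤nonzero zero    = ≤-refl
    0≤nonzero (suc k) = 0≤1

    0≤near : ∀ r v k → 0ℚ ≤ near r v k
    0≤near r v k with does (row v Fin.≟ r)
    ... | true  = 0≤nonzero k
    ... | false = 0≤1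

    -- Bounds the probability of decoding u r wrongly, given the counts z.
    bad : (Fin R → Bool) → Fin R → Vec ℕ M → ℚ
    bad u r z = if u r then miss else ∏ (λ v → near r v (lookup z v))

    0≤bad : ∀ u r z → 0ℚ ≤ bad u r z
    0≤bad u r z with u r
    ... | true  = 0≤miss
    ... | false = 0≤∏ (λ v → 0≤near r v (lookup z v))

    Supported : (Fin R → Bool) → Vec ℕ M → Set
    Supported u z = ∀ v → Range K (u (row v)) (lookup z v)

    val-diff : ∀ (u u′ : Fin R → Bool) → ∣ val (f u′) - val (f u) ∣ ≤ 2ℚ * ∑ (λ r → ind (u r xor u′ r))
    val-diff u u′ with Fin-choice {P = λ r → u′ r ≡ u r} {Q = λ r → ind (u r xor u′ r) ≡ 1ℚ} (λ r → compare (u r) (u′ r))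
      where
      compare : ∀ a b → b ≡ a ⊎ ind (a xor b) ≡ 1ℚ
      compare true  true  = inj₁ refl
      compare true  false = inj₂ refl
      compare false true  = inj₂ refl
      compare false false = inj₁ refl
    ... | inj₁ same    = subst (λ b → ∣ val b - val (f u) ∣ ≤ _) (sym (f-cong same))
      (subst (_≤ 2ℚ * ∑ (λ r → ind (u r xor u′ r))) (sym (cong ∣_∣ (+-inverseʳ (val (f u))))) (0≤* 0≤2 (0≤∑ (λ r → 0≤ind (u r xor u′ r)))))
    ... | inj₂ (r , e) = ≤-trans (∣p-q∣≤∣p∣+∣q∣ (val (f u′)) (val (f u))) (≤-trans (+-mono-≤ (val-abs (f u′)) (val-abs (f u)))
      (*-monoˡ {p = 1ℚ} 0≤2 (subst (_≤ ∑ (λ r → ind (u r xor u′ r))) e (term≤∑ (λ r → 0≤ind (u r xor u′ r)) r))))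

    module _ (u : Fin R → Bool) (z : Vec ℕ M) (supp : Supported u z) (fits : sum z ℕ.≤ X) where

      private
        w = weights z

        ∑w≤1 : ∑ w ≤ 1ℚ
        ∑w≤1 = subst (_≤ 1ℚ) (sym (∑-weights z))
          (≤-trans (*-monoʳ (0≤recip X) (ι-mono fits)) (≤-reflexive (trans (*-comm (ι X) (recip X)) (recip-ι 1≤X))))

        open Valid w (0≤weights z) ∑w≤1

        w≤1 : ∀ v → w v ≤ 1ℚ
        w≤1 v = ≤-trans (term≤∑ (0≤weights z) v) ∑w≤1

        miss-prob : ∀ v → 1 ℕ.≤ lookup z v → (1ℚ - w v) ^ N ≤ ½ ^ t
        miss-prob v 1≤z = begin
          (1ℚ - w v) ^ N               ≤⟨ ^-mono (0≤q-p (w≤1 v)) (+-monoʳ-≤ 1ℚ (neg-antimono-≤ y≤w)) N ⟩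
          (1ℚ - recip X) ^ N           ≡⟨ cong ((1ℚ - recip X) ^_) N≡ ⟩
          (1ℚ - recip X) ^ (t ℕ.* X)   ≡⟨ ^-^ (1ℚ - recip X) t X ⟩
          ((1ℚ - recip X) ^ X) ^ t     ≤⟨ ^-mono (0≤^ (0≤q-p (recip≤1 X)) X) (halving 1≤X) t ⟩
          ½ ^ t                        ∎
          where
          open ≤-Reasoning
          y≤w : recip X ≤ w v
          y≤w = subst (_≤ w v) (*-identityˡ (recip X)) (*-monoʳ (0≤recip X) (1≤ι 1≤z))

        error : ∀ r → sampled w (λ s → ind (u r xor decode s r)) ≤ bad u r z
        error r with u r in ur
        ... | true  = begin
          sampled w (λ s → ind (not (decode s r)))
            ≤⟨ E-mono (λ s _ → subst (λ b → ind (not b) ≤ ∑ (λ a → ind (not (hit s (cell r a))))) (sym (all-map (hit s) (cell r) (allFin m)))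
                 (ind-not-all (λ a → hit s (cell r a)) (λ a → a))) ⟩
          sampled w (λ s → ∑ (λ a → ind (not (hit s (cell r a)))))
            ≡⟨ E-∑ (λ a s → ind (not (hit s (cell r a)))) ⟩
          ∑ (λ a → sampled w (λ s → ind (not (hit s (cell r a)))))
            ≡⟨ ∑-cong (λ a → Π-draw-miss {N = N} w (cell r a)) ⟩
          ∑ (λ a → (1ℚ - w (cell r a)) ^ N)
            ≤⟨ ∑-≤const (λ a → miss-prob (cell r a) (1≤z a)) ⟩
          miss ∎
          where
          open ≤-Reasoning
          1≤z : ∀ a → 1 ℕ.≤ lookup z (cell r a)
          1≤z a = proj₁ (subst (λ b → Range K b (lookup z (cell r a))) (trans (cong u (row-cell r a)) ur) (supp (cell r a)))
        -- Either every count of the row is nonzero and the claimed bound is 1, or some pair has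
        -- count 0, is never drawn, and the row is surely decoded as false.
        ... | false with Fin-choice {P = λ a → nonzero (lookup z (cell r a)) ≡ 1ℚ} {Q = λ a → lookup z (cell r a) ≡ 0} (λ a → cases (lookup z (cell r a)))
          where
          cases : ∀ k → nonzero k ≡ 1ℚ ⊎ k ≡ 0
          cases zero    = inj₂ refl
          cases (suc k) = inj₁ refl
        ...   | inj₁ all-hit  = ≤-trans (E-ind≤1 (λ s → decode s r)) (≤-reflexive (sym (trans (∏-cong near-1) (trans (∏-const M 1ℚ) (1^ M)))))
          where
          near-1 : ∀ v → near r v (lookup z v) ≡ 1ℚ
          near-1 v with row v Fin.≟ r
          ... | no  _    = refl
          ... | yes refl with cell-row v
          ...   | a , e = subst (λ v → nonzero (lookup z v) ≡ 1ℚ) e (all-hit a)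
        ...   | inj₂ (a , z₀) = ≤-trans (≤-trans
            (E-mono (λ s _ → subst (λ b → ind b ≤ ind (hit s (cell r a))) (sym (all-map (hit s) (cell r) (allFin m))) (ind-all (λ a → hit s (cell r a)) (λ a → a) a)))
            (≤-reflexive (trans (hit-prob (cell r a)) (cong (λ x → 1ℚ - x) (trans (cong (_^ N) no-weight) (1^ N))))))
          (0≤∏ (λ v → 0≤near r v (lookup z v)))
          where
          no-weight : 1ℚ - w (cell r a) ≡ 1ℚ
          no-weight = cong (λ x → 1ℚ - x) (trans (cong (λ k → ι k * recip X) z₀) (*-zeroˡ (recip X)))

      close-inside : ∣ evalP (weights z) pw - val (f u) ∣ ≤ η + 2ℚ * ∑ (λ r → bad u r z)
      close-inside = begin
        ∣ evalP w pw - val (f u) ∣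
          ≡⟨ cong ∣_∣ (trans (cong (_- val (f u)) (sym (pw-value w))) (sym (E-shift (λ s → evalPoly p (enc s)) (val (f u))))) ⟩
        ∣ sampled w (λ s → evalPoly p (enc s) - val (f u)) ∣
          ≤⟨ ∣E∣≤ (λ s _ → ∣-∣-triangle (evalPoly p (enc s)) (val (f (decode s))) (val (f u)) (subst (λ b → ∣ evalPoly p (enc s) - val b ∣ ≤ η) (F-enc s) (p-close (enc s))) (val-diff u (decode s))) ⟩
        sampled w (λ s → η + 2ℚ * ∑ (λ r → ind (u r xor decode s r)))
          ≡⟨ trans (E-+ (λ _ → η) (λ s → 2ℚ * ∑ (λ r → ind (u r xor decode s r))))
               (cong₂ _+_ (E-const η) (trans (E-* 2ℚ (λ s → ∑ (λ r → ind (u r xor decode s r)))) (cong (2ℚ *_) (E-∑ (λ r s → ind (u r xor decode s r)))))) ⟩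
        η + 2ℚ * ∑ (λ r → sampled w (λ s → ind (u r xor decode s r)))
          ≤⟨ +-monoʳ-≤ η (*-monoˡ 0≤2 (∑-mono error)) ⟩
        η + 2ℚ * ∑ (λ r → bad u r z) ∎
        where open ≤-Reasoning

    -- 11 is chosen for x ^ H ≥ 12 = 3 · 4. The 3 pays for `growth`, and the 4 yields ¼ ^ D, of
    -- which a factor 2 ^ D is later spent on the expectation of x ^ sum z.
    x : ℚ
    x = 1ℚ + ι 11 * recip H

    0≤11/H : 0ℚ ≤ ι 11 * recip H
    0≤11/H = 0≤* (0≤ι 11) (0≤recip H)

    1≤x : 1ℚ ≤ x
    1≤x = ≤-by (ι 11 * recip H) 0≤11/H refl

    0≤x : 0ℚ ≤ x
    0≤x = ≤-trans 0≤1 1≤x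

    12≤x^H : 12ℚ ≤ x ^ H
    12≤x^H = subst (_≤ x ^ H) (cong (1ℚ +_) (trans (lemma (ι H) (ι 11) (recip H)) (trans (cong (ι 11 *_) (recip-ι 1≤H)) (*-identityʳ (ι 11))))) (bernoulli 0≤11/H H)
      where
      lemma : ∀ h a r → h * (a * r) ≡ a * (r * h)
      lemma = solve-∀ ring

    -- On the ray through z the average is a polynomial of degree D that is bounded by 2 up to
    -- the simplex, so outside it is at most exponential in T = ⌈sum z / H⌉.
    close-outside : ∀ u (z : Vec ℕ M) → X ℕ.< sum z → ∣ evalP (weights z) pw - val (f u) ∣ ≤ ι 9 * (¼ ^ D * x ^ sum z)
    close-outside u z X<S = begin
      ∣ evalP (weights z) pw - val (f u) ∣   ≤⟨ ∣p-q∣≤∣p∣+∣q∣ (evalP (weights z) pw) (val (f u)) ⟩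
      ∣ evalP (weights z) pw ∣ + ∣ val (f u) ∣  ≤⟨ +-mono-≤ at-T (≤-trans (val-abs (f u)) (1≤^ 1≤3 T)) ⟩
      2ℚ * 3ℚ ^ T + 3ℚ ^ T                   ≡⟨ lemma₁ (3ℚ ^ T′) ⟩
      ι 9 * 3ℚ ^ T′                          ≤⟨ *-monoˡ (0≤ι 9) (begin
        3ℚ ^ T′                                ≡⟨ *-identityˡ (3ℚ ^ T′) ⟨
        1ℚ * 3ℚ ^ T′                           ≡⟨ cong (_* 3ℚ ^ T′) (trans (sym (^-*-distrib ¼ 4ℚ D)) (1^ D)) ⟨
        ¼ ^ D * 4ℚ ^ D * 3ℚ ^ T′               ≤⟨ *-monoʳ (0≤^ 0≤3 T′) (*-monoˡ (0≤^ 0≤¼ D) (^-monoʳ 1≤4 D≤T′)) ⟩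
        ¼ ^ D * 4ℚ ^ T′ * 3ℚ ^ T′              ≡⟨ *-assoc (¼ ^ D) (4ℚ ^ T′) (3ℚ ^ T′) ⟩
        ¼ ^ D * (4ℚ ^ T′ * 3ℚ ^ T′)            ≡⟨ cong (¼ ^ D *_) (^-*-distrib 4ℚ 3ℚ T′) ⟨
        ¼ ^ D * 12ℚ ^ T′                       ≤⟨ *-monoˡ (0≤^ 0≤¼ D) (≤-trans (^-mono (nonNegative⁻¹ 12ℚ) 12≤x^H T′)
                                                    (≤-trans (≤-reflexive (sym (^-^ x T′ H))) (^-monoʳ 1≤x T′H≤S))) ⟩
        ¼ ^ D * x ^ sum z                      ∎) ⟩
      ι 9 * (¼ ^ D * x ^ sum z)              ∎
      where
      open ≤-Reasoning
      instance
        H≢0 : ℕ.NonZero H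
        H≢0 = ℕ.>-nonZero 1≤H
      S′ = ℕ.pred (sum z)
      S≡ : sum z ≡ suc S′
      S≡ = sym (ℕ.suc-pred (sum z) {{ℕ.>-nonZero (ℕ.≤-<-trans z≤n X<S)}})
      T′ = S′ ℕ./ H
      T = suc T′
      lemma₁ : ∀ a → (1ℚ + 1ℚ) * ((1ℚ + (1ℚ + 1ℚ)) * a) + (1ℚ + (1ℚ + 1ℚ)) * a ≡ ι 9 * a
      lemma₁ a = trans (cong (_+ 3ℚ * a) (sym (*-assoc 2ℚ 3ℚ a))) (sym (*-distribʳ-+ a (2ℚ * 3ℚ) 3ℚ))
      T′H≤S : T′ ℕ.* H ℕ.≤ sum z
      T′H≤S = ℕ.≤-trans (ℕ.m≤n+m (T′ ℕ.* H) (S′ ℕ.% H)) (ℕ.≤-trans (ℕ.≤-reflexive (sym (m≡m%n+[m/n]*n S′ H))) (ℕ.≤-trans (ℕ.n≤1+n S′) (ℕ.≤-reflexive (sym S≡))))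
      S≤TH : sum z ℕ.≤ T ℕ.* H
      S≤TH = ℕ.≤-trans (ℕ.≤-reflexive (trans S≡ (cong suc (m≡m%n+[m/n]*n S′ H)))) (ℕ.+-monoˡ-≤ (T′ ℕ.* H) (m%n<n S′ H))
      D≤T′ : D ℕ.≤ T′
      D≤T′ = ℕ.≤-pred (ℕ.*-cancelʳ-< H D T (ℕ.<-≤-trans X<S S≤TH))
      -- The T-th point of the ray is `weights z`; the points up to D lie in the simplex because D ·
      -- sum z ≤ D T H = X T.
      ray : Fin M → ℚ
      ray v = ι (lookup z v) * recip (X ℕ.* T)
      0≤ray : ∀ i v → 0ℚ ≤ ι i * ray v
      0≤ray i v = 0≤* (0≤ι i) (0≤* (0≤ι (lookup z v)) (0≤recip (X ℕ.* T)))
      ∑ray≤1 : ∀ i → i ℕ.≤ D → ∑ (λ v → ι i * ray v) ≤ 1ℚ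
      ∑ray≤1 i i≤D = begin
        ∑ (λ v → ι i * ray v)                      ≡⟨ trans (∑-*ˡ (ι i) ray) (cong (ι i *_) (trans (∑-*ʳ (recip (X ℕ.* T)) (λ v → ι (lookup z v))) (cong (_* recip (X ℕ.* T)) (sym (ι-sum z))))) ⟩
        ι i * (ι (sum z) * recip (X ℕ.* T))        ≡⟨ trans (sym (*-assoc (ι i) (ι (sum z)) (recip (X ℕ.* T)))) (cong (_* recip (X ℕ.* T)) (sym (ι-* i (sum z)))) ⟩
        ι (i ℕ.* sum z) * recip (X ℕ.* T)          ≤⟨ *-monoʳ (0≤recip (X ℕ.* T)) (ι-mono (ℕ.≤-trans (ℕ.*-mono-≤ i≤D S≤TH) (ℕ.≤-reflexive regroup))) ⟩
        ι (X ℕ.* T) * recip (X ℕ.* T)              ≡⟨ trans (*-comm (ι (X ℕ.* T)) (recip (X ℕ.* T))) (recip-ι (ℕ.*-mono-≤ {1} {X} {1} {T} 1≤X (s≤s z≤n))) ⟩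
        1ℚ                                         ∎
        where
        regroup : D ℕ.* (T ℕ.* H) ≡ X ℕ.* T
        regroup = trans (cong (D ℕ.*_) (ℕ.*-comm T H)) (sym (ℕ.*-assoc D H T))
      G : ℕ → ℚ
      G i = evalP (λ v → ι i * ray v) pw
      at-T : ∣ evalP (weights z) pw ∣ ≤ 2ℚ * 3ℚ ^ T
      at-T = subst (λ a → ∣ a ∣ ≤ 2ℚ * 3ℚ ^ T) (evalP-cong end pw)
        (growth D {G} 0≤2 (below-ray ray D pw (IsPoly.degree (poly-≤ D′≤D avg-poly))) (λ i i≤D → Valid.∣avg∣≤2 (λ v → ι i * ray v) (0≤ray i) (∑ray≤1 i i≤D)) T)
        where
        lemma : ∀ a b c → a * (b * c) ≡ b * (a * c)
        lemma = solve-∀ ring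
        end : ∀ v → ι T * ray v ≡ weights z v
        end v = trans (lemma (ι T) (ι (lookup z v)) (recip (X ℕ.* T))) (cong (ι (lookup z v) *_) (recip-* {X} {T} 1≤X (s≤s z≤n)))

    ρ : ℚ
    ρ = 2ℚ * (ι W * (ι 11 * recip H))

    tail : ℚ
    tail = ι 9 * (¼ ^ D * (1ℚ + ρ) ^ M)

    module _ (u : Fin R → Bool) where

      marginal : ∀ v → Expectation (Range K (u (row v))) (μ (u (row v)))
      marginal v = expectation (u (row v))

      counts : Functional (Vec ℕ M)
      counts = Π (λ v → μ (u (row v)))

      open Expectation (Π-expectation marginal)

      counts-∏ : ∀ (φ : Fin M → ℕ → ℚ) → counts (λ z → ∏ (λ v → φ v (lookup z v))) ≡ ∏ (λ v → μ (u (row v)) (φ v))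
      counts-∏ = Π-∏ (λ v → Expectation.linear (marginal v))

      in-range : ∀ b {k} → Range K b k → k ℕ.≤ K
      in-range true  = proj₂
      in-range false = λ l → l

      -- The bound K on the range linearises x ^ k pointwise; after that only the mean matters.
      E-x^≤ : ∀ b → μ b (x ^_) ≤ 1ℚ + ρ
      E-x^≤ b = begin
        μ b (x ^_)
          ≤⟨ Eb.E-mono (λ k l → bernoulli-upper 0≤11/H k (≤-trans (*-monoˡ 0≤2 (*-monoʳ 0≤11/H (ι-mono (in-range b l)))) K-small)) ⟩
        μ b (λ k → 1ℚ + 2ℚ * (ι k * (ι 11 * recip H)))
          ≡⟨ trans (Eb.E-+ (λ _ → 1ℚ) (λ k → 2ℚ * (ι k * (ι 11 * recip H)))) (cong₂ _+_ Eb.E-1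
               (trans (Eb.E-* 2ℚ (λ k → ι k * (ι 11 * recip H))) (cong (2ℚ *_) (Eb.E-*ʳ (ι 11 * recip H) ι)))) ⟩
        1ℚ + 2ℚ * (μ b ι * (ι 11 * recip H))
          ≤⟨ +-monoʳ-≤ 1ℚ (*-monoˡ 0≤2 (*-monoʳ 0≤11/H (mean b))) ⟩
        1ℚ + ρ ∎
        where
        open ≤-Reasoning
        module Eb = Expectation (expectation b)

      E-x^sum≤ : counts (λ z → x ^ sum z) ≤ (1ℚ + ρ) ^ M
      E-x^sum≤ = begin
        counts (λ z → x ^ sum z)                   ≡⟨ E-cong (^-sum x) ⟩
        counts (λ z → ∏ (λ v → x ^ lookup z v))    ≡⟨ counts-∏ (λ _ → x ^_) ⟩
        ∏ (λ v → μ (u (row v)) (x ^_))             ≤⟨ ∏-mono (λ v → Expectation.0≤E (marginal v) (λ k _ → 0≤^ 0≤x k)) (λ v → E-x^≤ (u (row v))) ⟩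
        ∏ {M} (λ _ → 1ℚ + ρ)                       ≡⟨ ∏-const M (1ℚ + ρ) ⟩
        (1ℚ + ρ) ^ M                               ∎
        where open ≤-Reasoning

      μ-false-nonzero≤ : μ false nonzero ≤ recip t
      μ-false-nonzero≤ = begin
        μ false nonzero                    ≡⟨ *-identityˡ (μ false nonzero) ⟨
        1ℚ * μ false nonzero               ≡⟨ cong (_* μ false nonzero) (recip-ι 1≤t) ⟨
        recip t * ι t * μ false nonzero    ≡⟨ *-assoc (recip t) (ι t) (μ false nonzero) ⟩
        recip t * (ι t * μ false nonzero)  ≤⟨ *-monoˡ (0≤recip t) concentrated ⟩
        recip t * 1ℚ                       ≡⟨ *-identityʳ (recip t) ⟩
        recip t                            ∎
        where open ≤-Reasoning

      E-bad≤ : ∀ r → counts (bad u r) ≤ miss + recip t ^ m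
      E-bad≤ r with u r in ur
      ... | true  = ≤-trans (≤-reflexive (E-const miss)) (≤-by (recip t ^ m) (0≤^ (0≤recip t) m) refl)
      ... | false = begin
        counts (λ z → ∏ (λ v → near r v (lookup z v)))             ≡⟨ counts-∏ (near r) ⟩
        ∏ (λ v → μ (u (row v)) (near r v))                         ≤⟨ ∏-mono (λ v → Expectation.0≤E (marginal v) (λ k _ → 0≤near r v k)) each ⟩
        ∏ (λ v → if does (row v Fin.≟ r) then recip t else 1ℚ)     ≡⟨ fibre r (recip t) ⟩
        recip t ^ m                                                ≤⟨ ≤-by miss 0≤miss (+-comm (recip t ^ m) miss) ⟩
        miss + recip t ^ m                                         ∎
        where
        open ≤-Reasoning
        each : ∀ v → μ (u (row v)) (near r v) ≤ (if does (row v Fin.≟ r) then recip t else 1ℚ)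
        each v with row v Fin.≟ r
        ... | no  _    = ≤-reflexive (Expectation.E-1 (marginal v))
        ... | yes refl = subst (λ b → μ b nonzero ≤ recip t) (sym ur) μ-false-nonzero≤

      average-close : ∣ counts (λ z → evalP (weights z) pw) - val (f u) ∣ ≤ η + 2ℚ * (ι R * (miss + recip t ^ m)) + tail
      average-close = begin
        ∣ counts (λ z → evalP (weights z) pw) - val (f u) ∣
          ≡⟨ cong ∣_∣ (E-shift (λ z → evalP (weights z) pw) (val (f u))) ⟨
        ∣ counts (λ z → evalP (weights z) pw - val (f u)) ∣
          ≤⟨ ∣E∣≤ pointwise ⟩
        counts (λ z → η + 2ℚ * ∑ (λ r → bad u r z) + ι 9 * (¼ ^ D * x ^ sum z))
          ≡⟨ trans (E-+ (λ z → η + 2ℚ * ∑ (λ r → bad u r z)) (λ z → ι 9 * (¼ ^ D * x ^ sum z)))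
               (cong₂ _+_
                 (trans (E-+ (λ _ → η) (λ z → 2ℚ * ∑ (λ r → bad u r z)))
                   (cong₂ _+_ (E-const η) (trans (E-* 2ℚ (λ z → ∑ (λ r → bad u r z))) (cong (2ℚ *_) (E-∑ (bad u))))))
                 (trans (E-* (ι 9) (λ z → ¼ ^ D * x ^ sum z)) (cong (ι 9 *_) (E-* (¼ ^ D) (λ z → x ^ sum z))))) ⟩
        η + 2ℚ * ∑ (λ r → counts (bad u r)) + ι 9 * (¼ ^ D * counts (λ z → x ^ sum z))
          ≤⟨ +-mono-≤ (+-monoʳ-≤ η (*-monoˡ 0≤2 (∑-≤const E-bad≤))) (*-monoˡ (0≤ι 9) (*-monoˡ (0≤^ 0≤¼ D) E-x^sum≤)) ⟩
        η + 2ℚ * (ι R * (miss + recip t ^ m)) + tail ∎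
        where
        open ≤-Reasoning
        0≤η : 0ℚ ≤ η
        0≤η = ≤-trans (0≤∣p∣ (evalPoly p (λ _ → true) - val (F (λ _ → true)))) (p-close (λ _ → true))
        0≤∑bad : ∀ z → 0ℚ ≤ 2ℚ * ∑ (λ r → bad u r z)
        0≤∑bad z = 0≤* 0≤2 (0≤∑ (λ r → 0≤bad u r z))
        0≤out : ∀ z → 0ℚ ≤ ι 9 * (¼ ^ D * x ^ sum z)
        0≤out z = 0≤* (0≤ι 9) (0≤* (0≤^ 0≤¼ D) (0≤^ 0≤x (sum z)))
        pointwise : ∀ z → Supported u z → ∣ evalP (weights z) pw - val (f u) ∣ ≤ η + 2ℚ * ∑ (λ r → bad u r z) + ι 9 * (¼ ^ D * x ^ sum z)
        pointwise z supp with ℕ.≤-<-connex (sum z) X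
        ... | inj₁ S≤X = ≤-trans (close-inside u z supp S≤X) (≤-by (ι 9 * (¼ ^ D * x ^ sum z)) (0≤out z) refl)
        ... | inj₂ X<S = ≤-trans (close-outside u z X<S)
          (≤-by (η + 2ℚ * ∑ (λ r → bad u r z)) (0≤+ 0≤η (0≤∑bad z)) (+-comm (ι 9 * (¼ ^ D * x ^ sum z)) (η + 2ℚ * ∑ (λ r → bad u r z))))

    module _ (κ : ℕ) (κ≤h : κ ℕ.≤ h) where

      private
        coordinate : (Fin R → Bool) → Fin R → ℚ
        coordinate u r = val (u r)

        scaled : ℕ → Fin M → ℚ
        scaled k _ = ι k * recip X

        moment : ∀ b zs → μ b (λ k → mono (scaled k) zs) ≡ recip X ^ length zs * μ b (λ k → ι k ^ length zs)
        moment b zs = trans (E-cong (λ k → trans (power k zs) (trans (^-*-distrib (ι k) (recip X) (length zs)) (*-comm (ι k ^ length zs) (recip X ^ length zs)))))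
          (E-* (recip X ^ length zs) (λ k → ι k ^ length zs))
          where
          open Expectation (expectation b)
          power : ∀ k zs → mono (scaled k) zs ≡ (ι k * recip X) ^ length zs
          power k []       = refl
          power k (v ∷ zs) = cong (ι k * recip X *_) (power k zs)

        boolean : ∀ (c : Bool → ℚ) r → IsPoly coordinate 1 (λ u → c (u r))
        boolean c r = poly-cong (λ u → interpolate (u r))
          (poly-+ (poly-≤ z≤n (poly-const (½ * (c false + c true)))) (poly-scale (½ * (c false - c true)) (poly-var r)))
          where
          lemma₁ : ∀ h a b → h * (a + b) + h * (a - b) * - 1ℚ ≡ (h + h) * b
          lemma₁ = solve-∀ ring
          lemma₂ : ∀ h a b → h * (a + b) + h * (a - b) * 1ℚ ≡ (h + h) * a
          lemma₂ = solve-∀ ring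
          interpolate : ∀ b → c b ≡ ½ * (c false + c true) + ½ * (c false - c true) * val b
          interpolate true  = sym (trans (lemma₁ ½ (c false) (c true)) (*-identityˡ (c true)))
          interpolate false = sym (trans (lemma₂ ½ (c false) (c true)) (*-identityˡ (c false)))

        -- Up to h occurrences of one count give a moment shared by both distributions, which does
        -- not depend on u. More occurrences give a function of one Boolean, which is affine in its
        -- value.
        factor : Fin M → Factor coordinate κ scaled
        factor v = (λ u → μ (u (row v))) , (λ u → Expectation.linear (expectation (u (row v)))) , degree
          where
          degree : ∀ zs → ∃ λ e → κ ℕ.* e ℕ.≤ length zs × IsPoly coordinate e (λ u → μ (u (row v)) (λ k → mono (scaled k) zs))
          degree zs with ℕ.≤-<-connex (length zs) h
          ... | inj₁ short = 0 , ℕ.≤-trans (ℕ.≤-reflexive (ℕ.*-zeroʳ κ)) z≤n ,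
            poly-cong (λ u → agree (u (row v))) (poly-const (μ false (λ k → mono (scaled k) zs)))
            where
            agree : ∀ b → μ b (λ k → mono (scaled k) zs) ≡ μ false (λ k → mono (scaled k) zs)
            agree false = refl
            agree true  = trans (moment true zs) (trans (cong (recip X ^ length zs *_) (moments (length zs) short)) (sym (moment false zs)))
          ... | inj₂ long  = 1 , ℕ.≤-trans (ℕ.≤-reflexive (ℕ.*-identityʳ κ)) (ℕ.≤-trans κ≤h (ℕ.<⇒≤ long)) ,
            boolean (λ b → μ b (λ k → mono (scaled k) zs)) (row v)

      average-poly : ∀ {e} → (∀ d → κ ℕ.* d ℕ.≤ D′ → d ℕ.≤ e) →
        IsPoly (λ (u : Fin R → Bool) r → val (u r)) e (λ u → counts u (λ z → evalP (weights z) pw))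
      average-poly bound = Π-poly coordinate κ scaled factor (λ v → v) bound pw (IsPoly.degree avg-poly)

  -- The amplification step

  ∏-+ : ∀ a {b} (F : Fin (a ℕ.+ b) → ℚ) → ∏ F ≡ ∏ (λ i → F (i Fin.↑ˡ b)) * ∏ (λ j → F (a Fin.↑ʳ j))
  ∏-+ zero    F = sym (*-identityˡ (∏ F))
  ∏-+ (suc a) {b} F = trans (cong (F zero *_) (∏-+ a (F ∘ suc))) (sym (*-assoc (F zero) (∏ (λ i → F (suc (i Fin.↑ˡ b)))) (∏ (λ j → F (suc (a Fin.↑ʳ j))))))

  ∏-combine : ∀ R m (F : Fin (R ℕ.* m) → ℚ) → ∏ F ≡ ∏ (λ (r : Fin R) → ∏ (λ (a : Fin m) → F (combine r a)))
  ∏-combine zero    m F = refl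
  ∏-combine (suc R) m F = trans (∏-+ m F) (cong (∏ (λ (a : Fin m) → F (combine {suc R} zero a)) *_) (∏-combine R m (λ v → F (m Fin.↑ʳ v))))

  ∏-delta : ∀ {n} (r : Fin n) y → ∏ (λ i → if does (i Fin.≟ r) then y else 1ℚ) ≡ y
  ∏-delta {suc n} zero    y = trans (cong (y *_) (trans (∏-const n 1ℚ) (1^ n))) (*-identityʳ y)
  ∏-delta {suc n} (suc r) y = trans (*-identityˡ _) (∏-delta r y)

  quotient-combine : ∀ {R m} (r : Fin R) (a : Fin m) → quotient m (combine r a) ≡ r
  quotient-combine r a = cong proj₁ (remQuot-combine r a)

  fibre : ∀ R m (r : Fin R) ε → ∏ (λ (v : Fin (R ℕ.* m)) → if does (quotient m v Fin.≟ r) then ε else 1ℚ) ≡ ε ^ m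
  fibre R m r ε = trans (∏-combine R m (λ v → if does (quotient m v Fin.≟ r) then ε else 1ℚ))
    (trans (∏-cong {R} each) (∏-delta r (ε ^ m)))
    where
    row : ∀ (b : Bool) → ∏ {m} (λ _ → if b then ε else 1ℚ) ≡ (if b then ε ^ m else 1ℚ)
    row true  = ∏-const m ε
    row false = trans (∏-const m 1ℚ) (1^ m)
    each : ∀ i → ∏ (λ (a : Fin m) → if does (quotient m (combine i a) Fin.≟ r) then ε else 1ℚ) ≡ (if does (i Fin.≟ r) then ε ^ m else 1ℚ)
    each i = trans (∏-cong {m} (λ a → cong (λ j → if does (j Fin.≟ r) then ε else 1ℚ) (quotient-combine {R} {m} i a))) (row (does (i Fin.≟ r)))

  ι*≤recip : ∀ {a b c y} → 1 ℕ.≤ b → 0ℚ ≤ y → y * ι c ≡ 1ℚ → a ℕ.* b ℕ.≤ c → ι a * y ≤ recip b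
  ι*≤recip {a} {b} {c} {y} 1≤b 0≤y yc≡1 ab≤c = begin
    ι a * y                          ≡⟨ *-identityʳ (ι a * y) ⟨
    ι a * y * 1ℚ                     ≡⟨ cong (ι a * y *_) (recip-ι 1≤b) ⟨
    ι a * y * (recip b * ι b)        ≡⟨ lemma (ι a) y (recip b) (ι b) ⟩
    recip b * (y * (ι a * ι b))      ≡⟨ cong (λ q → recip b * (y * q)) (ι-* a b) ⟨
    recip b * (y * ι (a ℕ.* b))      ≤⟨ *-monoˡ (0≤recip b) (*-monoˡ 0≤y (ι-mono ab≤c)) ⟩
    recip b * (y * ι c)              ≡⟨ cong (recip b *_) yc≡1 ⟩
    recip b * 1ℚ                     ≡⟨ *-identityʳ (recip b) ⟩
    recip b                          ∎
    where
    open ≤-Reasoning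
    lemma : ∀ a y r b → a * y * (r * b) ≡ r * (y * (a * b))
    lemma = solve-∀ ring

  ^-inverse : ∀ {y c} → y * ι c ≡ 1ℚ → ∀ n → y ^ n * ι (c ℕ.^ n) ≡ 1ℚ
  ^-inverse {y} {c} e n = trans (cong (y ^ n *_) (ι-^ c n)) (trans (sym (^-*-distrib y (ι c) n)) (trans (cong (_^ n) e) (1^ n)))

  ι*recip≤1 : ∀ {a H} → 1 ℕ.≤ H → a ℕ.≤ H → ι a * recip H ≤ 1ℚ
  ι*recip≤1 {a} {H} 1≤H a≤H = ≤-trans (*-monoʳ (0≤recip H) (ι-mono a≤H)) (≤-reflexive (trans (*-comm (ι H) (recip H)) (recip-ι 1≤H)))

  Approx : ℚ → ∀ {n} → BoolFun n → ℕ → Set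
  Approx η {n} f d = Σ (Poly n) λ p → degAtMost d p × ((x : Fin n → Bool) → ∣ evalPoly p x - val (f x) ∣ ≤ η)

  -- The zero polynomial has error 1; g measures the margin below it.
  Hard : ℕ → ∀ {n} → BoolFun n → ℕ → Set
  Hard g f P = ∀ d → Approx (1ℚ - recip g) f d → P ℕ.≤ d

  evalDNF-cong : ∀ {n} (D : MDNF n) {u u′ : Fin n → Bool} → (∀ r → u r ≡ u′ r) → evalDNF D u ≡ evalDNF D u′
  evalDNF-cong D e = any-cong (all-cong e) D

  -- Decoding of true rows (`miss-cond`), decoding of false rows (`error-cond`) and the overflow
  -- (`tail-cond`) may cost 1 / (6 g) each, in total the difference of 1 / g and 1 / (2 g). `M-cond`
  -- covers the M counts by P e groups of size `M′`, and by `W-cond` each group multiplies the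
  -- expected growth by at most 2.
  module Amplify
    (R m c₀ t e H M′ g P : ℕ) (dnf : MDNF R)
    (1≤t : 1 ℕ.≤ t) (1≤e : 1 ℕ.≤ e) (1≤H : 1 ℕ.≤ H) (1≤g : 1 ℕ.≤ g)
    (fits : R ℕ.* m ℕ.≤ t ℕ.^ suc c₀)
    (K-cond : 2 ℕ.* (Construct.K e t 1≤t ℕ.* 11) ℕ.≤ H)
    (W-cond : 2 ℕ.* (M′ ℕ.* (2 ℕ.* (4 ℕ.* suc ((e ℕ.+ e) ℕ.+ (e ℕ.+ e)) ℕ.* 11))) ℕ.≤ H)
    (M-cond : R ℕ.* m ℕ.≤ (P ℕ.* e) ℕ.* M′)
    (miss-cond : (2 ℕ.* (R ℕ.* m)) ℕ.* (g ℕ.* 2 ℕ.* 3) ℕ.≤ 2 ℕ.^ t)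
    (error-cond : (2 ℕ.* R) ℕ.* (g ℕ.* 2 ℕ.* 3) ℕ.≤ t ℕ.^ m)
    (tail-cond : 9 ℕ.* (g ℕ.* 2 ℕ.* 3) ℕ.≤ 2 ℕ.^ (P ℕ.* e))
    where

    N : ℕ
    N = t ℕ.* (P ℕ.* e ℕ.* H)

    open Compose R m N c₀ t fits

    private
      K W M₀ : ℕ
      K = Construct.K e t 1≤t
      W = 4 ℕ.* suc ((e ℕ.+ e) ℕ.+ (e ℕ.+ e))
      M₀ = R ℕ.* m

      ρ : ℚ
      ρ = 2ℚ * (ι W * (ι 11 * recip H))

      6g : ℕ
      6g = g ℕ.* 2 ℕ.* 3

      1≤6g : 1 ℕ.≤ 6g
      1≤6g = ℕ.*-mono-≤ {1} {g ℕ.* 2} {1} {3} (ℕ.*-mono-≤ {1} {g} {1} {2} 1≤g (s≤s z≤n)) (s≤s z≤n)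

      fold₁ : ∀ a r → 2ℚ * (ι a * (ι 11 * r)) ≡ ι (2 ℕ.* (a ℕ.* 11)) * r
      fold₁ a r = trans (lemma 2ℚ (ι a) (ι 11) r) (cong (_* r) (sym (trans (ι-* 2 (a ℕ.* 11)) (cong (2ℚ *_) (ι-* a 11)))))
        where
        lemma : ∀ c a b r → c * (a * (b * r)) ≡ c * (a * b) * r
        lemma = solve-∀ ring

      K-small : 2ℚ * (ι K * (ι 11 * recip H)) ≤ 1ℚ
      K-small = subst (_≤ 1ℚ) (sym (fold₁ K (recip H))) (ι*recip≤1 1≤H K-cond)

      0≤ρ : 0ℚ ≤ ρ
      0≤ρ = 0≤* 0≤2 (0≤* (0≤ι W) (0≤* (0≤ι 11) (0≤recip H)))

      growth-factor : (1ℚ + ρ) ^ M₀ ≤ 2ℚ ^ (P ℕ.* e)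
      growth-factor = begin
        (1ℚ + ρ) ^ M₀                  ≤⟨ ^-monoʳ (≤-by ρ 0≤ρ refl) M-cond ⟩
        (1ℚ + ρ) ^ (P ℕ.* e ℕ.* M′)    ≡⟨ ^-^ (1ℚ + ρ) (P ℕ.* e) M′ ⟩
        ((1ℚ + ρ) ^ M′) ^ (P ℕ.* e)    ≤⟨ ^-mono (0≤^ (0≤+ 0≤1 0≤ρ) M′) (≤-trans (bernoulli-upper 0≤ρ M′ small) (+-monoʳ-≤ 1ℚ small)) (P ℕ.* e) ⟩
        2ℚ ^ (P ℕ.* e)                 ∎
        where
        open ≤-Reasoning
        lemma : ∀ c m w r → c * (m * (w * r)) ≡ c * (m * w) * r
        lemma = solve-∀ ring
        small : 2ℚ * (ι M′ * ρ) ≤ 1ℚ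
        small = subst (_≤ 1ℚ) (sym (begin-equality
          2ℚ * (ι M′ * ρ)                                    ≡⟨ cong (λ a → 2ℚ * (ι M′ * a)) (fold₁ W (recip H)) ⟩
          2ℚ * (ι M′ * (ι (2 ℕ.* (W ℕ.* 11)) * recip H))     ≡⟨ lemma 2ℚ (ι M′) (ι (2 ℕ.* (W ℕ.* 11))) (recip H) ⟩
          2ℚ * (ι M′ * ι (2 ℕ.* (W ℕ.* 11))) * recip H       ≡⟨ cong (λ a → 2ℚ * a * recip H) (ι-* M′ (2 ℕ.* (W ℕ.* 11))) ⟨
          2ℚ * ι (M′ ℕ.* (2 ℕ.* (W ℕ.* 11))) * recip H       ≡⟨ cong (_* recip H) (ι-* 2 (M′ ℕ.* (2 ℕ.* (W ℕ.* 11)))) ⟨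
          ι (2 ℕ.* (M′ ℕ.* (2 ℕ.* (W ℕ.* 11)))) * recip H    ∎)) (ι*recip≤1 1≤H W-cond)

      tail-small : ι 9 * (¼ ^ (P ℕ.* e) * (1ℚ + ρ) ^ M₀) ≤ recip 6g
      tail-small = begin
        ι 9 * (¼ ^ (P ℕ.* e) * (1ℚ + ρ) ^ M₀)        ≤⟨ *-monoˡ (0≤ι 9) (*-monoˡ (0≤^ 0≤¼ (P ℕ.* e)) growth-factor) ⟩
        ι 9 * (¼ ^ (P ℕ.* e) * 2ℚ ^ (P ℕ.* e))       ≡⟨ cong (ι 9 *_) (^-*-distrib ¼ 2ℚ (P ℕ.* e)) ⟨
        ι 9 * ½ ^ (P ℕ.* e)                          ≤⟨ ι*≤recip {9} {6g} {2 ℕ.^ (P ℕ.* e)} 1≤6g (0≤^ 0≤½ (P ℕ.* e)) (^-inverse {½} {2} refl (P ℕ.* e)) tail-cond ⟩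
        recip 6g                                     ∎
        where open ≤-Reasoning

      decode-small : 2ℚ * (ι R * (ι m * ½ ^ t + recip t ^ m)) ≤ recip 6g + recip 6g
      decode-small = begin
        2ℚ * (ι R * (ι m * ½ ^ t + recip t ^ m))
          ≡⟨ lemma 2ℚ (ι R) (ι m) (½ ^ t) (recip t ^ m) ⟩
        2ℚ * (ι R * ι m) * ½ ^ t + 2ℚ * ι R * recip t ^ m
          ≡⟨ cong₂ (λ a b → a * ½ ^ t + b * recip t ^ m) (trans (cong (2ℚ *_) (sym (ι-* R m))) (sym (ι-* 2 (R ℕ.* m)))) (sym (ι-* 2 R)) ⟩
        ι (2 ℕ.* (R ℕ.* m)) * ½ ^ t + ι (2 ℕ.* R) * recip t ^ m
          ≤⟨ +-mono-≤ (ι*≤recip {2 ℕ.* (R ℕ.* m)} {6g} {2 ℕ.^ t} 1≤6g (0≤^ 0≤½ t) (^-inverse {½} {2} refl t) miss-cond)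
                      (ι*≤recip {2 ℕ.* R} {6g} {t ℕ.^ m} 1≤6g (0≤^ (0≤recip t) m) (^-inverse {recip t} {t} (recip-ι 1≤t) m) error-cond) ⟩
        recip 6g + recip 6g ∎
        where
        open ≤-Reasoning
        lemma : ∀ c r m a b → c * (r * (m * a + b)) ≡ c * (r * m) * a + c * r * b
        lemma = solve-∀ ring

      total : 1ℚ - recip g + 2ℚ * (ι R * (ι m * ½ ^ t + recip t ^ m)) + ι 9 * (¼ ^ (P ℕ.* e) * (1ℚ + ρ) ^ M₀) ≤ 1ℚ - recip (g ℕ.* 2)
      total = begin
        1ℚ - recip g + 2ℚ * (ι R * (ι m * ½ ^ t + recip t ^ m)) + ι 9 * (¼ ^ (P ℕ.* e) * (1ℚ + ρ) ^ M₀)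
          ≤⟨ +-mono-≤ (+-monoʳ-≤ (1ℚ - recip g) decode-small) tail-small ⟩
        1ℚ - recip g + (recip 6g + recip 6g) + recip 6g
          ≡⟨ lemma₁ (recip g) (recip 6g) ⟩
        1ℚ - recip g + ι 3 * recip 6g
          ≡⟨ cong (1ℚ - recip g +_) (recip-* {g ℕ.* 2} {3} 1≤2g (s≤s z≤n)) ⟩
        1ℚ - recip g + recip (g ℕ.* 2)
          ≡⟨ cong (λ a → 1ℚ - a + recip (g ℕ.* 2)) (recip-* {g} {2} 1≤g (s≤s z≤n)) ⟨
        1ℚ - ι 2 * recip (g ℕ.* 2) + recip (g ℕ.* 2)
          ≡⟨ lemma₂ (recip (g ℕ.* 2)) ⟩
        1ℚ - recip (g ℕ.* 2) ∎
        where
        open ≤-Reasoning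
        1≤2g : 1 ℕ.≤ g ℕ.* 2
        1≤2g = ℕ.*-mono-≤ {1} {g} {1} {2} 1≤g (s≤s z≤n)
        lemma₁ : ∀ a b → 1ℚ - a + (b + b) + b ≡ 1ℚ - a + (1ℚ + (1ℚ + (1ℚ + 0ℚ))) * b
        lemma₁ = solve-∀ ring
        lemma₂ : ∀ a → 1ℚ - (1ℚ + (1ℚ + 0ℚ)) * a + a ≡ 1ℚ - a
        lemma₂ = solve-∀ ring

    -- The averaged polynomial has degree at most d / e, hence less than P if d < P e, against the
    -- hardness of `dnf`.
    amplify : Hard (g ℕ.* 2) (evalDNF dnf) P → Hard g (evalDNF (compose dnf)) (P ℕ.* e)
    amplify hard d (p , deg-p , p-close) with ℕ.≤-<-connex (P ℕ.* e) d
    ... | inj₁ done = done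
    ... | inj₂ d<Pe = contradiction (hard (ℕ.pred P) (q , deg-q , λ u → subst (λ a → ∣ a - val (evalDNF dnf u) ∣ ≤ 1ℚ - recip (g ℕ.* 2)) (q-value u) (≤-trans (average-close u) total)))
                        (ℕ.<⇒≱ (ℕ.≤-reflexive (ℕ.suc-pred P {{ℕ.>-nonZero 1≤P}})))
      where
      1≤Pe : 1 ℕ.≤ P ℕ.* e
      1≤Pe = ℕ.≤-<-trans z≤n d<Pe
      1≤P : 1 ℕ.≤ P
      1≤P = ℕ.n≢0⇒n>0 λ { refl → ℕ.<⇒≱ 1≤Pe z≤n }
      degree-bound : ∀ j → e ℕ.* j ℕ.≤ d → j ℕ.≤ ℕ.pred P
      degree-bound j ej≤d = ℕ.<⇒≤pred (ℕ.*-cancelʳ-< e j P (ℕ.≤-<-trans (ℕ.≤-trans (ℕ.≤-reflexive (ℕ.*-comm j e)) ej≤d) d<Pe))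
      cell-row : ∀ v → ∃ λ a → combine {R} {m} (quotient m v) a ≡ v
      cell-row v = remainder {R} m v , combine-remQuot {R} m v
      lemma : ∀ a → 1ℚ - a + a ≡ 1ℚ
      lemma = solve-∀ ring
      open Average R m M N (N ℕ.* (c ℕ.* t)) (quotient m) combine (quotient-combine {R} {m}) cell-row (fibre R m)
        (quotient (c ℕ.* t)) (λ s x → digit s (remainder {N} (c ℕ.* t) x))
        (evalDNF dnf) (evalDNF-cong dnf) (evalDNF (compose dnf)) (compose-correct dnf)
        (Construct.indistinguishable e t 1≤t) H (P ℕ.* e) 1≤H 1≤Pe refl 1≤t K-small
        p d (ℕ.<⇒≤ d<Pe) deg-p (1ℚ - recip g) (≤-by (recip g) (0≤recip g) (lemma (recip g))) p-close
        using (average-close; average-poly)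
      averaged = average-poly e (ℕ.m≤m+n e e) degree-bound
      q = IsPoly.poly averaged
      deg-q = IsPoly.degree averaged
      q-value = IsPoly.value averaged

  -- A constant within 1 - 1 / g of both 1 and -1 would give 2 ≤ 2 - 2 / g.
  hard-variable : ∀ g → 1 ℕ.≤ g → Hard g (evalDNF {1} ((zero ∷ []) ∷ [])) 1
  hard-variable g 1≤g (suc d) _ = s≤s z≤n
  hard-variable g 1≤g zero (p , deg , close) = contradiction 1≤0 (λ { (*≤* (ℤ.+≤+ ())) })
    where
    r = recip g
    constant : ∀ p → degAtMost 0 p → ∀ (x y : Fin 1 → Bool) → evalPoly p x ≡ evalPoly p y
    constant []             []         x y = refl
    constant ((a , []) ∷ p) (z≤n ∷ ls) x y = cong (a * 1ℚ +_) (constant p ls x y)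
    all-true = evalPoly p (λ _ → true)
    all-false = evalPoly p (λ _ → false)
    lemma₁ : ∀ a → (1ℚ + 1ℚ) ≡ a - - 1ℚ - (a - 1ℚ)
    lemma₁ = solve-∀ ring
    lemma₂ : ∀ r → r + r + (1ℚ - r + (1ℚ - r) - (1ℚ + 1ℚ)) ≡ 0ℚ
    lemma₂ = solve-∀ ring
    2≤ : 2ℚ ≤ 1ℚ - r + (1ℚ - r)
    2≤ = begin
      2ℚ                                        ≡⟨ lemma₁ all-true ⟩
      all-true - - 1ℚ - (all-true - 1ℚ)         ≤⟨ p≤∣p∣ (all-true - - 1ℚ - (all-true - 1ℚ)) ⟩
      ∣ all-true - - 1ℚ - (all-true - 1ℚ) ∣     ≤⟨ ∣p-q∣≤∣p∣+∣q∣ (all-true - - 1ℚ) (all-true - 1ℚ) ⟩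
      ∣ all-true - - 1ℚ ∣ + ∣ all-true - 1ℚ ∣   ≤⟨ +-mono-≤ (close (λ _ → true)) (subst (λ a → ∣ a - 1ℚ ∣ ≤ 1ℚ - r) (constant p deg (λ _ → false) (λ _ → true)) (close (λ _ → false))) ⟩
      1ℚ - r + (1ℚ - r)                         ∎
      where open ≤-Reasoning
    r≤0 : r ≤ 0ℚ
    r≤0 = ≤-trans (≤-by {r} r (0≤recip g) refl) (≤-by (1ℚ - r + (1ℚ - r) - 2ℚ) (0≤q-p 2≤) (lemma₂ r))
    1≤0 : 1ℚ ≤ 0ℚ
    1≤0 = subst₂ _≤_ (recip-ι 1≤g) (*-zeroˡ (ι g)) (*-monoʳ (0≤ι g) r≤0)

  -- Dummy variables

  embed : ∀ {v n} → v ℕ.≤ n → MDNF v → MDNF n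
  embed v≤n = map (map (λ i → inject≤ i v≤n))

  embed-width : ∀ {v n} (v≤n : v ℕ.≤ n) {w D} → widthAtMost w D → widthAtMost w (embed v≤n D)
  embed-width v≤n = All.map⁺ ∘ All.map (λ {cl} l → ℕ.≤-trans (ℕ.≤-reflexive (length-map (λ i → inject≤ i v≤n) cl)) l)

  embed-size : ∀ {v n} (v≤n : v ℕ.≤ n) {s} D → sizeAtMost s D → sizeAtMost s (embed v≤n D)
  embed-size v≤n D l = ℕ.≤-trans (ℕ.≤-reflexive (length-map (map (λ i → inject≤ i v≤n)) D)) l

  module _ {v n : ℕ} (v≤n : v ℕ.≤ n) where

    private
      restrict : Fin n → Maybe (Fin v)
      restrict j with toℕ j ℕ.<? v
      ... | yes j<v = just (fromℕ< j<v)
      ... | no  _   = nothing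

      restrict-inject : ∀ i → restrict (inject≤ i v≤n) ≡ just i
      restrict-inject i with toℕ (inject≤ i v≤n) ℕ.<? v
      ... | yes j<v = cong just (toℕ-injective (trans (toℕ-fromℕ< j<v) (toℕ-inject≤ i v≤n)))
      ... | no  j≮v = contradiction (subst (ℕ._< v) (sym (toℕ-inject≤ i v≤n)) (toℕ<n i)) j≮v

      extend : (Fin v → Bool) → Fin n → Bool
      extend u j = maybe′ u false (restrict j)

      extend-inject : ∀ u i → extend u (inject≤ i v≤n) ≡ u i
      extend-inject u i = cong (maybe′ u false) (restrict-inject i)

      -- Dummies are set to FALSE, whose value is 1, so substituting for them amounts to deleting
      -- them from the monomials.
      restrictPoly : Poly n → Poly v
      restrictPoly = map λ t → proj₁ t , mapMaybe restrict (proj₂ t)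

      restrict-deg : ∀ {d p} → degAtMost d p → degAtMost d (restrictPoly p)
      restrict-deg = All.map⁺ ∘ All.map (λ {t} l → ℕ.≤-trans (length-mapMaybe restrict (proj₂ t)) l)

      restrict-mono : ∀ u is → evalMono (mapMaybe restrict is) u ≡ evalMono is (extend u)
      restrict-mono u []       = refl
      restrict-mono u (i ∷ is) with restrict i
      ... | just j  = cong (val (u j) *_) (restrict-mono u is)
      ... | nothing = trans (restrict-mono u is) (sym (*-identityˡ (evalMono is (extend u))))

      restrict-eval : ∀ u p → evalPoly (restrictPoly p) u ≡ evalPoly p (extend u)
      restrict-eval u []             = refl
      restrict-eval u ((a , is) ∷ p) = cong₂ (λ m r → a * m + r) (restrict-mono u is) (restrict-eval u p)

      embed-eval : ∀ D u → evalDNF (embed v≤n D) (extend u) ≡ evalDNF D u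
      embed-eval D u = trans (any-map (all (extend u)) (map (λ i → inject≤ i v≤n)) D)
        (any-cong (λ cl → trans (all-map (extend u) (λ i → inject≤ i v≤n) cl) (all-cong (extend-inject u) cl)) D)

    hard-embed : ∀ {g P} D → Hard g (evalDNF D) P → Hard g (evalDNF (embed v≤n D)) P
    hard-embed {g} D hard d (p , deg , close) = hard d
      ( restrictPoly p , restrict-deg deg
      , λ u → subst₂ (λ a b → ∣ a - val b ∣ ≤ 1ℚ - recip g) (sym (restrict-eval u p)) (embed-eval D u) (close (extend u)))

  ⅓≤½ : (ℤ.+ 1) / 3 ≤ 1ℚ - recip 2
  ⅓≤½ = ≤ᵇ⇒≤ _

  approx-⅓ : ∀ {n d} {f : BoolFun n} → ApproxDegAtMost f d → Approx (1ℚ - recip 2) f d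
  approx-⅓ (p , deg , close) = p , deg , λ x → ≤-trans (close x) ⅓≤½

open Amplification using (Hard; module Construct; module Compose; module Amplify; hard-variable; embed; embed-width; embed-size; hard-embed; approx-⅓)
open import Data.Fin using (zero)
open import Data.List using ([]; _∷_)
open import Data.List.Relation.Unary.All as All using ([]; _∷_)
open import Data.Nat using (ℕ; _+_; _*_; _^_; _≤_; _∸_)
open import Data.Nat using (zero; suc; pred; _<_; _/_; _%_; _≤?_; z≤n; s≤s; NonZero; >-nonZero)
open import Data.Nat.DivMod using (m≡m%n+[m/n]*n; m%n<n)
open import Data.Nat.Logarithm using (⌊log₂⌋-mono-≤; ⌊log₂[2^n]⌋≡n)
open import Data.Nat.Properties
import Data.Nat.Tactic.RingSolver as ℕ-Solver
open import Data.Product using (Σ; _×_)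
open import Data.Product using (∃; _,_; proj₁; proj₂)
open import Data.Sum using (inj₁; inj₂)
open import Relation.Binary.PropositionalEquality
open import Relation.Nullary using (Dec; yes; no; contradiction)

-- Iterating the amplification

suc≤* : ∀ {x z} k → 1 ≤ z → x ≤ k * z → suc x ≤ suc k * z
suc≤* k = +-mono-≤

1≤^ : ∀ {t} n → 1 ≤ t → 1 ≤ t ^ n
1≤^ {t} n 1≤t = m^n>0 t {{>-nonZero 1≤t}} n

n<2^n : ∀ n → n < 2 ^ n
n<2^n zero    = s≤s z≤n
n<2^n (suc n) = ≤-trans (+-mono-≤ (1≤^ {2} n (s≤s z≤n)) (n<2^n n)) (≤-reflexive (cong (2 ^ n +_) (sym (+-identityʳ (2 ^ n)))))

^-*-distrib : ∀ a b n → (a * b) ^ n ≡ a ^ n * b ^ n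
^-*-distrib a b zero    = refl
^-*-distrib a b (suc n) = trans (cong (a * b *_) (^-*-distrib a b n)) (lemma a b (a ^ n) (b ^ n))
  where
  lemma : ∀ a b c d → a * b * (c * d) ≡ a * c * (b * d)
  lemma = ℕ-Solver.solve-∀

-- With q = t / e rounded down, t ≤ e (q + 1) ≤ e 2 ^ q; then take e-th powers.
^≤2^ : ∀ e → 1 ≤ e → ∀ t → t ^ e ≤ e ^ e * 2 ^ t
^≤2^ e 1≤e t = begin
  t ^ e                      ≤⟨ ^-monoˡ-≤ e t≤ ⟩
  (e * 2 ^ q) ^ e            ≡⟨ ^-*-distrib e (2 ^ q) e ⟩
  e ^ e * (2 ^ q) ^ e        ≡⟨ cong (e ^ e *_) (^-*-assoc 2 q e) ⟩
  e ^ e * 2 ^ (q * e)        ≤⟨ *-monoʳ-≤ (e ^ e) (^-monoʳ-≤ 2 (≤-trans (m≤n+m (q * e) (t % e)) (≤-reflexive (sym (m≡m%n+[m/n]*n t e))))) ⟩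
  e ^ e * 2 ^ t              ∎
  where
  open ≤-Reasoning
  instance
    e≢0 : NonZero e
    e≢0 = >-nonZero 1≤e
  q = t / e
  t≤ : t ≤ e * 2 ^ q
  t≤ = begin
    t                        ≡⟨ m≡m%n+[m/n]*n t e ⟩
    t % e + q * e            ≤⟨ +-monoˡ-≤ (q * e) (<⇒≤ (m%n<n t e)) ⟩
    suc q * e                ≤⟨ *-monoˡ-≤ e (n<2^n q) ⟩
    2 ^ q * e                ≡⟨ *-comm (2 ^ q) e ⟩
    e * 2 ^ q                ∎

Eventually : (ℕ → Set) → Set
Eventually S = ∃ λ t₀ → ∀ t → t₀ ≤ t → S t

infixr 4 _and_
_and_ : ∀ {S T : ℕ → Set} → Eventually S → Eventually T → Eventually (λ t → S t × T t)
(a , p) and (b , q) = a + b , λ t le → p t (≤-trans (m≤m+n a b) le) , q t (≤-trans (m≤n+m b a) le)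

eventually-map : ∀ {S T : ℕ → Set} → (∀ {t} → S t → T t) → Eventually S → Eventually T
eventually-map f (a , p) = a , λ t le → f (p t le)

eventually-≥ : ∀ a → Eventually (a ≤_)
eventually-≥ a = a , λ t le → le

-- The exponential bound is applied to the exponent Q + 1, and the spare factor t absorbs the
-- constants.
eventually-exp : ∀ C Q → Eventually (λ t → C * t ^ Q ≤ 2 ^ t)
eventually-exp C Q = C * E , λ t CE≤t → *-cancelˡ-≤ E {{m^n≢0 (suc Q) (suc Q)}} (begin
  E * (C * t ^ Q)    ≡⟨ lemma E C (t ^ Q) ⟩
  C * E * t ^ Q      ≤⟨ *-monoˡ-≤ (t ^ Q) CE≤t ⟩
  t * t ^ Q          ≤⟨ ^≤2^ (suc Q) (s≤s z≤n) t ⟩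
  E * 2 ^ t          ∎)
  where
  open ≤-Reasoning
  E = suc Q ^ suc Q
  lemma : ∀ e c x → e * (c * x) ≡ c * e * x
  lemma = ℕ-Solver.solve-∀

-- Degree `t ^ P` on at most `t ^ (P + A)` variables. The threshold for t may depend on g, as every
-- step calls on the hardness for 2 g.
record Family (P A : ℕ) : Set where
  field
    vars  : ℕ → ℕ
    dnf   : ∀ t → MDNF (vars t)
    w s   : ℕ
    width : ∀ t → widthAtMost w (dnf t)
    large : Eventually (λ t → 1 ≤ t × vars t ≤ t ^ (P + A) × sizeAtMost (t ^ s) (dnf t))
    hard  : ∀ g → 1 ≤ g → Eventually (λ t → Hard g (evalDNF (dnf t)) (t ^ P))

single-variable : Family 0 1
single-variable = record
  { vars  = λ _ → 1
  ; dnf   = λ _ → (zero ∷ []) ∷ []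
  ; w     = 1
  ; s     = 0
  ; width = λ _ → s≤s z≤n ∷ []
  ; large = 1 , λ t 1≤t → 1≤t , ≤-trans 1≤t (≤-reflexive (sym (*-identityʳ t))) , s≤s z≤n
  ; hard  = λ g 1≤g → 0 , λ _ _ → hard-variable g 1≤g
  }

-- Replacing t by t ^ r multiplies both exponents, so that the additive losses of a step become
-- negligible against `A`.
rescale : ∀ {P A} r → 1 ≤ r → Family P A → Family (r * P) (r * A)
rescale {P} {A} r 1≤r F = record
  { vars  = λ t → vars (t ^ r)
  ; dnf   = λ t → dnf (t ^ r)
  ; w     = w
  ; s     = r * s
  ; width = λ t → width (t ^ r)
  ; large = eventually-map
      (λ { {t} (1≤t , _ , v≤ , s≤) → 1≤t
         , ≤-trans v≤ (≤-reflexive (trans (^-*-assoc t r (P + A)) (cong (t ^_) (*-distribˡ-+ r P A))))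
         , ≤-trans s≤ (≤-reflexive (^-*-assoc t r s)) })
      (eventually-≥ 1 and along large)
  ; hard  = λ g 1≤g → eventually-map (λ {t} → subst (Hard g (evalDNF (dnf (t ^ r)))) (^-*-assoc t r P)) (along (hard g 1≤g))
  }
  where
  open Family F
  along : ∀ {S} → Eventually S → Eventually (λ t → S (t ^ r))
  along (t₀ , p) = suc t₀ , λ t lt → p (t ^ r) (≤-trans (<⇒≤ lt)
    (≤-trans (≤-reflexive (sym (*-identityʳ t))) (^-monoʳ-≤ t {{>-nonZero (≤-trans (s≤s z≤n) lt)}} 1≤r)))

module Step {P A : ℕ} (F : Family P A) (B : ℕ) (1≤B : 1 ≤ B) (B-small : B + B + B + 1 ≤ A) where
  open Family F

  Q m : ℕ
  Q = P + A
  -- One more than the exponent of the number of rows: t ^ Q rows, each wrong with probability 1 / t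
  -- ^ m, leave 1 / t.
  m = suc Q

  items vars′ : ℕ → ℕ
  -- The last factor is `H`, which has one t more than t ^ A for the constants in `K-cond` and
  -- `W-cond`.
  items t = t * (t ^ P * t ^ B * t ^ suc A)
  vars′ t = items t * (suc Q * t)

  Fits : ℕ → Set
  Fits t = vars t * m ≤ t ^ suc Q

  -- The decision is an argument so that proofs can match on it. The empty DNF fills in for the
  -- finitely many t that are too small.
  pick : ∀ t → Dec (Fits t) → MDNF (vars′ t)
  pick t (yes fits) = Compose.compose (vars t) m (items t) Q t fits (dnf t)
  pick t (no  _)    = []

  pick-width : ∀ t d → widthAtMost (w * m * suc Q) (pick t d)
  pick-width t (yes fits) = Compose.compose-width (vars t) m (items t) Q t fits (width t)
  pick-width t (no  _)    = []

  u : ℕ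
  u = suc (P + B + suc A)

  items≡ : ∀ t → items t ≡ t ^ u
  items≡ t = cong (t *_) (trans (cong (_* t ^ suc A) (sym (^-distribˡ-+-* t P B))) (sym (^-distribˡ-+-* t (P + B) (suc A))))

  pick-size : ∀ t d → 1 ≤ t → sizeAtMost (t ^ s) (dnf t) → sizeAtMost (t ^ (s + u * (w * m))) (pick t d)
  pick-size t (yes fits) 1≤t s≤ = ≤-trans
    (Compose.compose-size (vars t) m (items t) Q t fits (≤-trans (1≤^ u 1≤t) (≤-reflexive (sym (items≡ t)))) (width t) s≤)
    (≤-reflexive (trans (cong (λ x → t ^ s * x ^ (w * m)) (items≡ t))
      (trans (cong (t ^ s *_) (^-*-assoc t u (w * m))) (sym (^-distribˡ-+-* t s (u * (w * m)))))))
  pick-size t (no  _)    _   _  = z≤n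

  -- The exponent 4 counts one t for the items beyond X, one spare t in `H`, one for the base of the
  -- digits and one bounding their number.
  vars′≤ : ∀ t → suc Q ≤ t → vars′ t ≤ t ^ (P + B + (A + 4))
  vars′≤ t Q<t = begin
    items t * (suc Q * t)    ≤⟨ *-mono-≤ (≤-reflexive (items≡ t)) (*-monoˡ-≤ t Q<t) ⟩
    t ^ u * (t * t)          ≡⟨ cong (t ^ u *_) (cong (t *_) (sym (*-identityʳ t))) ⟩
    t ^ u * t ^ 2            ≡⟨ ^-distribˡ-+-* t u 2 ⟨
    t ^ (u + 2)              ≡⟨ cong (t ^_) (lemma P B A) ⟩
    t ^ (P + B + (A + 4))    ∎
    where
    open ≤-Reasoning
    lemma : ∀ p b a → suc (p + b + suc a) + 2 ≡ p + b + (a + 4)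
    lemma = ℕ-Solver.solve-∀

  module Conditions {g t : ℕ} (1≤g : 1 ≤ g) (1≤t : 1 ≤ t) (v≤ : vars t ≤ t ^ Q)
    (Q<t : suc Q ≤ t) (error≤t : 2 * (g * 2 * 3) ≤ t) (K≤t : 990 ≤ t) (W≤t : 880 * m ≤ t)
    (tail≤t : 9 * (g * 2 * 3) ≤ t) (miss≤ : 2 * m * (g * 2 * 3) * t ^ Q ≤ 2 ^ t) where

    open ≤-Reasoning

    e = t ^ B
    x = t ^ (A ∸ B)

    1≤e : 1 ≤ e
    1≤e = 1≤^ B 1≤t

    B≤A : B ≤ A
    B≤A = ≤-trans (≤-trans (m≤n+m B (B + B)) (m≤m+n (B + B + B) 1)) B-small

    e*x : e * x ≡ t ^ A
    e*x = trans (sym (^-distribˡ-+-* t B (A ∸ B))) (cong (t ^_) (m+[n∸m]≡n B≤A))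

    fits : Fits t
    fits = ≤-trans (*-mono-≤ v≤ Q<t) (≤-reflexive (*-comm (t ^ Q) t))

    four : ∀ e → (e + e) + (e + e) ≡ 4 * e
    four = ℕ-Solver.solve-∀

    5e : suc ((e + e) + (e + e)) ≤ 5 * e
    5e = suc≤* 4 1≤e (≤-reflexive (four e))

    -- Here c ≤ 11 e t and h² = 4 e², so K ≤ 45 e³ t, and 990 = 2 · 45 · 11. The exponent of e³ t is
    -- the left side of `B-small`.
    K-cond : 2 * (Construct.K e t 1≤t * 11) ≤ t ^ suc A
    K-cond = begin
      2 * (Construct.K e t 1≤t * 11)    ≤⟨ *-monoʳ-≤ 2 (*-monoˡ-≤ 11 K≤) ⟩
      2 * (45 * (e * e * e * t) * 11)   ≡⟨ lemma₃ (e * e * e * t) ⟩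
      990 * (e * e * e * t)             ≤⟨ *-mono-≤ K≤t cube≤ ⟩
      t * t ^ A                         ∎
      where
      lemma₁ : ∀ e t → 2 * (5 * e * t) ≡ 10 * (e * t)
      lemma₁ = ℕ-Solver.solve-∀
      lemma₂ : ∀ e t → 11 * (e * t) * ((e + e) * (e + e)) ≡ 44 * (e * e * e * t)
      lemma₂ = ℕ-Solver.solve-∀
      lemma₃ : ∀ y → 2 * (45 * y * 11) ≡ 990 * y
      lemma₃ = ℕ-Solver.solve-∀
      c≤ : suc (2 * (suc ((e + e) + (e + e)) * t)) ≤ 11 * (e * t)
      c≤ = suc≤* 10 (*-mono-≤ 1≤e 1≤t) (≤-trans (*-monoʳ-≤ 2 (*-monoˡ-≤ t 5e)) (≤-reflexive (lemma₁ e t)))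
      K≤ : Construct.K e t 1≤t ≤ 45 * (e * e * e * t)
      K≤ = suc≤* 44 (*-mono-≤ (*-mono-≤ (*-mono-≤ 1≤e 1≤e) 1≤e) 1≤t)
        (≤-trans (*-monoˡ-≤ ((e + e) * (e + e)) c≤) (≤-reflexive (lemma₂ e t)))
      cube≤ : e * e * e * t ≤ t ^ A
      cube≤ = begin
        e * e * e * t            ≡⟨ cong (λ y → y * e * t) (^-distribˡ-+-* t B B) ⟨
        t ^ (B + B) * e * t      ≡⟨ cong (_* t) (^-distribˡ-+-* t (B + B) B) ⟨
        t ^ (B + B + B) * t      ≡⟨ cong (t ^ (B + B + B) *_) (*-identityʳ t) ⟨
        t ^ (B + B + B) * t ^ 1  ≡⟨ ^-distribˡ-+-* t (B + B + B) 1 ⟨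
        t ^ (B + B + B + 1)      ≤⟨ ^-monoʳ-≤ t {{>-nonZero 1≤t}} B-small ⟩
        t ^ A                    ∎

    W-cond : 2 * (m * x * (2 * (4 * suc ((e + e) + (e + e)) * 11))) ≤ t ^ suc A
    W-cond = begin
      2 * (m * x * (2 * (4 * suc ((e + e) + (e + e)) * 11)))  ≤⟨ *-monoʳ-≤ 2 (*-monoʳ-≤ (m * x) (*-monoʳ-≤ 2 (*-monoˡ-≤ 11 (*-monoʳ-≤ 4 5e)))) ⟩
      2 * (m * x * (2 * (4 * (5 * e) * 11)))                  ≡⟨ lemma m x e ⟩
      880 * m * (e * x)                                       ≤⟨ *-mono-≤ W≤t (≤-reflexive e*x) ⟩
      t * t ^ A                                               ∎
      where
      lemma : ∀ m x e → 2 * (m * x * (2 * (4 * (5 * e) * 11))) ≡ 880 * m * (e * x)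
      lemma = ℕ-Solver.solve-∀

    M-cond : vars t * m ≤ t ^ P * e * (m * x)
    M-cond = begin
      vars t * m               ≤⟨ *-monoˡ-≤ m v≤ ⟩
      t ^ (P + A) * m          ≡⟨ cong (_* m) (^-distribˡ-+-* t P A) ⟩
      t ^ P * t ^ A * m        ≡⟨ cong (λ y → t ^ P * y * m) e*x ⟨
      t ^ P * (e * x) * m      ≡⟨ lemma (t ^ P) e x m ⟩
      t ^ P * e * (m * x)      ∎
      where
      lemma : ∀ p e x m → p * (e * x) * m ≡ p * e * (m * x)
      lemma = ℕ-Solver.solve-∀

    miss-cond : 2 * (vars t * m) * (g * 2 * 3) ≤ 2 ^ t
    miss-cond = begin
      2 * (vars t * m) * (g * 2 * 3)     ≤⟨ *-monoˡ-≤ (g * 2 * 3) (*-monoʳ-≤ 2 (*-monoˡ-≤ m v≤)) ⟩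
      2 * (t ^ Q * m) * (g * 2 * 3)      ≡⟨ lemma (t ^ Q) m (g * 2 * 3) ⟩
      2 * m * (g * 2 * 3) * t ^ Q        ≤⟨ miss≤ ⟩
      2 ^ t                              ∎
      where
      lemma : ∀ y m c → 2 * (y * m) * c ≡ 2 * m * c * y
      lemma = ℕ-Solver.solve-∀

    error-cond : 2 * vars t * (g * 2 * 3) ≤ t ^ m
    error-cond = begin
      2 * vars t * (g * 2 * 3)     ≡⟨ lemma (vars t) (g * 2 * 3) ⟩
      2 * (g * 2 * 3) * vars t     ≤⟨ *-mono-≤ error≤t v≤ ⟩
      t * t ^ Q                    ∎
      where
      lemma : ∀ v c → 2 * v * c ≡ 2 * c * v
      lemma = ℕ-Solver.solve-∀

    tail-cond : 9 * (g * 2 * 3) ≤ 2 ^ (t ^ P * e)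
    tail-cond = begin
      9 * (g * 2 * 3)     ≤⟨ tail≤t ⟩
      t                   ≡⟨ *-identityʳ t ⟨
      t ^ 1               ≤⟨ ^-monoʳ-≤ t {{>-nonZero 1≤t}} 1≤B ⟩
      t ^ B               ≡⟨ *-identityˡ (t ^ B) ⟨
      1 * t ^ B           ≤⟨ *-monoˡ-≤ (t ^ B) (1≤^ P 1≤t) ⟩
      t ^ P * t ^ B       ≤⟨ <⇒≤ (n<2^n (t ^ P * t ^ B)) ⟩
      2 ^ (t ^ P * t ^ B) ∎

    pick-hard : ∀ d → Hard (g * 2) (evalDNF (dnf t)) (t ^ P) → Hard g (evalDNF (pick t d)) (t ^ (P + B))
    pick-hard (no ¬fits) _ = contradiction fits ¬fits
    pick-hard (yes fits) h = subst (Hard g (evalDNF (pick t (yes fits)))) (sym (^-distribˡ-+-* t P B))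
      (Amplify.amplify (vars t) m Q t e (t ^ suc A) (m * x) g (t ^ P) (dnf t) 1≤t 1≤e (1≤^ (suc A) 1≤t) 1≤g
        fits K-cond W-cond M-cond miss-cond error-cond tail-cond h)

  step : Family (P + B) (A + 4)
  step = record
    { vars  = vars′
    ; dnf   = λ t → pick t (vars t * m ≤? t ^ suc Q)
    ; w     = w * m * suc Q
    ; s     = s + u * (w * m)
    ; width = λ t → pick-width t (vars t * m ≤? t ^ suc Q)
    ; large = eventually-map
        (λ { {t} (Q<t , 1≤t , _ , s≤) → 1≤t , vars′≤ t Q<t , pick-size t (vars t * m ≤? t ^ suc Q) 1≤t s≤ })
        (eventually-≥ (suc Q) and large)
    ; hard  = λ g 1≤g → eventually-map
        (λ { {t} (h , (1≤t , v≤ , _) , Q<t , error≤t , K≤t , W≤t , tail≤t , miss≤) →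
             Conditions.pick-hard 1≤g 1≤t v≤ Q<t error≤t K≤t W≤t tail≤t miss≤ (vars t * m ≤? t ^ suc Q) h })
        (hard (g * 2) (*-mono-≤ 1≤g (s≤s {n = 1} z≤n)) and large and eventually-≥ (suc Q) and eventually-≥ (2 * (g * 2 * 3))
          and eventually-≥ 990 and eventually-≥ (880 * m) and eventually-≥ (9 * (g * 2 * 3)) and eventually-exp (2 * m * (g * 2 * 3)) Q)
    }

-- With A / (P + A) = 1 - log_n (degree) for n = t ^ (P + A), one step after a rescaling takes
-- the reciprocal (P + A) / A from J / 6 to (J + 1) / 6.
families : ∀ J → ∃ λ P → ∃ λ A → 1 ≤ A × J * A ≤ 6 * (P + A) × Family P A
families zero    = 0 , 1 , s≤s z≤n , z≤n , single-variable
families (suc J) with families J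
... | P , A , 1≤A , ratio , F = r * P + B , r * A + 4 , m≤n⇒m≤o+n (r * A) (s≤s z≤n) , ratio′ ,
  Step.step (rescale r 1≤r F) B 1≤B B-small
  where
  open ≤-Reasoning
  ρ r y B : ℕ
  -- With y = ρ A, this gives r A = 3 y = 3 B + 3. In `ratio′` the surplus on the left is 3 y + 4 (J
  -- + 1) = 3 y + 2 ρ ≤ 5 y, while the right side offers 6 (B + 4) = 6 y + 18.
  ρ = 2 * J + 2
  r = 3 * ρ
  y = ρ * A
  B = pred y
  1≤r : 1 ≤ r
  1≤r = *-mono-≤ {1} {3} {1} {ρ} (s≤s z≤n) (≤-trans (s≤s z≤n) (m≤n+m 2 (2 * J)))
  ρ≤y : ρ ≤ y
  ρ≤y = ≤-trans (≤-reflexive (sym (*-identityʳ ρ))) (*-monoʳ-≤ ρ 1≤A)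
  2≤y : 2 ≤ y
  2≤y = ≤-trans (m≤n+m 2 (2 * J)) ρ≤y
  y≡ : y ≡ suc B
  y≡ = sym (suc-pred y {{>-nonZero (≤-trans (s≤s z≤n) 2≤y)}})
  1≤B : 1 ≤ B
  1≤B = pred-mono-≤ 2≤y
  B-small : B + B + B + 1 ≤ r * A
  B-small = begin
    B + B + B + 1       ≤⟨ m≤m+n (B + B + B + 1) 2 ⟩
    B + B + B + 1 + 2   ≡⟨ lemma B ⟩
    3 * suc B           ≡⟨ cong (3 *_) y≡ ⟨
    3 * (ρ * A)         ≡⟨ *-assoc 3 ρ A ⟨
    r * A               ∎
    where
    lemma : ∀ b → b + b + b + 1 + 2 ≡ 3 * suc b
    lemma = ℕ-Solver.solve-∀
  ratio′ : suc J * (r * A + 4) ≤ 6 * (r * P + B + (r * A + 4))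
  ratio′ = begin
    suc J * (r * A + 4)                           ≡⟨ lemma₁ J ρ A ⟩
    r * (J * A) + 3 * y + 2 * ρ                   ≤⟨ +-monoˡ-≤ (2 * ρ) (+-monoˡ-≤ (3 * y) (*-monoʳ-≤ r ratio)) ⟩
    r * (6 * (P + A)) + 3 * y + 2 * ρ             ≤⟨ +-monoʳ-≤ (r * (6 * (P + A)) + 3 * y) (*-monoʳ-≤ 2 ρ≤y) ⟩
    r * (6 * (P + A)) + 3 * y + 2 * y             ≡⟨ cong (λ y → r * (6 * (P + A)) + 3 * y + 2 * y) y≡ ⟩
    r * (6 * (P + A)) + 3 * suc B + 2 * suc B     ≤⟨ m≤m+n _ (B + 19) ⟩
    r * (6 * (P + A)) + 3 * suc B + 2 * suc B + (B + 19)  ≡⟨ lemma₂ r P A B ⟩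
    6 * (r * P + B + (r * A + 4))                 ∎
    where
    lemma₁ : ∀ j ρ a → suc j * (3 * (2 * j + 2) * a + 4) ≡ 3 * (2 * j + 2) * (j * a) + 3 * ((2 * j + 2) * a) + 2 * (2 * j + 2)
    lemma₁ = ℕ-Solver.solve-∀
    lemma₂ : ∀ r p a b → r * (6 * (p + a)) + 3 * suc b + 2 * suc b + (b + 19) ≡ 6 * (r * p + b + (r * a + 4))
    lemma₂ = ℕ-Solver.solve-∀

-- Integer roots and logarithms of n

root : ∀ Q → 1 ≤ Q → ∀ n → ∃ λ t → t ^ Q ≤ n × n < suc t ^ Q
root (suc Q) _   zero    = 0 , z≤n , 1≤^ {1} (suc Q) (s≤s z≤n)
root Q@(suc _) 1≤Q (suc n) with root Q 1≤Q n
... | t , t≤n , n<t with suc t ^ Q ≤? suc n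
...   | yes st≤ = suc t , st≤ , ≤-<-trans n<t (^-monoˡ-< Q (n<1+n (suc t)))
...   | no  st≰ = t , m≤n⇒m≤1+n t≤n , ≰⇒> st≰

2^lg≤ : ∀ n → 1 ≤ n → 2 ^ lg n ≤ 2 * n
2^lg≤ n 1≤n with lg n in eq
... | zero  = *-mono-≤ {1} {2} (s≤s z≤n) 1≤n
... | suc l with ≤-<-connex (2 ^ l) n
...   | inj₁ le = *-monoʳ-≤ 2 le
...   | inj₂ lt = contradiction (≤-trans (≤-reflexive (sym eq)) (≤-trans (⌊log₂⌋-mono-≤ (<⇒≤ lt)) (≤-reflexive (⌊log₂[2^n]⌋≡n l)))) (<⇒≱ (n<1+n l))

n<2^[1+lg] : ∀ n → n < 2 ^ suc (lg n)
n<2^[1+lg] n with ≤-<-connex (2 ^ suc (lg n)) n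
... | inj₁ le = contradiction (≤-trans (≤-reflexive (sym (⌊log₂[2^n]⌋≡n (suc (lg n))))) (⌊log₂⌋-mono-≤ le)) (<⇒≱ (n<1+n (lg n)))
... | inj₂ lt = lt

^-cancelˡ-≤ : ∀ {a b} Q → 1 ≤ Q → a ^ Q ≤ b ^ Q → a ≤ b
^-cancelˡ-≤ {a} {b} Q 1≤Q le with ≤-<-connex a b
... | inj₁ a≤b = a≤b
... | inj₂ b<a = contradiction le (<⇒≱ (^-monoˡ-< Q {{>-nonZero 1≤Q}} b<a))

-- Powers of the logarithm cost a single factor t: the power (e + 1) Q of lg n is at most a constant
-- times 2 ^ lg n ≤ 2 n, hence a constant times (2 t) ^ Q, and Q-th roots are taken.
lg-power : ∀ {n t} e Q → 1 ≤ Q → 1 ≤ lg n → 1 ≤ n → n ≤ (2 * t) ^ Q → lg n ^ e ≤ (2 * (suc e * Q) ^ (suc e * Q)) * (2 * t)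
lg-power {n} {t} e Q 1≤Q 1≤L 1≤n n≤ = ≤-trans (^-monoʳ-≤ L {{>-nonZero 1≤L}} (n≤1+n e)) (^-cancelˡ-≤ Q 1≤Q (begin
  (L ^ suc e) ^ Q                  ≡⟨ ^-*-assoc L (suc e) Q ⟩
  L ^ k                            ≤⟨ ^≤2^ k 1≤k L ⟩
  k ^ k * 2 ^ L                    ≤⟨ *-monoʳ-≤ (k ^ k) (≤-trans (2^lg≤ n 1≤n) (*-monoʳ-≤ 2 n≤)) ⟩
  k ^ k * (2 * (2 * t) ^ Q)        ≡⟨ lemma (k ^ k) ((2 * t) ^ Q) ⟩
  E * (2 * t) ^ Q                  ≤⟨ *-monoˡ-≤ ((2 * t) ^ Q) (≤-trans (≤-reflexive (sym (*-identityʳ E))) (^-monoʳ-≤ E {{>-nonZero 1≤E}} 1≤Q)) ⟩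
  E ^ Q * (2 * t) ^ Q              ≡⟨ ^-*-distrib E (2 * t) Q ⟨
  (E * (2 * t)) ^ Q                ∎))
  where
  open ≤-Reasoning
  L = lg n
  k = suc e * Q
  E = 2 * k ^ k
  1≤k : 1 ≤ k
  1≤k = *-mono-≤ {1} {suc e} (s≤s z≤n) 1≤Q
  1≤E : 1 ≤ E
  1≤E = *-mono-≤ {1} {2} (s≤s z≤n) (1≤^ k 1≤k)
  lemma : ∀ a b → a * (2 * b) ≡ 2 * a * b
  lemma = ℕ-Solver.solve-∀

-- Choice of t for given n, and the three bounds

module Bounds (k : ℕ) (1≤k : 1 ≤ k) {P A : ℕ} (1≤A : 1 ≤ A) (ratio : 12 * 3 ^ k * A ≤ 6 * (P + A)) (F : Family P A) where
  open Family F
  open ≤-Reasoning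

  Q α e E C : ℕ
  Q = P + A
  α = 3 ^ k ∸ 2 ^ (k ∸ 1)
  e = 3 ^ (k + 1) ∸ 2 ^ (k + 2)
  E = 2 * (suc e * Q) ^ (suc e * Q)
  -- One summand for each of width, size and degree.
  C = w + 2 * s + 2 ^ (Q * α) * (E * 2)

  1≤Q : 1 ≤ Q
  1≤Q = ≤-trans 1≤A (m≤n+m A P)

  -- As α ≤ 3 ^ k - 1, it suffices that 1 + 3 ^ k A ≤ Q, and `ratio` gives 2 · 3 ^ k A ≤ Q. The 1 is
  -- the factor t that `lg-power` consumes.
  exponent≤ : Q * α + 1 ≤ P * 3 ^ k
  exponent≤ = +-cancelʳ-≤ (3 ^ k * A) (Q * α + 1) (P * 3 ^ k) (begin
    Q * α + 1 + 3 ^ k * A           ≡⟨ +-assoc (Q * α) 1 (3 ^ k * A) ⟩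
    Q * α + suc (3 ^ k * A)         ≤⟨ +-monoʳ-≤ (Q * α) (≤-trans (+-monoˡ-≤ (3 ^ k * A) (*-mono-≤ (1≤^ {3} k (s≤s z≤n)) 1≤A)) twice≤) ⟩
    Q * α + Q                       ≡⟨ lemma₁ Q α ⟩
    Q * suc α                       ≤⟨ *-monoʳ-≤ Q α<3^k ⟩
    Q * 3 ^ k                       ≡⟨ lemma₂ P A (3 ^ k) ⟩
    P * 3 ^ k + 3 ^ k * A           ∎)
    where
    lemma₁ : ∀ q a → q * a + q ≡ q * suc a
    lemma₁ = ℕ-Solver.solve-∀
    lemma₂ : ∀ p a x → (p + a) * x ≡ p * x + x * a
    lemma₂ = ℕ-Solver.solve-∀
    lemma₃ : ∀ x a → 6 * (x * a + x * a) ≡ 12 * x * a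
    lemma₃ = ℕ-Solver.solve-∀
    twice≤ : 3 ^ k * A + 3 ^ k * A ≤ Q
    twice≤ = *-cancelˡ-≤ 6 (≤-trans (≤-reflexive (lemma₃ (3 ^ k) A)) ratio)
    α<3^k : suc α ≤ 3 ^ k
    α<3^k = begin
      suc (3 ^ k ∸ 2 ^ (k ∸ 1))   ≤⟨ s≤s (∸-monoʳ-≤ (3 ^ k) (1≤^ {2} (k ∸ 1) (s≤s z≤n))) ⟩
      suc (3 ^ k ∸ 1)             ≡⟨ m+[n∸m]≡n (1≤^ {3} k (s≤s z≤n)) ⟩
      3 ^ k                       ∎

  t : ℕ → ℕ
  t n = proj₁ (root Q 1≤Q n)

  t^Q≤n : ∀ n → t n ^ Q ≤ n
  t^Q≤n n = proj₁ (proj₂ (root Q 1≤Q n))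

  n<[1+t]^Q : ∀ n → n < suc (t n) ^ Q
  n<[1+t]^Q n = proj₂ (proj₂ (root Q 1≤Q n))

  pick : ∀ n → Dec (vars (t n) ≤ n * lg n ^ (4 * k ∸ 4)) → MDNF (n * lg n ^ (4 * k ∸ 4))
  pick n (yes v≤) = embed v≤ (dnf (t n))
  pick n (no  _)  = []

  D : ∀ n → MDNF (n * lg n ^ (4 * k ∸ 4))
  D n = pick n (vars (t n) ≤? n * lg n ^ (4 * k ∸ 4))

  good : Eventually (λ t → (1 ≤ t × vars t ≤ t ^ Q × sizeAtMost (t ^ s) (dnf t)) × Hard 2 (evalDNF (dnf t)) (t ^ P))
  good = large and hard 2 (s≤s z≤n)

  n₀ : ℕ
  -- The power forces the root t of n past the threshold of the family; the 2 makes lg n at least 1.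
  n₀ = proj₁ good ^ Q + 2

  module _ (n : ℕ) (n₀≤n : n₀ ≤ n) where

    T L : ℕ
    T = t n
    L = lg n

    t₀≤T : proj₁ good ≤ T
    t₀≤T with ≤-<-connex (proj₁ good) T
    ... | inj₁ le = le
    ... | inj₂ lt = contradiction (≤-<-trans (≤-trans (m≤m+n (proj₁ good ^ Q) 2) n₀≤n) (n<[1+t]^Q n)) (≤⇒≯ (^-monoˡ-≤ Q lt))

    1≤T : 1 ≤ T
    1≤T = proj₁ (proj₁ (proj₂ good T t₀≤T))

    2≤n : 2 ≤ n
    2≤n = ≤-trans (m≤n+m 2 (proj₁ good ^ Q)) n₀≤n

    1≤L : 1 ≤ L
    1≤L = ≤-trans (≤-reflexive (sym (⌊log₂[2^n]⌋≡n 1))) (⌊log₂⌋-mono-≤ 2≤n)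

    T≤n : T ≤ n
    T≤n = ≤-trans (≤-reflexive (sym (*-identityʳ T))) (≤-trans (^-monoʳ-≤ T {{>-nonZero 1≤T}} 1≤Q) (t^Q≤n n))

    n≤[2T]^Q : n ≤ (2 * T) ^ Q
    n≤[2T]^Q = ≤-trans (<⇒≤ (n<[1+t]^Q n)) (^-monoˡ-≤ Q (≤-trans (+-monoˡ-≤ T 1≤T) (+-monoʳ-≤ T (≤-reflexive (sym (+-identityʳ T))))))

    fits : vars T ≤ n * L ^ (4 * k ∸ 4)
    fits = ≤-trans (proj₁ (proj₂ (proj₁ (proj₂ good T t₀≤T)))) (≤-trans (t^Q≤n n)
      (≤-trans (≤-reflexive (sym (*-identityʳ n))) (*-monoʳ-≤ n (1≤^ (4 * k ∸ 4) 1≤L))))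

    w≤ : w ≤ C * L ^ (2 * k ∸ 1)
    w≤ = ≤-trans (≤-reflexive (sym (*-identityʳ w)))
      (*-mono-≤ (≤-trans (m≤m+n w (2 * s)) (m≤m+n (w + 2 * s) (2 ^ (Q * α) * (E * 2)))) (1≤^ (2 * k ∸ 1) 1≤L))

    size≤ : T ^ s ≤ 2 ^ (C * L ^ (2 * k))
    size≤ = begin
      T ^ s                     ≤⟨ ^-monoˡ-≤ s (≤-trans T≤n (<⇒≤ (n<2^[1+lg] n))) ⟩
      (2 ^ suc L) ^ s           ≡⟨ ^-*-assoc 2 (suc L) s ⟩
      2 ^ (suc L * s)           ≤⟨ ^-monoʳ-≤ 2 (begin
        suc L * s                 ≤⟨ *-monoˡ-≤ s (+-monoˡ-≤ L 1≤L) ⟩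
        (L + L) * s               ≡⟨ lemma L s ⟩
        2 * s * L                 ≤⟨ *-mono-≤ (≤-trans (m≤n+m (2 * s) w) (m≤m+n (w + 2 * s) (2 ^ (Q * α) * (E * 2)))) L≤ ⟩
        C * L ^ (2 * k)           ∎) ⟩
      2 ^ (C * L ^ (2 * k))     ∎
      where
      lemma : ∀ l s → (l + l) * s ≡ 2 * s * l
      lemma = ℕ-Solver.solve-∀
      L≤ : L ≤ L ^ (2 * k)
      L≤ = ≤-trans (≤-reflexive (sym (*-identityʳ L))) (^-monoʳ-≤ L {{>-nonZero 1≤L}} (*-mono-≤ {1} {2} (s≤s z≤n) 1≤k))

    degree≤ : ∀ d → T ^ P ≤ d → n ^ α * L ^ e ≤ C * d ^ (3 ^ k)
    degree≤ d le = begin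
      n ^ α * L ^ e                                         ≤⟨ *-mono-≤ (^-monoˡ-≤ α n≤[2T]^Q) (lg-power {n} {T} e Q 1≤Q 1≤L (≤-trans (s≤s z≤n) 2≤n) n≤[2T]^Q) ⟩
      ((2 * T) ^ Q) ^ α * (E * (2 * T))                     ≡⟨ cong (_* (E * (2 * T))) (trans (^-*-assoc (2 * T) Q α) (^-*-distrib 2 T (Q * α))) ⟩
      2 ^ (Q * α) * T ^ (Q * α) * (E * (2 * T))             ≡⟨ lemma (2 ^ (Q * α)) (T ^ (Q * α)) E T ⟩
      2 ^ (Q * α) * (E * 2) * (T ^ (Q * α) * (T * 1))       ≡⟨ cong (2 ^ (Q * α) * (E * 2) *_) (^-distribˡ-+-* T (Q * α) 1) ⟨
      2 ^ (Q * α) * (E * 2) * T ^ (Q * α + 1)               ≤⟨ *-mono-≤ (m≤n+m (2 ^ (Q * α) * (E * 2)) (w + 2 * s)) (^-monoʳ-≤ T {{>-nonZero 1≤T}} exponent≤) ⟩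
      C * T ^ (P * 3 ^ k)                                   ≡⟨ cong (C *_) (^-*-assoc T P (3 ^ k)) ⟨
      C * (T ^ P) ^ (3 ^ k)                                 ≤⟨ *-monoʳ-≤ C (^-monoˡ-≤ (3 ^ k) le) ⟩
      C * d ^ (3 ^ k)                                       ∎
      where
      lemma : ∀ a b c t → a * b * (c * (2 * t)) ≡ a * (c * 2) * (b * (t * 1))
      lemma = ℕ-Solver.solve-∀

    bounds : ∀ dec → widthAtMost (C * L ^ (2 * k ∸ 1)) (pick n dec) × sizeAtMost (2 ^ (C * L ^ (2 * k))) (pick n dec)
      × (∀ d → ApproxDegAtMost (evalDNF (pick n dec)) d → n ^ α * L ^ e ≤ C * d ^ (3 ^ k))
    bounds (no ¬fits) = contradiction fits ¬fits
    bounds (yes v≤)   = embed-width v≤ (All.map (λ l → ≤-trans l w≤) (width T))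
      , ≤-trans (embed-size v≤ (dnf T) (proj₂ (proj₂ (proj₁ (proj₂ good T t₀≤T))))) size≤
      , λ d approx → degree≤ d (hard-embed v≤ {2} (dnf T) (proj₂ (proj₂ good T t₀≤T)) d (approx-⅓ {f = evalDNF (embed v≤ (dnf T))} approx))

theorem1p4 : (k : ℕ) → 1 ≤ k →
    Σ ((n : ℕ) → MDNF (n * lg n ^ (4 * k ∸ 4))) λ D →
    Σ ℕ λ n₀ → Σ ℕ λ C →
    ((n : ℕ) → n₀ ≤ n →
    widthAtMost (C * lg n ^ (2 * k ∸ 1)) (D n)
    × sizeAtMost (2 ^ (C * lg n ^ (2 * k))) (D n)
    × ((d : ℕ) → ApproxDegAtMost (evalDNF (D n)) d →
    n ^ (3 ^ k ∸ 2 ^ (k ∸ 1)) * lg n ^ (3 ^ (k + 1) ∸ 2 ^ (k + 2))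
    ≤ C * d ^ (3 ^ k)))
-- The family loses at most 1 / (2 · 3 ^ k) in the exponent of n, half of 1 / 3 ^ k; the statement
-- concedes at least 1 / 3 ^ k, and the rest covers the logarithms.
theorem1p4 k 1≤k with families (12 * 3 ^ k)
... | P , A , 1≤A , ratio , F = D , n₀ , C , λ n n₀≤n → bounds n n₀≤n (vars (t n) ≤? n * lg n ^ (4 * k ∸ 4))
  where
  open Bounds k 1≤k 1≤A ratio F
  open Family F using (vars)
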